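{- Let $G$ be a plane graph (multiple edges allowed) without isolated vertices, without self-loops, and without $2$-faces. Then there exist two disjoint subsets $V_1, V_2 \subseteq V(G)$ such that each of $V_1$ and $V_2$ is both a dominating set of $G$ and a face-hitting set of $G$.
   Context: All graphs are finite and undirected; a plane graph is a planar (multi)graph together with a crossing-free embedding in the plane. A dominating set of $G$ is a set $S\subseteq V(G)$ such that every vertex of $G$ not in $S$ has a neighbor in $S$. For a face $f$, $V(f)$ denotes the set of vertices on the boundary of $f$; a face-hitting set of $G$ is a set $T\subseteq V(G)$ with $T\cap V(f)\neq\emptyset$ for every face $f$ of $G$. If $G$ is disconnected, the boundary of a face may be a disjoint union of closed walks; the length of the face is the total length of these walks. A $k$-face is a face of length exactly $k$. -}

module Defs where

open import Data.Nat using (ℕ; zero; suc; _+_; _*_; _≤_)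
open import Data.Fin using (Fin; _≟_)
open import Data.Bool using (Bool; true; false)
open import Data.Product using (Σ; ∃; ∃-syntax; _×_; _,_)
open import Data.Sum using (_⊎_; inj₁; inj₂)
open import Relation.Nullary using (¬_)
open import Relation.Nullary.Decidable using (⌊_⌋)
open import Relation.Binary.PropositionalEquality using (_≡_; _≢_)
open import Relation.Binary.Construct.Closure.ReflexiveTransitive using (Star)
open import Data.Fin.Subset using (Subset; _∈_; _∉_)

iter : ∀ {A : Set} → (A → A) → ℕ → A → A
iter f zero x = x
iter f (suc k) x = f (iter f k x)

count : ∀ {n} → (Fin n → Bool) → ℕ
count {zero} p = 0
count {suc n} p with p Fin.zero
... | true  = suc (count {n} (λ i → p (Fin.suc i)))
... | false = count {n} (λ i → p (Fin.suc i))

-- Plane (multi)graphs, encoded combinatorially.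
--
-- Darts (half-edges) Fin nD; every edge consists of the two darts d, α d.
-- vert d is the vertex at which dart d starts; σ is the rotation (the cyclic
-- order of darts around each vertex in the embedding).  The face-tracing
-- permutation is φ = σ ∘ α; its orbits ("boundary walks") are Fin nO via orb.
-- Connected components are Fin nC via comp.  Since the graph may be
-- disconnected, a face of the plane embedding may be bounded by several
-- boundary walks (from different components); faceOf assigns each boundary
-- walk to the face of the plane it bounds.  The planarity conditions are:
--  * each component is a genus-0 map (Euler's formula V - E + F = 2),
--  * the bipartite incidence graph "components -- faces", with one edge per
--    boundary walk, is a tree (nesting of components inside faces):
--    a component meets each face in at most one boundary walk, this graph is
--    connected, and #faces = E - V + #components + 1.
-- These are exactly the combinatorial data of plane embeddings of graphs
-- (up to homeomorphism of the sphere/plane).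
record PlaneGraph : Set where
  field
    nV nD nC nO nF : ℕ
    vert   : Fin nD → Fin nV
    α      : Fin nD → Fin nD
    σ      : Fin nD → Fin nD
    comp   : Fin nV → Fin nC
    orb    : Fin nD → Fin nO
    compOf : Fin nO → Fin nC
    faceOf : Fin nO → Fin nF

  φ : Fin nD → Fin nD
  φ d = σ (α d)

  Adj : Fin nV → Fin nV → Set
  Adj v w = ∃[ d ] (vert d ≡ v × vert (α d) ≡ w)

  BAdj : Fin nC ⊎ Fin nF → Fin nC ⊎ Fin nF → Set
  BAdj x y = ∃[ o ] ((x ≡ inj₁ (compOf o) × y ≡ inj₂ (faceOf o))
                    ⊎ (x ≡ inj₂ (faceOf o) × y ≡ inj₁ (compOf o)))

  vertsIn : Fin nC → ℕ
  vertsIn c = count (λ v → ⌊ comp v ≟ c ⌋)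

  dartsIn : Fin nC → ℕ
  dartsIn c = count (λ d → ⌊ comp (vert d) ≟ c ⌋)

  orbitsIn : Fin nC → ℕ
  orbitsIn c = count (λ o → ⌊ compOf o ≟ c ⌋)

  field
    α-invol : ∀ d → α (α d) ≡ d
    α-fpf   : ∀ d → α d ≢ d
    σ-inj   : ∀ d d' → σ d ≡ σ d' → d ≡ d'
    σ-vert  : ∀ d → vert (σ d) ≡ vert d
    σ-cycle : ∀ d d' → vert d ≡ vert d' → ∃[ k ] (iter σ k d ≡ d')
    orb-φ    : ∀ d → orb (φ d) ≡ orb d
    orb-cyc  : ∀ d d' → orb d ≡ orb d' → ∃[ k ] (iter φ k d ≡ d')
    orb-surj : ∀ o → ∃[ d ] (orb d ≡ o)
    comp-edge : ∀ d → comp (vert (α d)) ≡ comp (vert d)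
    comp-conn : ∀ v w → comp v ≡ comp w → Star Adj v w
    comp-surj : ∀ c → ∃[ v ] (comp v ≡ c)
    compOf-orb : ∀ d → compOf (orb d) ≡ comp (vert d)
    -- each component is embedded in the sphere (V - E + F = 2, times 2)
    euler : ∀ c → 2 * vertsIn c + 2 * orbitsIn c ≡ dartsIn c + 4
    face-inj  : ∀ o o' → compOf o ≡ compOf o' → faceOf o ≡ faceOf o' → o ≡ o'
    tree-conn : ∀ x y → Star BAdj x y
    tree-count : 2 * nF + 2 * nV ≡ nD + 2 * nC + 2

  OnFace : Fin nF → Fin nV → Set
  OnFace f v = ∃[ d ] (faceOf (orb d) ≡ f × vert d ≡ v)

  faceLength : Fin nF → ℕ
  faceLength f = count (λ d → ⌊ faceOf (orb d) ≟ f ⌋)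

  NoIsolated : Set
  NoIsolated = ∀ v → ∃[ d ] (vert d ≡ v)

  NoLoops : Set
  NoLoops = ∀ d → vert (α d) ≢ vert d

  No2Faces : Set
  No2Faces = ∀ f → faceLength f ≢ 2

  Dominating : Subset nV → Set
  Dominating S = ∀ v → v ∉ S → ∃[ w ] (Adj v w × w ∈ S)

  FaceHitting : Subset nV → Set
  FaceHitting T = ∀ f → ∃[ v ] (OnFace f v × v ∈ T)

  Disjoint : Subset nV → Subset nV → Set
  Disjoint S T = ∀ v → v ∈ S → v ∉ T

{-# OPTIONS --safe #-}
module Submission where

open import Defs
open import Algebra.Bundles using (CommutativeMonoid; CommutativeRing)
import Algebra.Properties.CommutativeMonoid.Sum as MonoidSum
import Algebra.Properties.Semiring.Sum as SemiringSum
open import Data.Bool using (Bool; true; false; not; _∧_; _∨_; _xor_; if_then_else_)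
open import Data.Bool.Properties as Bool
  using (xor-∧-commutativeRing; ∧-comm; ∧-identityʳ; ∧-zeroʳ; ∧-distribˡ-xor; ∧-distribʳ-xor;
         xor-assoc; xor-comm; xor-same; xor-identityʳ)
open import Data.Bool.Solver using (module xor-∧-Solver)
open import Data.Empty using (⊥; ⊥-elim)
open import Data.Fin using (Fin; zero; suc; toℕ; fromℕ<; _≟_; _↑ˡ_; _↑ʳ_; splitAt; join; combine; finToFun; funToFin)
open import Data.Fin.Permutation using (permutation)
open import Data.Fin.Properties
  using (any?; all?; toℕ-injective; splitAt-↑ˡ; splitAt-↑ʳ; splitAt-join; join-splitAt;
         finToFun-funToFin; funToFin-finToFin; injective⇒≤)
open import Data.Fin.Subset using (Subset; _∈_)
open import Data.Fin.Subset.Properties using (anySubset?)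
open import Data.Nat as ℕ using (ℕ; zero; suc; _+_; _*_; _≤_; _<_; z≤n; s≤s; z<s)
open import Data.Nat.Properties as ℕ using ()
open import Data.Nat.Solver using (module +-*-Solver)
open import Data.Product using (∃-syntax; _×_; _,_; proj₁; proj₂)
open import Data.Sum as Sum using (_⊎_; inj₁; inj₂)
open import Data.Vec using (lookup; tabulate)
open import Data.Vec.Properties using (lookup∘tabulate; []=⇒lookup; lookup⇒[]=)
open import Function using (_∘_)
open import Relation.Binary using (tri<; tri≈; tri>)
open import Relation.Binary.Construct.Closure.ReflexiveTransitive using (Star; ε; _◅_)
open import Relation.Binary.PropositionalEquality
  using (_≡_; _≢_; _≗_; refl; sym; trans; cong; cong₂; subst; module ≡-Reasoning)
open import Relation.Nullary using (¬_; Dec; does; yes; no; contradiction)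
open import Relation.Nullary.Decidable using (⌊_⌋; dec-true; dec-false; isYes≗does; _×-dec_)

open xor-∧-Solver using (solve; _:+_; _:*_; _:=_; con)

-- A colouring V → 𝔽₂ is sought through its set x of bichromatic edges.  By planarity x comes from
-- a colouring as soon as it is even on every face walk (counting dimensions over 𝔽₂), and the
-- colouring can moreover be made to differ on two walks of the same face.  Call a corner u–v–w of a
-- face a cherry if u ≠ w; a face walk of length at least 3 without cherries would alternate between
-- two vertices, which planarity forbids.  One chooses cherries, no two of them consecutive on a
-- face, such that every vertex with two neighbours, except one root per component, is the middle of
-- a cherry and every walk that has cherries contains a chosen one.  Splitting off the two edges of
-- each chosen cherry in the dual graph leaves it bridgeless, because the star of u contains just
-- one of them.  So, as in Petersen's theorem, some even x meets every chosen cherry and contains a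
-- prescribed edge at the root.  The matching part is the min–max theorem for T-joins in bipartite
-- graphs, in the style of Sebő: odd cuts have at least three edges, hence some odd join uses at
-- most a third of the edges.

-- One vertex per component has to do without a cherry: in a triangle the three corners of a face
-- are pairwise consecutive, so the two faces admit two chosen cherries for three vertices. The
-- prescribed edge makes up for the root. A vertex with a single neighbour cannot be the middle of a
-- cherry either; it is recoloured afterwards, which is harmless because a face through it also
-- contains its neighbour. The even set is the complement of an odd join. A cherry node has degree
-- three, so every odd join spends an edge there; a join within a third of the total spends exactly
-- one, and at least one of the two edges of the cherry survives in the complement. The join theorem
-- is applied with a cost that only counts edges between two vertex classes. Contracting the
-- components of cost-free edges would leave a bipartite graph; instead the graph stays fixed, and a
-- contraction is recorded by changing the class of some vertices.

module 𝔽₂ = SemiringSum (CommutativeRing.semiring xor-∧-commutativeRing)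
module ℕΣ = SemiringSum ℕ.+-*-semiring

private variable
  n : ℕ

-- Boolean equality and Boolean predicates

infix 6 _==_
_==_ : Fin n → Fin n → Bool
i == j = does (i ≟ j)

==-refl : (i : Fin n) → i == i ≡ true
==-refl i = dec-true (i ≟ i) refl

==-≢ : {i j : Fin n} → i ≢ j → i == j ≡ false
==-≢ {i = i} {j} = dec-false (i ≟ j)

==⇒≡ : {i j : Fin n} → i == j ≡ true → i ≡ j
==⇒≡ {i = i} {j} p with i ≟ j
... | yes q = q

==-sym : (i j : Fin n) → i == j ≡ j == i
==-sym i j with i ≟ j
... | yes refl = sym (==-refl i)
... | no  i≢j = sym (==-≢ (i≢j ∘ sym))

true≢false : {b : Bool} → b ≡ true → b ≢ false
true≢false refl ()

bool-cases : (b : Bool) → b ≡ true ⊎ b ≡ false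
bool-cases true  = inj₁ refl
bool-cases false = inj₂ refl

≢true⇒≡false : {b : Bool} → b ≢ true → b ≡ false
≢true⇒≡false {true}  p = ⊥-elim (p refl)
≢true⇒≡false {false} p = refl

≢false⇒≡true : {b : Bool} → b ≢ false → b ≡ true
≢false⇒≡true {true}  p = refl
≢false⇒≡true {false} p = ⊥-elim (p refl)

∧-true : {x y : Bool} → x ∧ y ≡ true → x ≡ true × y ≡ true
∧-true {true} {true} _ = refl , refl

∧-intro : {x y : Bool} → x ≡ true → y ≡ true → x ∧ y ≡ true
∧-intro refl refl = refl

xor≡false : {x y : Bool} → x xor y ≡ false → x ≡ y
xor≡false {true}  {true}  _ = refl
xor≡false {false} {false} _ = refl

xor≡true : {x y : Bool} → x xor y ≡ true → (x ≡ true × y ≡ false) ⊎ (x ≡ false × y ≡ true)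
xor≡true {true}  {false} _ = inj₁ (refl , refl)
xor≡true {false} {true}  _ = inj₂ (refl , refl)

infixr 5 _⊻_
_⊻_ : {A : Set} → (A → Bool) → (A → Bool) → A → Bool
(p ⊻ q) x = p x xor q x

infix 4 _⊑_
_⊑_ : {A : Set} → (A → Bool) → (A → Bool) → Set
p ⊑ q = ∀ x → p x ≡ true → q x ≡ true

none : {A : Set} → A → Bool
none _ = false

all : {A : Set} → A → Bool
all _ = true

find : (p : Fin n → Bool) → (∃[ i ] p i ≡ true) ⊎ (∀ i → p i ≡ false)
find p with any? (λ i → p i Bool.≟ true)
... | yes found = inj₁ found
... | no  none′ = inj₂ λ i → ≢true⇒≡false λ q → none′ (i , q)

-- Sums over 𝔽₂ and cardinalities

⊕-sum : (Fin n → Bool) → Bool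
⊕-sum = 𝔽₂.sum

⊕-cong : {f g : Fin n → Bool} → f ≗ g → ⊕-sum f ≡ ⊕-sum g
⊕-cong = 𝔽₂.sum-cong-≗

⊕-none : {f : Fin n → Bool} → (∀ i → f i ≡ false) → ⊕-sum f ≡ false
⊕-none {n} f≡0 = trans (⊕-cong f≡0) (𝔽₂.sum-replicate-zero n)

⊕-xor : (f g : Fin n → Bool) → ⊕-sum (f ⊻ g) ≡ ⊕-sum f xor ⊕-sum g
⊕-xor = 𝔽₂.∑-distrib-+

⊕-single : (f : Fin n → Bool) (i : Fin n) → ⊕-sum (λ j → f j ∧ (i == j)) ≡ f i
⊕-single {suc n} f zero = trans
  (cong₂ _xor_ (∧-identityʳ (f zero)) (⊕-none {n} λ j → ∧-zeroʳ (f (suc j))))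
  (xor-identityʳ (f zero))
⊕-single f (suc i) = trans
  (cong (_xor ⊕-sum (λ j → f (suc j) ∧ (i == j))) (∧-zeroʳ (f zero)))
  (⊕-single (f ∘ suc) i)

⊕-single′ : (f : Fin n → Bool) (i : Fin n) → ⊕-sum (λ j → (i == j) ∧ f j) ≡ f i
⊕-single′ f i = trans (⊕-cong λ j → ∧-comm (i == j) (f j)) (⊕-single f i)

⊕-indicator : (i : Fin n) → ⊕-sum (i ==_) ≡ true
⊕-indicator i = trans (⊕-cong λ j → sym (∧-identityʳ (i == j))) (⊕-single′ all i)

⊕-witness : (p : Fin n → Bool) → ⊕-sum p ≡ true → ∃[ i ] p i ≡ true
⊕-witness p Σ≡1 with find p
... | inj₁ found = found
... | inj₂ p≡0 = contradiction (⊕-none p≡0) (true≢false Σ≡1)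

⟦_⟧ : Bool → ℕ
⟦ true ⟧ = 1
⟦ false ⟧ = 0

size : (Fin n → Bool) → ℕ
size p = ℕΣ.sum (⟦_⟧ ∘ p)

size-cong : {p q : Fin n → Bool} → p ≗ q → size p ≡ size q
size-cong p≗q = ℕΣ.sum-cong-≗ (cong ⟦_⟧ ∘ p≗q)

sum-mono : {f g : Fin n → ℕ} → (∀ i → f i ≤ g i) → ℕΣ.sum f ≤ ℕΣ.sum g
sum-mono {zero}  f≤g = z≤n
sum-mono {suc n} f≤g = ℕ.+-mono-≤ (f≤g zero) (sum-mono (f≤g ∘ suc))

-- Localises a global bound: a total that does not exceed the sum of the local minima is minimal at
-- every index.
sum-mono-tight : {f g : Fin n → ℕ} → (∀ i → f i ≤ g i) → ℕΣ.sum g ≤ ℕΣ.sum f → ∀ i → g i ≤ f i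
sum-mono-tight {suc n} {f} {g} f≤g Σg≤Σf zero =
  ℕ.+-cancelʳ-≤ _ _ _ (ℕ.≤-trans (ℕ.+-monoʳ-≤ (g zero) (sum-mono (f≤g ∘ suc))) Σg≤Σf)
sum-mono-tight {suc n} {f} {g} f≤g Σg≤Σf (suc i) =
  sum-mono-tight (f≤g ∘ suc) (ℕ.+-cancelˡ-≤ _ _ _ (ℕ.≤-trans (ℕ.+-monoˡ-≤ _ (f≤g zero)) Σg≤Σf)) i

⟦⟧-mono : {x y : Bool} → (x ≡ true → y ≡ true) → ⟦ x ⟧ ≤ ⟦ y ⟧
⟦⟧-mono {false} _ = z≤n
⟦⟧-mono {true} {true}  _ = ℕ.≤-refl
⟦⟧-mono {true} {false} h with () ← h refl

size-mono : {p q : Fin n → Bool} → p ⊑ q → size p ≤ size q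
size-mono p⊑q = sum-mono (λ i → ⟦⟧-mono (p⊑q i))

size-none : {p : Fin n → Bool} → (∀ i → p i ≡ false) → size p ≡ 0
size-none {n} p≡0 = trans (size-cong p≡0) (ℕΣ.sum-replicate-zero n)

-- Sets are edited by `⊻` with a singleton, so that insertion and deletion are one operation, to
-- which `∂` is linear; only sizes have to tell them apart.
size-insert : (p : Fin n → Bool) (i : Fin n) → p i ≡ false → size (p ⊻ (i ==_)) ≡ suc (size p)
size-insert p zero pi = cong₂ _+_ (cong (λ x → ⟦ x xor true ⟧) pi)
  (trans (size-cong λ j → xor-identityʳ (p (suc j))) (sym (cong (λ x → ⟦ x ⟧ + size (p ∘ suc)) pi)))
size-insert p (suc i) pi = trans
  (cong₂ _+_ (cong ⟦_⟧ (xor-identityʳ (p zero))) (size-insert (p ∘ suc) i pi))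
  (ℕ.+-suc ⟦ p zero ⟧ (size (p ∘ suc)))

size-delete : (p : Fin n → Bool) (i : Fin n) → p i ≡ true → size p ≡ suc (size (p ⊻ (i ==_)))
size-delete p i pi = trans
  (size-cong λ j → sym (trans (xor-assoc (p j) (i == j) (i == j))
                         (trans (cong (p j xor_) (xor-same (i == j))) (xor-identityʳ (p j)))))
  (size-insert (p ⊻ (i ==_)) i (trans (cong₂ _xor_ pi (==-refl i)) refl))

delete-⊑ : (p : Fin n → Bool) (i : Fin n) → p i ≡ true → p ⊻ (i ==_) ⊑ p
delete-⊑ p i pi j q with i ≟ j
... | yes refl = pi
... | no _ = trans (sym (xor-identityʳ (p j))) q

delete-≢ : (p : Fin n → Bool) (i j : Fin n) → p i ≡ true → (p ⊻ (i ==_)) j ≡ true → i ≢ j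
delete-≢ p i .i pi q refl = true≢false q (cong₂ _xor_ pi (==-refl i))

odd : ℕ → Bool
odd zero    = false
odd (suc k) = not (odd k)

odd-+ : ∀ j k → odd (j + k) ≡ odd j xor odd k
odd-+ zero k = refl
odd-+ (suc j) k = trans (cong not (odd-+ j k)) (Bool.not-distribˡ-xor (odd j) (odd k))

odd-size : (p : Fin n → Bool) → odd (size p) ≡ ⊕-sum p
odd-size {zero} p = refl
odd-size {suc n} p = trans (odd-+ ⟦ p zero ⟧ (size (p ∘ suc))) (cong₂ _xor_ (odd-⟦⟧ (p zero)) (odd-size (p ∘ suc)))
  where
  odd-⟦⟧ : ∀ b → odd ⟦ b ⟧ ≡ b
  odd-⟦⟧ true = refl
  odd-⟦⟧ false = refl

-- Parity turns a loss of at most one into no loss.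
odd-≤ : ∀ {j k} → odd j ≡ odd k → j ≤ suc k → j ≤ k
odd-≤ {j} {k} same j≤1+k with ℕ.m≤n⇒m<n∨m≡n j≤1+k
... | inj₁ (s≤s j≤k) = j≤k
... | inj₂ refl = contradiction same (not-≢ (odd k))
  where
  not-≢ : ∀ b → not b ≢ b
  not-≢ true ()
  not-≢ false ()

-- Small odd joins

module Graph {n m : ℕ} (a b : Fin m → Fin n) where

  -- A loop has incidence `false` everywhere and lies in no cut, so an edge can be made absent by
  -- giving it equal ends.
  inc : Fin m → Fin n → Bool
  inc e v = (a e == v) xor (b e == v)

  ∂ : (Fin m → Bool) → Fin n → Bool
  ∂ Z v = ⊕-sum (λ e → Z e ∧ inc e v)

  cut : (Fin n → Bool) → Fin m → Bool
  cut U e = U (a e) xor U (b e)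

  ∂-cong : ∀ {Z Z′} → Z ≗ Z′ → ∀ v → ∂ Z v ≡ ∂ Z′ v
  ∂-cong Z≗Z′ v = ⊕-cong (λ e → cong (_∧ inc e v) (Z≗Z′ e))

  ∂-none : ∀ v → ∂ none v ≡ false
  ∂-none v = ⊕-none {m} (λ e → refl)

  ∂-xor : ∀ Z Z′ v → ∂ (Z ⊻ Z′) v ≡ ∂ Z v xor ∂ Z′ v
  ∂-xor Z Z′ v = trans (⊕-cong λ e → ∧-distribʳ-xor (inc e v) (Z e) (Z′ e))
                       (⊕-xor (λ e → Z e ∧ inc e v) (λ e → Z′ e ∧ inc e v))

  ∂-single : ∀ e v → ∂ (e ==_) v ≡ inc e v
  ∂-single e v = ⊕-single′ (λ e′ → inc e′ v) e

  -- Exchange of summation: an edge of `Z` with both ends in `U` is counted twice and cancels.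
  handshake : ∀ Z U → ⊕-sum (λ e → Z e ∧ cut U e) ≡ ⊕-sum (λ v → U v ∧ ∂ Z v)
  handshake Z U = begin
    ⊕-sum (λ e → Z e ∧ cut U e)
      ≡⟨ ⊕-cong (λ e → cong (Z e ∧_) (cut-as-sum e)) ⟩
    ⊕-sum (λ e → Z e ∧ ⊕-sum (λ v → U v ∧ inc e v))
      ≡⟨ ⊕-cong (λ e → 𝔽₂.*-distribˡ-sum (Z e) (λ v → U v ∧ inc e v)) ⟩
    ⊕-sum (λ e → ⊕-sum (λ v → Z e ∧ (U v ∧ inc e v)))
      ≡⟨ 𝔽₂.∑-comm (λ e v → Z e ∧ (U v ∧ inc e v)) ⟩
    ⊕-sum (λ v → ⊕-sum (λ e → Z e ∧ (U v ∧ inc e v)))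
      ≡⟨ ⊕-cong (λ v → ⊕-cong (λ e → swap (Z e) (U v) (inc e v))) ⟩
    ⊕-sum (λ v → ⊕-sum (λ e → U v ∧ (Z e ∧ inc e v)))
      ≡⟨ ⊕-cong (λ v → sym (𝔽₂.*-distribˡ-sum (U v) (λ e → Z e ∧ inc e v))) ⟩
    ⊕-sum (λ v → U v ∧ ∂ Z v) ∎
    where
    open ≡-Reasoning
    swap : ∀ x y z → x ∧ (y ∧ z) ≡ y ∧ (x ∧ z)
    swap = solve 3 (λ x y z → x :* (y :* z) := y :* (x :* z)) refl
    cut-as-sum : ∀ e → cut U e ≡ ⊕-sum (λ v → U v ∧ inc e v)
    cut-as-sum e = sym (trans (⊕-cong λ v → ∧-distribˡ-xor (U v) (a e == v) (b e == v))
      (trans (⊕-xor (λ v → U v ∧ (a e == v)) (λ v → U v ∧ (b e == v)))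
             (cong₂ _xor_ (⊕-single U (a e)) (⊕-single U (b e)))))

  -- Keeps only the effect of the two ends on `inc` and `cut`, which makes the order of `a e` and
  -- `b e` irrelevant.
  Joins : Fin m → Fin n → Fin n → Set
  Joins e v w = (∀ x → inc e x ≡ (v == x) xor (w == x)) × (∀ U → cut U e ≡ U v xor U w)

  other-end : ∀ e v → inc e v ≡ true → ∃[ w ] Joins e v w
  other-end e v p with xor≡true p
  ... | inj₁ (q , _) with refl ← ==⇒≡ {i = a e} q = b e , (λ x → refl) , λ U → refl
  ... | inj₂ (_ , q) with refl ← ==⇒≡ {i = b e} q =
    a e , (λ x → xor-comm (a e == x) (b e == x)) , λ U → xor-comm (U (a e)) (U (b e))

  crossing : ∀ U e → cut U e ≡ true → ∃[ u ] ∃[ v ] (U u ≡ true × U v ≡ false × Joins e u v)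
  crossing U e p with xor≡true p
  ... | inj₁ (q , r) = a e , b e , q , r , (λ x → refl) , λ U → refl
  ... | inj₂ (q , r) = b e , a e , r , q ,
    (λ x → xor-comm (a e == x) (b e == x)) , λ U → xor-comm (U (a e)) (U (b e))

  record Walk (U : Fin n → Bool) (K : Fin m → Bool) (v : Fin n) : Set where
    field
      trail       : Fin m → Bool
      last entry  : Fin n
      edge        : Fin m
      trail⊑      : trail ⊑ K
      trail-avoid : ∀ e → trail e ≡ true → cut U e ≡ false
      ∂-trail     : ∀ x → ∂ trail x ≡ (v == x) xor (last == x)
      edge∈       : K edge ≡ true
      edge-joins  : Joins edge entry last
      entry∈      : U entry ≡ true
      last∉       : U last ≡ false

  abstract
    -- The last hypothesis makes `v` the only vertex outside `U` of odd `K`-degree. Deleting the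
    -- edge just traversed passes this role to its other end, so the walk cannot get stuck before it
    -- enters `U`, and `K` shrinks at each step.
    walk : ∀ U k K v → size K < k → U v ≡ false →
           (∀ x → U x ≡ false → ∂ K x ≡ (v == x)) → Walk U K v
    walk U (suc k) K v (s≤s K≤k) Uv ∂K
      with ⊕-witness (λ e → K e ∧ inc e v) (trans (∂K v Uv) (==-refl v))
    ... | e , q with ∧-true q
    ... | Ke , e∋v with other-end e v e∋v
    ... | w , (inc-e , cut-e) with bool-cases (U w)
    ... | inj₁ Uw = record
      { trail = none ; last = v ; entry = w ; edge = e
      ; trail⊑ = λ _ () ; trail-avoid = λ _ ()
      ; ∂-trail = λ x → trans (∂-none x) (sym (xor-same (v == x)))
      ; edge∈ = Ke
      ; edge-joins = (λ x → trans (inc-e x) (xor-comm (v == x) (w == x)))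
                   , (λ V → trans (cut-e V) (xor-comm (V v) (V w)))
      ; entry∈ = Uw ; last∉ = Uv }
    ... | inj₂ Uw = record
      { trail = W.trail ⊻ (e ==_) ; last = W.last ; entry = W.entry ; edge = W.edge
      ; trail⊑ = trail⊑ ; trail-avoid = avoid
      ; ∂-trail = λ x → begin
          ∂ (W.trail ⊻ (e ==_)) x ≡⟨ ∂-xor W.trail (e ==_) x ⟩
          ∂ W.trail x xor ∂ (e ==_) x ≡⟨ cong₂ _xor_ (W.∂-trail x) (trans (∂-single e x) (inc-e x)) ⟩
          ((w == x) xor (W.last == x)) xor ((v == x) xor (w == x))
            ≡⟨ solve 3 (λ w l v → (w :+ l) :+ (v :+ w) := v :+ l) refl (w == x) (W.last == x) (v == x) ⟩
          (v == x) xor (W.last == x) ∎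
      ; edge∈ = delete-⊑ K e Ke W.edge W.edge∈
      ; edge-joins = W.edge-joins ; entry∈ = W.entry∈ ; last∉ = W.last∉ }
      where
      open ≡-Reasoning
      ∂K-e : ∀ x → U x ≡ false → ∂ (K ⊻ (e ==_)) x ≡ (w == x)
      ∂K-e x Ux = begin
        ∂ (K ⊻ (e ==_)) x ≡⟨ ∂-xor K (e ==_) x ⟩
        ∂ K x xor ∂ (e ==_) x ≡⟨ cong₂ _xor_ (∂K x Ux) (trans (∂-single e x) (inc-e x)) ⟩
        (v == x) xor ((v == x) xor (w == x))
          ≡⟨ solve 2 (λ v w → v :+ (v :+ w) := w) refl (v == x) (w == x) ⟩
        (w == x) ∎
      rest : Walk U (K ⊻ (e ==_)) w
      rest = walk U k (K ⊻ (e ==_)) w (subst (_≤ k) (size-delete K e Ke) K≤k) Uw ∂K-e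
      module W = Walk rest
      trail⊑ : W.trail ⊻ (e ==_) ⊑ K
      trail⊑ f q with xor≡true q
      ... | inj₁ (p , _) = delete-⊑ K e Ke f (W.trail⊑ f p)
      ... | inj₂ (_ , p) = subst (λ e → K e ≡ true) (==⇒≡ p) Ke
      avoid : ∀ f → (W.trail ⊻ (e ==_)) f ≡ true → cut U f ≡ false
      avoid f q with xor≡true q
      ... | inj₁ (p , _) = W.trail-avoid f p
      ... | inj₂ (_ , p) = subst (λ e → cut U e ≡ false) (==⇒≡ p) (trans (cut-e U) (cong₂ _xor_ Uv Uw))

  -- A path is remembered by its edge set and its boundary only; the exchange arguments below need
  -- parities, never an order of the edges.
  record Link (free : Fin m → Bool) (u t : Fin n) : Set where
    constructor link
    field
      path   : Fin m → Bool
      path⊑  : path ⊑ free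
      ∂-path : ∀ x → ∂ path x ≡ (u == x) xor (t == x)

  -- `U` is the component of `t` in the subgraph of the `free` edges.
  record Cluster (free : Fin m → Bool) (t : Fin n) : Set where
    field
      U      : Fin n → Bool
      t∈     : U t ≡ true
      closed : ∀ e → free e ≡ true → cut U e ≡ false
      links  : ∀ u → U u ≡ true → Link free u t

  abstract
    cluster : ∀ free t → Cluster free t
    cluster free t = grow _ (t ==_) (==-refl t) start (ℕ.n<1+n _)
      where
      start : ∀ u → t == u ≡ true → Link free u t
      start u p with refl ← ==⇒≡ {i = t} p = link none (λ _ ()) λ x → trans (∂-none x) (sym (xor-same (t == x)))
      grow : ∀ k U → U t ≡ true → (∀ u → U u ≡ true → Link free u t) → size (not ∘ U) < k → Cluster free t
      grow (suc k) U t∈ links (s≤s bound) with find (λ e → free e ∧ cut U e)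
      ... | inj₂ none = record { U = U ; t∈ = t∈ ; closed = closed ; links = links }
        where
        closed : ∀ e → free e ≡ true → cut U e ≡ false
        closed e p = trans (sym (cong (_∧ cut U e) p)) (none e)
      ... | inj₁ (e , q) with ∧-true q
      ... | fe , ce with crossing U e ce
      ... | u , v , Uu , Uv , inc-e , _ = grow k (U ⊻ (v ==_)) t∈′ links′ bound′
        where
        t∈′ : U t xor (v == t) ≡ true
        t∈′ = cong₂ _xor_ t∈ (==-≢ {i = v} {t} λ { refl → true≢false t∈ Uv })
        bound′ : size (not ∘ (U ⊻ (v ==_))) < k
        bound′ = subst (_≤ k) (trans (size-delete (not ∘ U) v (cong not Uv))
          (cong suc (size-cong λ x → sym (Bool.not-distribˡ-xor (U x) (v == x))))) bound
        links′ : ∀ x → U x xor (v == x) ≡ true → Link free x t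
        links′ x p with xor≡true p
        ... | inj₁ (Ux , _) = links x Ux
        ... | inj₂ (_ , v≡x) with refl ← ==⇒≡ {i = v} v≡x = link (L.path ⊻ (e ==_)) path⊑ λ y → begin
          ∂ (L.path ⊻ (e ==_)) y ≡⟨ ∂-xor L.path (e ==_) y ⟩
          ∂ L.path y xor ∂ (e ==_) y ≡⟨ cong₂ _xor_ (L.∂-path y) (trans (∂-single e y) (inc-e y)) ⟩
          ((u == y) xor (t == y)) xor ((u == y) xor (v == y))
            ≡⟨ solve 3 (λ u t v → (u :+ t) :+ (u :+ v) := v :+ t) refl (u == y) (t == y) (v == y) ⟩
          (v == y) xor (t == y) ∎
          where
          open ≡-Reasoning
          module L = Link (links u Uu)
          path⊑ : L.path ⊻ (e ==_) ⊑ free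
          path⊑ f q with xor≡true q
          ... | inj₁ (r , _) = L.path⊑ f r
          ... | inj₂ (_ , r) = subst (λ e → free e ≡ true) (==⇒≡ r) fe

size-split : ∀ {n} (p q : Fin n → Bool) → q ⊑ p → size p ≡ size (p ⊻ q) + size q
size-split p q q⊑p = trans (ℕΣ.sum-cong-≗ λ i → split (p i) (q i) (q⊑p i))
                           (ℕΣ.∑-distrib-+ (λ i → ⟦ p i xor q i ⟧) (λ i → ⟦ q i ⟧))
  where
  split : ∀ x y → (y ≡ true → x ≡ true) → ⟦ x ⟧ ≡ ⟦ x xor y ⟧ + ⟦ y ⟧
  split x false _ = sym (trans (ℕ.+-identityʳ _) (cong ⟦_⟧ (xor-identityʳ x)))
  split true true _ = refl
  split false true h with () ← h refl

⊻-⊑ : ∀ {A : Set} {p q r : A → Bool} → p ⊑ r → q ⊑ r → p ⊻ q ⊑ r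
⊻-⊑ p⊑r q⊑r x h with xor≡true h
... | inj₁ (px , _) = p⊑r x px
... | inj₂ (_ , qx) = q⊑r x qx

single-⊑ : ∀ {n} {p : Fin n → Bool} {i} → p i ≡ true → (i ==_) ⊑ p
single-⊑ {p = p} pi j h = subst (λ j → p j ≡ true) (==⇒≡ h) pi

size-witness : ∀ {n} (p : Fin n → Bool) → 1 ≤ size p → ∃[ i ] p i ≡ true
size-witness p 1≤ with find p
... | inj₁ found = found
... | inj₂ p≡0 = contradiction (subst (1 ≤_) (size-none p≡0) 1≤) λ ()

module TJoin {n m : ℕ} (a b : Fin m → Fin n) where
  open Graph a b

  cost : (Fin n → Bool) → (Fin m → Bool) → ℕ
  cost cl F = size (λ e → F e ∧ cut cl e)

  Even : (Fin m → Bool) → Set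
  Even Z = ∀ v → ∂ Z v ≡ false

  -- Any even set through `e` replaces a circuit. Only charged edges are required to have one.
  Bridgeless : (Fin n → Bool) → Set
  Bridgeless cl = ∀ e → cut cl e ≡ true → ∃[ Z ] (Z e ≡ true × Even Z)

  -- A `T`-join for the set `T` of vertices of odd degree; equivalently, the complement of `J` is
  -- even.
  OddJoin : (Fin m → Bool) → Set
  OddJoin J = ∀ v → ∂ J v ≡ ∂ all v

  -- An edge is charged when it joins the two classes; the others are free.
  SmallJoin : (Fin n → Bool) → Set
  SmallJoin cl = ∃[ J ] (OddJoin J × 3 * cost cl J ≤ size (cut cl))

  -- An odd join with defects at `s` and `t`: the state of a search for a cheaper join, in which the
  -- defect `t` is moved around until it meets `s` at no cost.
  NearJoin : (Fin m → Bool) → Fin n → Fin n → Set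
  NearJoin F s t = ∀ x → ∂ F x ≡ ∂ all x xor ((s == x) xor (t == x))

  cut-⊻ : ∀ U V e → cut (U ⊻ V) e ≡ cut U e xor cut V e
  cut-⊻ U V e = solve 4 (λ p q r s → (p :+ q) :+ (r :+ s) := (p :+ r) :+ (q :+ s)) refl
    (U (a e)) (V (a e)) (U (b e)) (V (b e))

  cut-joins : ∀ U {e u v} → Joins e u v → U u ≡ true → U v ≡ false → cut U e ≡ true
  cut-joins U (_ , cut-e) Uu Uv = trans (cut-e U) (cong₂ _xor_ Uu Uv)

  Ignored : (Fin n → Bool) → (Fin m → Bool) → Set
  Ignored cl X = ∀ e → X e ≡ true → cut cl e ≡ false

  cost-ignored : ∀ cl F X → Ignored cl X → cost cl (F ⊻ X) ≡ cost cl F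
  cost-ignored cl F X ignored = size-cong λ e → pointwise (F e) (X e) (cut cl e) (ignored e)
    where
    pointwise : ∀ f x c → (x ≡ true → c ≡ false) → (f xor x) ∧ c ≡ f ∧ c
    pointwise f false c _ = cong (_∧ c) (xor-identityʳ f)
    pointwise f true c h with refl ← h refl = trans (∧-zeroʳ (f xor true)) (sym (∧-zeroʳ f))

  toggle-∧ : ∀ cl F e → cut cl e ≡ true →
             ∀ j → (F ⊻ (e ==_)) j ∧ cut cl j ≡ ((λ i → F i ∧ cut cl i) ⊻ (e ==_)) j
  toggle-∧ cl F e ce j = trans (∧-distribʳ-xor (cut cl j) (F j) (e == j))
                               (cong ((F j ∧ cut cl j) xor_) absorb)
    where
    absorb : (e == j) ∧ cut cl j ≡ e == j
    absorb with e ≟ j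
    ... | yes refl = ce
    ... | no _ = refl

  cost-insert : ∀ cl F e → cut cl e ≡ true → F e ≡ false → cost cl (F ⊻ (e ==_)) ≡ suc (cost cl F)
  cost-insert cl F e ce Fe = trans (size-cong (toggle-∧ cl F e ce))
    (size-insert (λ j → F j ∧ cut cl j) e (cong (_∧ cut cl e) Fe))

  cost-delete : ∀ cl F e → cut cl e ≡ true → F e ≡ true → cost cl F ≡ suc (cost cl (F ⊻ (e ==_)))
  cost-delete cl F e ce Fe = trans (size-delete (λ j → F j ∧ cut cl j) e (∧-intro Fe ce))
    (cong suc (size-cong λ j → sym (toggle-∧ cl F e ce j)))

  even-meets-cut : ∀ Z U → Even Z → ⊕-sum (λ e → Z e ∧ cut U e) ≡ false
  even-meets-cut Z U even = trans (handshake Z U)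
    (⊕-none λ v → trans (cong (U v ∧_) (even v)) (∧-zeroʳ (U v)))

  free : (Fin n → Bool) → Fin m → Bool
  free cl = not ∘ cut cl

  ⊑free⇒ignored : ∀ cl {X} → X ⊑ free cl → Ignored cl X
  ⊑free⇒ignored cl X⊑ e Xe with cut cl e | X⊑ e Xe
  ... | false | _ = refl

  -- The cluster U of t under free edges is left by F only at the price of an improvement; if F
  -- avoids δU, then |δU| is odd and U is contracted into its surroundings by flipping its class,
  -- which frees exactly the edges of δU.
  module Separated (cl : Fin n → Bool) (F : Fin m → Bool) (s t : Fin n) (near : NearJoin F s t)
                   (C : Cluster (free cl) t) (s∉U : Cluster.U C s ≡ false)
                   (F∩δU : ∀ e → F e ∧ cut (Cluster.U C) e ≡ false) where
    open Cluster C

    cl′ : Fin n → Bool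
    cl′ = cl ⊻ U

    δU⊑cut : cut U ⊑ cut cl
    δU⊑cut e Ue with bool-cases (cut cl e)
    ... | inj₁ ce = ce
    ... | inj₂ ce = contradiction (closed e (cong not ce)) (true≢false Ue)

    cut′ : ∀ e → cut cl′ e ≡ cut cl e xor cut U e
    cut′ = cut-⊻ cl U

    δU-ignored : ∀ {e} → cut U e ≡ true → cut cl′ e ≡ false
    δU-ignored {e} Ue = trans (cut′ e) (cong₂ _xor_ (δU⊑cut e Ue) Ue)

    cut′⊑cut : cut cl′ ⊑ cut cl
    cut′⊑cut e c′ with xor≡true (trans (sym (cut′ e)) c′)
    ... | inj₁ (ce , _) = ce
    ... | inj₂ (_ , Ue) = δU⊑cut e Ue

    bridgeless′ : Bridgeless cl → Bridgeless cl′
    bridgeless′ bridgeless e c′ = bridgeless e (cut′⊑cut e c′)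

    size-cut : size (cut cl) ≡ size (cut cl′) + size (cut U)
    size-cut = trans (size-split (cut cl) (cut U) δU⊑cut)
                     (cong (_+ size (cut U)) (size-cong λ e → sym (cut′ e)))

    cost-split : ∀ J → cost cl J ≡ cost cl′ J + size (λ e → J e ∧ cut U e)
    cost-split J = trans
      (size-split (λ e → J e ∧ cut cl e) (λ e → J e ∧ cut U e)
        λ e h → let (Je , Ue) = ∧-true h in ∧-intro Je (δU⊑cut e Ue))
      (cong (_+ size (λ e → J e ∧ cut U e)) (size-cong λ e →
        sym (trans (cong (J e ∧_) (cut′ e)) (∧-distribˡ-xor (J e) (cut cl e) (cut U e)))))

    cost-avoiding : ∀ J → (∀ e → J e ∧ cut U e ≡ false) → cost cl′ J ≡ cost cl J
    cost-avoiding J avoid = sym (trans (cost-split J)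
      (trans (cong (cost cl′ J +_) (size-none avoid)) (ℕ.+-identityʳ _)))

    -- The degrees in `U` agree with those of `F` up to the defects, of which only `t` lies in `U`;
    -- and the `F`-degrees in `U` have even sum because `F` avoids `δU`.
    odd-cut : ⊕-sum (cut U) ≡ true
    odd-cut = begin
      ⊕-sum (cut U) ≡⟨ handshake all U ⟩
      ⊕-sum (λ v → U v ∧ ∂ all v) ≡⟨ ⊕-cong (λ v → cong (U v ∧_) (∂all v)) ⟩
      ⊕-sum (λ v → U v ∧ (∂ F v xor ((s == v) xor (t == v))))
        ≡⟨ ⊕-cong (λ v → distrib (U v) (∂ F v) (s == v) (t == v)) ⟩
      ⊕-sum (λ v → (U v ∧ ∂ F v) xor ((U v ∧ (s == v)) xor (U v ∧ (t == v))))
        ≡⟨ trans (⊕-xor (λ v → U v ∧ ∂ F v) (λ v → (U v ∧ (s == v)) xor (U v ∧ (t == v))))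
             (cong (⊕-sum (λ v → U v ∧ ∂ F v) xor_) (⊕-xor (λ v → U v ∧ (s == v)) (λ v → U v ∧ (t == v)))) ⟩
      ⊕-sum (λ v → U v ∧ ∂ F v) xor (⊕-sum (λ v → U v ∧ (s == v)) xor ⊕-sum (λ v → U v ∧ (t == v)))
        ≡⟨ cong₂ _xor_ (trans (sym (handshake F U)) (⊕-none F∩δU))
             (cong₂ _xor_ (trans (⊕-single U s) s∉U) (trans (⊕-single U t) t∈)) ⟩
      true ∎
      where
      open ≡-Reasoning
      ∂all : ∀ v → ∂ all v ≡ ∂ F v xor ((s == v) xor (t == v))
      ∂all v = sym (trans (cong (_xor ((s == v) xor (t == v))) (near v))
        (trans (xor-assoc (∂ all v) _ _) (trans (cong (∂ all v xor_) (xor-same ((s == v) xor (t == v)))) (xor-identityʳ _))))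
      distrib : ∀ u f x y → u ∧ (f xor (x xor y)) ≡ (u ∧ f) xor ((u ∧ x) xor (u ∧ y))
      distrib = solve 4 (λ u f x y → u :* (f :+ (x :+ y)) := (u :* f) :+ ((u :* x) :+ (u :* y))) refl

    module ThreeCut (e : Fin m) (Ue : cut U e ≡ true) (Z : Fin m → Bool) (Ze : Z e ≡ true) (even : Even Z) where
      zU rest : Fin m → Bool
      zU e = Z e ∧ cut U e
      rest = cut U ⊻ (e ==_)

      second : ∃[ e′ ] (zU ⊻ (e ==_)) e′ ≡ true
      second = ⊕-witness (zU ⊻ (e ==_)) (trans (⊕-xor zU (e ==_))
        (cong₂ _xor_ (even-meets-cut Z U even) (⊕-indicator e)))

      e′ : Fin m
      e′ = proj₁ second

      rest-e′ : rest e′ ≡ true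
      rest-e′ = cong₂ _xor_ (proj₂ (∧-true {Z e′} (delete-⊑ zU e (∧-intro Ze Ue) e′ (proj₂ second))))
                            (==-≢ (delete-≢ zU e e′ (∧-intro Ze Ue) (proj₂ second)))

      third : ∃[ e″ ] (rest ⊻ (e′ ==_)) e″ ≡ true
      third = ⊕-witness (rest ⊻ (e′ ==_)) (trans (⊕-xor rest (e′ ==_))
        (cong₂ _xor_ (trans (⊕-xor (cut U) (e ==_)) (cong₂ _xor_ odd-cut (⊕-indicator e))) (⊕-indicator e′)))

      3≤ : 3 ≤ size (cut U)
      3≤ = ℕ.≤-trans (s≤s (s≤s (s≤s z≤n))) (ℕ.≤-reflexive (sym (trans (size-delete (cut U) e Ue)
        (cong suc (trans (size-delete rest e′ rest-e′)
          (cong suc (size-delete (rest ⊻ (e′ ==_)) (proj₁ third) (proj₂ third))))))))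

    -- An even set through one edge of `δU` crosses `δU` a second time, and an odd number above one
    -- is at least three. This is the origin of the constant 3 in `SmallJoin`.
    three-cut : Bridgeless cl → 3 ≤ size (cut U)
    three-cut bridgeless = ThreeCut.3≤ (proj₁ edge) (proj₂ edge)
        (proj₁ circuit) (proj₁ (proj₂ circuit)) (proj₂ (proj₂ circuit))
      where
      edge : ∃[ e ] cut U e ≡ true
      edge = ⊕-witness (cut U) odd-cut
      circuit : ∃[ Z ] (Z (proj₁ edge) ≡ true × Even Z)
      circuit = bridgeless (proj₁ edge) (δU⊑cut (proj₁ edge) (proj₂ edge))

    Better : Set
    Better = ∃[ F′ ] ∃[ s′ ] ∃[ t′ ] (NearJoin F′ s′ t′ × cost cl F′ < cost cl F)

    -- The `suc` pays for a single edge of `δU` in the join: it is free for `cl′` but charged for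
    -- `cl`.
    Uncontracted : ℕ → Set
    Uncontracted c = ∃[ J ] (OddJoin J × cost cl J ≤ suc c)

    -- J crosses δU at least twice.  J + F contains a path from s into U, and another one that
    -- leaves U by e₁ and comes back by e₂: exchanging along the latter improves F or lets J cross
    -- δU two times less, a loss of one on F being impossible by parity.
    module Detour (J : Fin m → Bool) (∂J : OddJoin J) (2≤ : 2 ≤ size (λ e → J e ∧ cut U e)) where
      K c : Fin m → Bool
      K = J ⊻ F
      c e = J e ∧ cut U e

      ∂K : ∀ x → ∂ K x ≡ (s == x) xor (t == x)
      ∂K x = trans (∂-xor J F x) (trans (cong₂ _xor_ (∂J x) (near x))
        (solve 2 (λ A B → A :+ (A :+ B) := B) refl (∂ all x) ((s == x) xor (t == x))))

      outside : ∀ {u x} → U u ≡ true → U x ≡ false → u == x ≡ false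
      outside {u} {x} Uu Ux = ==-≢ λ u≡x → true≢false (subst (λ y → U y ≡ true) u≡x Uu) Ux

      F∌ : ∀ {e} → cut U e ≡ true → F e ≡ false
      F∌ {e} Ue = ≢true⇒≡false λ Fe → true≢false (∧-intro Fe Ue) (F∩δU e)

      K⇒J : ∀ {e} → cut U e ≡ true → K e ≡ true → J e ≡ true
      K⇒J {e} Ue Ke = trans (sym (trans (cong (J e xor_) (F∌ Ue)) (xor-identityʳ (J e)))) Ke

      ∂K-outside : ∀ x → U x ≡ false → ∂ K x ≡ (s == x)
      ∂K-outside x Ux = trans (∂K x) (trans (cong ((s == x) xor_) (outside t∈ Ux)) (xor-identityʳ (s == x)))

      walk₀ : Walk U K s
      walk₀ = walk U (suc (size K)) K s (ℕ.n<1+n (size K)) s∉U ∂K-outside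

      module W₀ = Walk walk₀

      e₀ : Fin m
      e₀ = W₀.edge

      Ue₀ : cut U e₀ ≡ true
      Ue₀ = cut-joins U W₀.edge-joins W₀.entry∈ W₀.last∉

      ce₀ : c e₀ ≡ true
      ce₀ = ∧-intro (K⇒J Ue₀ W₀.edge∈) Ue₀

      another : ∃[ e₁ ] (c ⊻ (e₀ ==_)) e₁ ≡ true
      another = size-witness (c ⊻ (e₀ ==_)) (ℕ.≤-pred (subst (2 ≤_) (size-delete c e₀ ce₀) 2≤))

      e₁ : Fin m
      e₁ = proj₁ another

      ce₁ : c e₁ ≡ true
      ce₁ = delete-⊑ c e₀ ce₀ e₁ (proj₂ another)

      Ue₁ : cut U e₁ ≡ true
      Ue₁ = proj₂ (∧-true {J e₁} ce₁)

      -- Without the first walk every vertex outside `U` has even degree in `K₁`. Deleting `e₁` as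
      -- well makes its outer end `v₁` the only odd one, which is what a second walk needs; that
      -- walk cannot use `e₁` again.
      K₁ K₂ : Fin m → Bool
      K₁ = K ⊻ (W₀.trail ⊻ (e₀ ==_))
      K₂ = K₁ ⊻ (e₁ ==_)

      trail₀∌ : ∀ {e} → cut U e ≡ true → W₀.trail e ≡ false
      trail₀∌ {e} Ue = ≢true⇒≡false λ h → true≢false Ue (W₀.trail-avoid e h)

      K₁e₁ : K₁ e₁ ≡ true
      K₁e₁ = cong₂ _xor_ (cong₂ _xor_ (proj₁ (∧-true {J e₁} ce₁)) (F∌ Ue₁))
                         (cong₂ _xor_ (trail₀∌ Ue₁) (==-≢ (delete-≢ c e₀ e₁ ce₀ (proj₂ another))))

      K₁⊑K : K₁ ⊑ K
      K₁⊑K = ⊻-⊑ (λ _ h → h) (⊻-⊑ W₀.trail⊑ (single-⊑ W₀.edge∈))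

      K₂⊑K : K₂ ⊑ K
      K₂⊑K e h = K₁⊑K e (delete-⊑ K₁ e₁ K₁e₁ e h)

      ends₁ : ∃[ u ] ∃[ v ] (U u ≡ true × U v ≡ false × Joins e₁ u v)
      ends₁ = crossing U e₁ Ue₁

      u₁ v₁ : Fin n
      u₁ = proj₁ ends₁
      v₁ = proj₁ (proj₂ ends₁)

      u₁∈ : U u₁ ≡ true
      u₁∈ = proj₁ (proj₂ (proj₂ ends₁))

      v₁∉ : U v₁ ≡ false
      v₁∉ = proj₁ (proj₂ (proj₂ (proj₂ ends₁)))

      inc-e₁ : ∀ x → inc e₁ x ≡ (u₁ == x) xor (v₁ == x)
      inc-e₁ = proj₁ (proj₂ (proj₂ (proj₂ (proj₂ ends₁))))

      ∂K₂ : ∀ x → U x ≡ false → ∂ K₂ x ≡ (v₁ == x)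
      ∂K₂ x Ux = begin
        ∂ K₂ x ≡⟨ ∂-xor K₁ (e₁ ==_) x ⟩
        ∂ K₁ x xor ∂ (e₁ ==_) x ≡⟨ cong₂ _xor_ (∂-xor K (W₀.trail ⊻ (e₀ ==_)) x) (trans (∂-single e₁ x) (inc-e₁ x)) ⟩
        (∂ K x xor ∂ (W₀.trail ⊻ (e₀ ==_)) x) xor ((u₁ == x) xor (v₁ == x))
          ≡⟨ cong (_xor ((u₁ == x) xor (v₁ == x))) (cong₂ _xor_ (∂K x) (∂-xor W₀.trail (e₀ ==_) x)) ⟩
        (((s == x) xor (t == x)) xor (∂ W₀.trail x xor ∂ (e₀ ==_) x)) xor ((u₁ == x) xor (v₁ == x))
          ≡⟨ cong (λ y → (((s == x) xor (t == x)) xor y) xor ((u₁ == x) xor (v₁ == x)))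
               (cong₂ _xor_ (W₀.∂-trail x) (trans (∂-single e₀ x) (proj₁ W₀.edge-joins x))) ⟩
        (((s == x) xor (t == x)) xor (((s == x) xor (W₀.last == x)) xor ((W₀.entry == x) xor (W₀.last == x)))) xor ((u₁ == x) xor (v₁ == x))
          ≡⟨ solve 6 (λ s t l n u v → ((s :+ t) :+ ((s :+ l) :+ (n :+ l))) :+ (u :+ v) := t :+ (n :+ (u :+ v))) refl
               (s == x) (t == x) (W₀.last == x) (W₀.entry == x) (u₁ == x) (v₁ == x) ⟩
        (t == x) xor ((W₀.entry == x) xor ((u₁ == x) xor (v₁ == x)))
          ≡⟨ cong₂ _xor_ (outside t∈ Ux) (cong₂ _xor_ (outside W₀.entry∈ Ux) (cong (_xor (v₁ == x)) (outside u₁∈ Ux))) ⟩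
        (v₁ == x) ∎
        where open ≡-Reasoning

      walk₁ : Walk U K₂ v₁
      walk₁ = walk U (suc (size K₂)) K₂ v₁ (ℕ.n<1+n (size K₂)) v₁∉ ∂K₂

      module W = Walk walk₁

      Q : Fin m → Bool
      Q = W.trail

      e₂ : Fin m
      e₂ = W.edge

      u₂ v₂ : Fin n
      u₂ = W.entry
      v₂ = W.last

      Ue₂ : cut U e₂ ≡ true
      Ue₂ = cut-joins U W.edge-joins W.entry∈ W.last∉

      module P₁ = Link (links u₁ u₁∈)
      module P₂ = Link (links u₂ W.entry∈)

      Q∌ : ∀ {e} → cut U e ≡ true → Q e ≡ false
      Q∌ {e} Ue = ≢true⇒≡false λ h → true≢false Ue (W.trail-avoid e h)

      -- `Z` is the closed detour: out of `U` by `e₁`, along `Q`, back by `e₂`, and through `t`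
      -- along the two free paths. `F′` moves the defect of `F` from `t` to `v₁`, and `G` is `F′`
      -- without the charged edge `e₂` and the free path.
      G F′ R Z : Fin m → Bool
      G = F ⊻ Q
      F′ = (G ⊻ (e₂ ==_)) ⊻ P₂.path
      R = (e₁ ==_) ⊻ ((e₂ ==_) ⊻ (P₁.path ⊻ P₂.path))
      Z = Q ⊻ R

      near′ : NearJoin F′ s v₁
      near′ x = begin
        ∂ F′ x ≡⟨ ∂-xor (G ⊻ (e₂ ==_)) P₂.path x ⟩
        ∂ (G ⊻ (e₂ ==_)) x xor ∂ P₂.path x ≡⟨ cong (_xor ∂ P₂.path x) (trans (∂-xor G (e₂ ==_) x) (cong (_xor ∂ (e₂ ==_) x) (∂-xor F Q x))) ⟩
        ((∂ F x xor ∂ Q x) xor ∂ (e₂ ==_) x) xor ∂ P₂.path x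
          ≡⟨ cong₂ _xor_ (cong₂ _xor_ (cong₂ _xor_ (near x) (W.∂-trail x))
               (trans (∂-single e₂ x) (proj₁ W.edge-joins x))) (P₂.∂-path x) ⟩
        (((∂ all x xor ((s == x) xor (t == x))) xor ((v₁ == x) xor (v₂ == x))) xor ((u₂ == x) xor (v₂ == x))) xor ((u₂ == x) xor (t == x))
          ≡⟨ solve 6 (λ A s t v w u → (((A :+ (s :+ t)) :+ (v :+ w)) :+ (u :+ w)) :+ (u :+ t) := A :+ (s :+ v)) refl
               (∂ all x) (s == x) (t == x) (v₁ == x) (v₂ == x) (u₂ == x) ⟩
        ∂ all x xor ((s == x) xor (v₁ == x)) ∎
        where open ≡-Reasoning

      cost-F′ : cost cl F′ ≡ suc (cost cl G)
      cost-F′ = trans (cost-ignored cl (G ⊻ (e₂ ==_)) P₂.path (⊑free⇒ignored cl P₂.path⊑))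
        (cost-insert cl G e₂ (δU⊑cut e₂ Ue₂) (cong₂ _xor_ (F∌ Ue₂) (Q∌ Ue₂)))

      even-Z : Even Z
      even-Z x = begin
        ∂ Z x ≡⟨ trans (∂-xor Q R x) (cong (∂ Q x xor_) (trans (∂-xor (e₁ ==_) _ x) (cong (∂ (e₁ ==_) x xor_)
                   (trans (∂-xor (e₂ ==_) _ x) (cong (∂ (e₂ ==_) x xor_) (∂-xor P₁.path P₂.path x)))))) ⟩
        ∂ Q x xor (∂ (e₁ ==_) x xor (∂ (e₂ ==_) x xor (∂ P₁.path x xor ∂ P₂.path x)))
          ≡⟨ cong₂ _xor_ (W.∂-trail x) (cong₂ _xor_ (trans (∂-single e₁ x) (inc-e₁ x))
               (cong₂ _xor_ (trans (∂-single e₂ x) (proj₁ W.edge-joins x)) (cong₂ _xor_ (P₁.∂-path x) (P₂.∂-path x)))) ⟩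
        ((v₁ == x) xor (v₂ == x)) xor (((u₁ == x) xor (v₁ == x)) xor (((u₂ == x) xor (v₂ == x)) xor (((u₁ == x) xor (t == x)) xor ((u₂ == x) xor (t == x)))))
          ≡⟨ solve 5 (λ v w u y t → (v :+ w) :+ ((u :+ v) :+ ((y :+ w) :+ ((u :+ t) :+ (y :+ t)))) := con false) refl
               (v₁ == x) (v₂ == x) (u₁ == x) (u₂ == x) (t == x) ⟩
        false ∎
        where open ≡-Reasoning

      parity : (Fin m → Bool) → Bool
      parity X = ⊕-sum (λ e → X e ∧ cut cl e)

      parity-⊻ : ∀ X Y → parity (X ⊻ Y) ≡ parity X xor parity Y
      parity-⊻ X Y = trans (⊕-cong λ e → ∧-distribʳ-xor (cut cl e) (X e) (Y e))
        (⊕-xor (λ e → X e ∧ cut cl e) (λ e → Y e ∧ cut cl e))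

      parity-single : ∀ {e} → cut U e ≡ true → parity (e ==_) ≡ true
      parity-single {e} Ue = trans (⊕-single′ (cut cl) e) (δU⊑cut e Ue)

      parity-free : ∀ {X} → X ⊑ free cl → parity X ≡ false
      parity-free {X} X⊑ = ⊕-none λ e → ≢true⇒≡false λ h →
        let (Xe , ce) = ∧-true {X e} h in true≢false ce (⊑free⇒ignored cl X⊑ e Xe)

      -- The even set `Z` meets the charged edges an even number of times; apart from `Q` it has the
      -- two charged edges `e₁`, `e₂` and otherwise free ones.
      even-Q : parity Q ≡ false
      even-Q = begin
        parity Q ≡⟨ xor-identityʳ _ ⟨
        parity Q xor (true xor (true xor (false xor false)))
          ≡⟨ cong (parity Q xor_) (cong₂ _xor_ (parity-single Ue₁) (cong₂ _xor_ (parity-single Ue₂)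
               (cong₂ _xor_ (parity-free P₁.path⊑) (parity-free P₂.path⊑)))) ⟨
        parity Q xor (parity (e₁ ==_) xor (parity (e₂ ==_) xor (parity P₁.path xor parity P₂.path)))
          ≡⟨ trans (parity-⊻ Q R) (cong (parity Q xor_) (trans (parity-⊻ (e₁ ==_) _) (cong (parity (e₁ ==_) xor_)
                   (trans (parity-⊻ (e₂ ==_) _) (cong (parity (e₂ ==_) xor_) (parity-⊻ P₁.path P₂.path)))))) ⟨
        parity Z ≡⟨ even-meets-cut Z cl even-Z ⟩
        false ∎
        where open ≡-Reasoning

      cost-G-parity : odd (cost cl F) ≡ odd (cost cl G)
      cost-G-parity = trans (odd-size (λ e → F e ∧ cut cl e)) (trans
        (sym (trans (parity-⊻ F Q) (trans (cong (parity F xor_) even-Q) (xor-identityʳ _))))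
        (sym (odd-size (λ e → G e ∧ cut cl e))))

      J′ : Fin m → Bool
      J′ = (J ⊻ Q) ⊻ R

      ∂J′ : OddJoin J′
      ∂J′ v = trans (∂-cong (λ e → xor-assoc (J e) (Q e) (R e)) v)
        (trans (∂-xor J Z v) (trans (cong₂ _xor_ (∂J v) (even-Z v)) (xor-identityʳ _)))

      path∌ : ∀ {X} → X ⊑ free cl → ∀ {e} → cut U e ≡ true → X e ≡ false
      path∌ X⊑ {e} Ue = ≢true⇒≡false λ Xe → true≢false Ue (closed e (X⊑ e Xe))

      R-ignored : Ignored cl′ R
      R-ignored = ignored-⊻ (single (Ue₁)) (ignored-⊻ (single Ue₂) (ignored-⊻ (path P₁.path⊑) (path P₂.path⊑)))
        where
        ignored-⊻ : ∀ {X Y} → Ignored cl′ X → Ignored cl′ Y → Ignored cl′ (X ⊻ Y)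
        ignored-⊻ X-ign Y-ign e h with xor≡true h
        ... | inj₁ (Xe , _) = X-ign e Xe
        ... | inj₂ (_ , Ye) = Y-ign e Ye
        single : ∀ {e} → cut U e ≡ true → Ignored cl′ (e ==_)
        single Ue f h = subst (λ e → cut cl′ e ≡ false) (==⇒≡ h) (δU-ignored Ue)
        path : ∀ {X} → X ⊑ free cl → Ignored cl′ X
        path X⊑ e Xe = ≢true⇒≡false λ c′ → true≢false (cut′⊑cut e c′) (⊑free⇒ignored cl X⊑ e Xe)

      -- `Q` lies in `J ⊻ F`, so each of its edges belongs to exactly one of `J` and `F`, and
      -- toggling both along `Q` hands it over to the other.
      exchange : cost cl′ (J ⊻ Q) + cost cl′ G ≡ cost cl′ J + cost cl′ F
      exchange = trans (sym (ℕΣ.∑-distrib-+ (λ e → ⟦ (J ⊻ Q) e ∧ cut cl′ e ⟧) (λ e → ⟦ G e ∧ cut cl′ e ⟧)))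
        (trans (ℕΣ.sum-cong-≗ λ e → swap (J e) (F e) (Q e) (cut cl′ e) (λ Qe → K₂⊑K e (W.trail⊑ e Qe)))
        (ℕΣ.∑-distrib-+ (λ e → ⟦ J e ∧ cut cl′ e ⟧) (λ e → ⟦ F e ∧ cut cl′ e ⟧)))
        where
        swap : ∀ j f q c → (q ≡ true → j xor f ≡ true) →
               ⟦ (j xor q) ∧ c ⟧ + ⟦ (f xor q) ∧ c ⟧ ≡ ⟦ j ∧ c ⟧ + ⟦ f ∧ c ⟧
        swap j f false c _ = cong₂ (λ x y → ⟦ x ∧ c ⟧ + ⟦ y ∧ c ⟧) (xor-identityʳ j) (xor-identityʳ f)
        swap j f true c h with xor≡true {j} (h refl)
        ... | inj₁ (refl , refl) = ℕ.+-comm 0 ⟦ c ⟧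
        ... | inj₂ (refl , refl) = ℕ.+-comm ⟦ c ⟧ 0

      G∩δU : ∀ e → G e ∧ cut U e ≡ false
      G∩δU e = ≢true⇒≡false λ h → let (Ge , Ue) = ∧-true h in
        true≢false Ge (cong₂ _xor_ (F∌ Ue) (Q∌ Ue))

      cost-J′ : cost cl F ≤ cost cl G → cost cl′ J′ ≤ cost cl′ J
      cost-J′ F≤G = subst (_≤ cost cl′ J) (sym (cost-ignored cl′ (J ⊻ Q) R R-ignored))
        (ℕ.+-cancelʳ-≤ (cost cl′ G) _ _ (ℕ.≤-trans (ℕ.≤-reflexive exchange) (ℕ.+-monoʳ-≤ (cost cl′ J) F≤G′)))
        where
        F≤G′ : cost cl′ F ≤ cost cl′ G
        F≤G′ = ℕ.≤-trans (ℕ.≤-reflexive (cost-avoiding F F∩δU))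
          (ℕ.≤-trans F≤G (ℕ.≤-reflexive (sym (cost-avoiding G G∩δU))))

      -- On `δU` the sets `J` and `J′` differ in `e₁` and `e₂` only. Both belong to `J`, and they
      -- are distinct because `K₂` omits `e₁`.
      fewer-crossings : size (λ e → J′ e ∧ cut U e) < size c
      fewer-crossings = ℕ.≤-trans (s≤s (size-mono c′⊑)) (ℕ.≤-reflexive (sym (size-delete c e₁ ce₁)))
        where
        Je₂ : J e₂ ≡ true
        Je₂ = K⇒J Ue₂ (K₂⊑K e₂ W.edge∈)
        arrange : ∀ {e} → cut U e ≡ true → J′ e ≡ J e xor ((e₁ == e) xor (e₂ == e))
        arrange {e} Ue = trans (cong₂ (λ q r → (J e xor q) xor ((e₁ == e) xor ((e₂ == e) xor r)))
            (Q∌ Ue) (cong₂ _xor_ (path∌ P₁.path⊑ Ue) (path∌ P₂.path⊑ Ue)))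
          (cong₂ (λ j x → j xor ((e₁ == e) xor x)) (xor-identityʳ (J e)) (xor-identityʳ (e₂ == e)))
        e₂∉J′ : J′ e₂ ≡ false
        e₂∉J′ = trans (arrange Ue₂) (cong₂ _xor_ Je₂ (cong₂ _xor_ (==-≢ (delete-≢ K₁ e₁ e₂ K₁e₁ W.edge∈)) (==-refl e₂)))
        c′⊑ : (λ e → J′ e ∧ cut U e) ⊑ c ⊻ (e₁ ==_)
        c′⊑ e h = trans (cong (_xor (e₁ == e)) (trans (cong (J e ∧_) Ue) (∧-identityʳ (J e))))
          (trans (cong (J e xor_) (sym (trans (cong ((e₁ == e) xor_) e₂≢e) (xor-identityʳ _))))
          (trans (sym (arrange Ue)) J′e))
          where
          J′e : J′ e ≡ true
          J′e = proj₁ (∧-true h)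
          Ue : cut U e ≡ true
          Ue = proj₂ (∧-true h)
          e₂≢e : e₂ == e ≡ false
          e₂≢e = ≢true⇒≡false λ e₂≡e → true≢false J′e (subst (λ e → J′ e ≡ false) (==⇒≡ e₂≡e) e₂∉J′)

    -- A detour that does not improve `F` lowers the number of crossings without raising the cost
    -- for `cl′`. Once at most one crossing is left, going back to `cl` charges at most one more
    -- edge. `r` bounds the crossings.
    uncontract : ∀ r J → OddJoin J → size (λ e → J e ∧ cut U e) < r → Better ⊎ Uncontracted (cost cl′ J)
    uncontract (suc r) J ∂J (s≤s bound) = few-or-many (size (λ e → J e ∧ cut U e) ℕ.≤? 1)
      where
      module Many (≰1 : ¬ size (λ e → J e ∧ cut U e) ≤ 1) where
        open Detour J ∂J (ℕ.≰⇒> ≰1)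

        done : cost cl F ≤ cost cl G → Better ⊎ Uncontracted (cost cl′ J′) → Better ⊎ Uncontracted (cost cl′ J)
        done _   (inj₁ better) = inj₁ better
        done F≤G (inj₂ (J″ , ∂J″ , bound)) = inj₂ (J″ , ∂J″ , ℕ.≤-trans bound (s≤s (cost-J′ F≤G)))

        compare : Dec (cost cl F′ < cost cl F) → Better ⊎ Uncontracted (cost cl′ J)
        compare (yes better) = inj₁ (F′ , s , v₁ , near′ , better)
        compare (no worse) = done (odd-≤ cost-G-parity (subst (cost cl F ≤_) cost-F′ (ℕ.≮⇒≥ worse)))
          (uncontract r J′ ∂J′ (ℕ.<-≤-trans fewer-crossings bound))

      few-or-many : Dec (size (λ e → J e ∧ cut U e) ≤ 1) → Better ⊎ Uncontracted (cost cl′ J)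
      few-or-many (yes ≤1) = inj₂ (J , ∂J , ℕ.≤-trans (ℕ.≤-reflexive (cost-split J))
        (ℕ.≤-trans (ℕ.+-monoʳ-≤ (cost cl′ J) ≤1) (ℕ.≤-reflexive (ℕ.+-comm _ 1))))
      few-or-many (no ≰1) = Many.compare ≰1 (cost cl (Detour.F′ J ∂J (ℕ.≰⇒> ≰1)) ℕ.<? cost cl F)

  -- The outer induction is on the number of charged edges: a contraction frees at least three of
  -- them and costs the join at most one, which preserves the ratio. The inner one, on `c`, is on
  -- the cost of the current join or near-join and starts from the join of all edges.
  small-join : ∀ k cl → size (cut cl) < k → Bridgeless cl → SmallJoin cl
  small-join (suc k) cl (s≤s size≤k) bridgeless = from-join (cost cl all) all (λ _ → refl) ℕ.≤-refl
    where
    improve : ∀ c F s t → NearJoin F s t → cost cl F < c → SmallJoin cl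
    from-join : ∀ c J → OddJoin J → cost cl J ≤ c → SmallJoin cl

    from-join c J ∂J cost≤c = costless-or-not (find (λ e → J e ∧ cut cl e))
      where
      costless-or-not : (∃[ e ] J e ∧ cut cl e ≡ true) ⊎ (∀ e → J e ∧ cut cl e ≡ false) → SmallJoin cl
      costless-or-not (inj₂ none′) = J , ∂J , subst (λ x → 3 * x ≤ size (cut cl)) (sym (size-none none′)) z≤n
      -- Deleting a charged edge creates the two defects and saves the unit of cost that the search
      -- has to beat.
      costless-or-not (inj₁ (e , h)) = improve c (J ⊻ (e ==_)) (a e) (b e)
        (λ x → trans (∂-xor J (e ==_) x) (cong₂ _xor_ (∂J x) (∂-single e x)))
        (ℕ.≤-trans (ℕ.≤-reflexive (sym (cost-delete cl J e (proj₂ (∧-true {J e} h)) (proj₁ (∧-true {J e} h))))) cost≤c)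

    improve (suc c) F s t near (s≤s cost≤c) = go (bool-cases (U s))
      where
      C : Cluster (free cl) t
      C = cluster (free cl) t
      open Cluster C

      joined : Link (free cl) s t → SmallJoin cl
      joined L = from-join c (F ⊻ L.path) ∂J
          (ℕ.≤-trans (ℕ.≤-reflexive (cost-ignored cl F L.path (⊑free⇒ignored cl L.path⊑))) cost≤c)
        where
        module L = Link L
        ∂J : OddJoin (F ⊻ L.path)
        ∂J x = trans (∂-xor F L.path x) (trans (cong₂ _xor_ (near x) (L.∂-path x))
          (solve 2 (λ A B → (A :+ B) :+ B := A) refl (∂ all x) ((s == x) xor (t == x))))

      -- An edge of `F` that leaves the cluster is charged. Replacing it by a free path inside the
      -- cluster moves the defect from `t` to its outer end and saves one.
      crossed : ∀ e → F e ≡ true → cut U e ≡ true →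
                ∃[ u ] ∃[ v ] (U u ≡ true × U v ≡ false × Joins e u v) → SmallJoin cl
      crossed e Fe Ue (u , v , Uu , _ , inc-e , _) = improve c ((F ⊻ (e ==_)) ⊻ L.path) s v near′ cheaper
        where
        module L = Link (links u Uu)
        ce : cut cl e ≡ true
        ce = ≢false⇒≡true λ c≡0 → true≢false Ue (closed e (cong not c≡0))
        near′ : NearJoin ((F ⊻ (e ==_)) ⊻ L.path) s v
        near′ x = trans (∂-xor (F ⊻ (e ==_)) L.path x)
          (trans (cong₂ _xor_ (trans (∂-xor F (e ==_) x) (cong₂ _xor_ (near x) (trans (∂-single e x) (inc-e x)))) (L.∂-path x))
          (solve 5 (λ A s t u v → ((A :+ (s :+ t)) :+ (u :+ v)) :+ (u :+ t) := A :+ (s :+ v)) refl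
            (∂ all x) (s == x) (t == x) (u == x) (v == x)))
        cheaper : cost cl ((F ⊻ (e ==_)) ⊻ L.path) < c
        cheaper = ℕ.≤-trans (ℕ.≤-reflexive (trans
          (cong suc (cost-ignored cl (F ⊻ (e ==_)) L.path (⊑free⇒ignored cl L.path⊑)))
          (sym (cost-delete cl F e ce Fe)))) cost≤c

      module _ (s∉U : U s ≡ false) (F∩δU : ∀ e → F e ∧ cut U e ≡ false) where
        module S = Separated cl F s t near C s∉U F∩δU

        smaller : 3 + size (cut S.cl′) ≤ size (cut cl)
        smaller = ℕ.≤-trans (ℕ.+-monoˡ-≤ _ (S.three-cut bridgeless))
          (ℕ.≤-reflexive (trans (ℕ.+-comm (size (cut U)) _) (sym S.size-cut)))

        contracted : SmallJoin S.cl′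
        contracted = small-join k S.cl′
          (ℕ.≤-trans (ℕ.≤-trans (s≤s (ℕ.m≤n+m _ 2)) smaller) size≤k) (S.bridgeless′ bridgeless)

        separated : S.Better ⊎ S.Uncontracted (cost S.cl′ (proj₁ contracted)) → SmallJoin cl
        separated (inj₁ (F′ , s′ , t′ , near′ , better)) = improve c F′ s′ t′ near′ (ℕ.<-≤-trans better cost≤c)
        separated (inj₂ (J , ∂J , bound)) = J , ∂J , (begin
          3 * cost cl J ≤⟨ ℕ.*-monoʳ-≤ 3 bound ⟩
          3 * suc (cost S.cl′ (proj₁ contracted)) ≡⟨ ℕ.*-suc 3 (cost S.cl′ (proj₁ contracted)) ⟩
          3 + 3 * cost S.cl′ (proj₁ contracted) ≤⟨ ℕ.+-monoʳ-≤ 3 (proj₂ (proj₂ contracted)) ⟩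
          3 + size (cut S.cl′) ≤⟨ smaller ⟩
          size (cut cl) ∎)
          where open ℕ.≤-Reasoning

        attempt : SmallJoin cl
        attempt = separated (S.uncontract (suc (size (λ e → proj₁ contracted e ∧ cut U e)))
          (proj₁ contracted) (proj₁ (proj₂ contracted)) (ℕ.n<1+n (size (λ e → proj₁ contracted e ∧ cut U e))))

      inside-or-outside : (∃[ e ] F e ∧ cut U e ≡ true) ⊎ (∀ e → F e ∧ cut U e ≡ false) →
                          U s ≡ false → SmallJoin cl
      inside-or-outside (inj₁ (e , h)) _ = crossed e (proj₁ (∧-true {F e} h)) Ue (crossing U e Ue)
        where
        Ue : cut U e ≡ true
        Ue = proj₂ (∧-true {F e} h)
      inside-or-outside (inj₂ F∩δU) s∉U = attempt s∉U F∩δU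

      go : U s ≡ true ⊎ U s ≡ false → SmallJoin cl
      go (inj₁ s∈U) = joined (links s s∈U)
      go (inj₂ s∉U) = inside-or-outside (find (λ e → F e ∧ cut U e)) s∉U

module SumSplit {c ℓ} (M : CommutativeMonoid c ℓ) where
  open CommutativeMonoid M renaming (refl to ≈-refl; sym to ≈-sym; trans to ≈-trans)
  open MonoidSum M using (sum)

  sum-+ : ∀ m {n} (f : Fin (m + n) → Carrier) → sum f ≈ sum (λ i → f (i ↑ˡ n)) ∙ sum (λ j → f (m ↑ʳ j))
  sum-+ zero f = ≈-sym (identityˡ _)
  sum-+ (suc m) f = ≈-trans (∙-congˡ (sum-+ m (f ∘ suc))) (≈-sym (assoc _ _ _))

module Split𝔽₂ = SumSplit (CommutativeRing.+-commutativeMonoid xor-∧-commutativeRing)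
module Splitℕ = SumSplit ℕ.+-0-commutativeMonoid

-- Rotations, face walks and face-even edge sets

module Map (G : PlaneGraph) where
  open PlaneGraph G public

  vert-φ : ∀ d → vert (φ d) ≡ vert (α d)
  vert-φ d = σ-vert (α d)

  vert-iter : ∀ k d → vert (iter σ k d) ≡ vert d
  vert-iter zero d = refl
  vert-iter (suc k) d = trans (σ-vert (iter σ k d)) (vert-iter k d)

  σ⁻¹ : Fin nD → Fin nD
  σ⁻¹ d = iter σ (proj₁ (σ-cycle (σ d) d (σ-vert d))) d

  σσ⁻¹ : ∀ d → σ (σ⁻¹ d) ≡ d
  σσ⁻¹ d = trans (sym (iter-suc (proj₁ c) d)) (proj₂ c)
    where
    c : ∃[ k ] iter σ k (σ d) ≡ d
    c = σ-cycle (σ d) d (σ-vert d)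
    iter-suc : ∀ k d → iter σ k (σ d) ≡ σ (iter σ k d)
    iter-suc zero d = refl
    iter-suc (suc k) d = cong σ (iter-suc k d)

  φ⁻¹ : Fin nD → Fin nD
  φ⁻¹ d = α (σ⁻¹ d)

  φφ⁻¹ : ∀ d → φ (φ⁻¹ d) ≡ d
  φφ⁻¹ d = trans (cong σ (α-invol (σ⁻¹ d))) (σσ⁻¹ d)

  φ-inj : ∀ {d d′} → φ d ≡ φ d′ → d ≡ d′
  φ-inj {d} {d′} eq = trans (sym (α-invol d)) (trans (cong α (σ-inj (α d) (α d′) eq)) (α-invol d′))

  φ⁻¹φ : ∀ d → φ⁻¹ (φ d) ≡ d
  φ⁻¹φ d = φ-inj (φφ⁻¹ (φ d))

  ⊕-φ : ∀ f → ⊕-sum f ≡ ⊕-sum (f ∘ φ)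
  ⊕-φ f = 𝔽₂.sum-permute f (permutation φ φ⁻¹ φφ⁻¹ φ⁻¹φ)

  ⊕-α : ∀ f → ⊕-sum f ≡ ⊕-sum (f ∘ α)
  ⊕-α f = 𝔽₂.sum-permute f (permutation α α α-invol α-invol)

  -- The even edge sets of the dual graph, taken walk by walk rather than face by face. An edge with
  -- both darts on one walk counts twice there and drops out.
  record FaceEven (x : Fin nD → Bool) : Set where
    constructor faceEven
    field
      symmetric : ∀ d → x (α d) ≡ x d
      even      : ∀ o → ⊕-sum (λ d → (orb d == o) ∧ x d) ≡ false

  δ : (Fin nV → Bool) → Fin nD → Bool
  δ c d = c (vert d) xor c (vert (α d))

  -- The head of a dart is the tail of its successor under `φ`, so along a walk the sum over heads
  -- is the sum over tails, reindexed.
  δ-faceEven : ∀ c → FaceEven (δ c)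
  δ-faceEven c = faceEven
    (λ d → trans (cong (λ e → c (vert (α d)) xor c (vert e)) (α-invol d)) (xor-comm (c (vert (α d))) (c (vert d))))
    λ o → begin
      ⊕-sum (λ d → (orb d == o) ∧ (c (vert d) xor c (vert (α d))))
        ≡⟨ trans (⊕-cong λ d → ∧-distribˡ-xor (orb d == o) _ _) (⊕-xor (λ d → (orb d == o) ∧ c (vert d)) _) ⟩
      ⊕-sum (λ d → (orb d == o) ∧ c (vert d)) xor ⊕-sum (λ d → (orb d == o) ∧ c (vert (α d)))
        ≡⟨ cong (_xor ⊕-sum (λ d → (orb d == o) ∧ c (vert (α d)))) (⊕-φ (λ d → (orb d == o) ∧ c (vert d))) ⟩
      ⊕-sum (λ d → (orb (φ d) == o) ∧ c (vert (φ d))) xor ⊕-sum (λ d → (orb d == o) ∧ c (vert (α d)))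
        ≡⟨ cong (_xor ⊕-sum (λ d → (orb d == o) ∧ c (vert (α d))))
             (⊕-cong λ d → cong₂ (λ p v → (p == o) ∧ c v) (orb-φ d) (vert-φ d)) ⟩
      ⊕-sum (λ d → (orb d == o) ∧ c (vert (α d))) xor ⊕-sum (λ d → (orb d == o) ∧ c (vert (α d)))
        ≡⟨ xor-same (⊕-sum (λ d → (orb d == o) ∧ c (vert (α d)))) ⟩
      false ∎
    where open ≡-Reasoning

  Independent : (Fin nD → Bool) → Set
  Independent K = ∀ p → K p ≡ true → K (φ p) ≡ false

  Spread : (Fin nD → Bool) → Set
  Spread K = ∀ p → K p ≡ true → vert p ≢ vert (α (φ p))

  Branching : (Fin nV → Bool) → Set
  Branching S = ∀ v → S v ≡ false → ∀ u → ∃[ d ] (vert d ≡ v × vert (α d) ≢ u)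

  Reaching : (Fin nV → Bool) → Set
  Reaching S = ∀ v → ∃[ u ] (S u ≡ true × Star Adj u v)

  first : Fin nD → Bool
  first p = does (toℕ p ℕ.<? toℕ (α p))

  first-xor : ∀ q → first q xor first (α q) ≡ true
  first-xor q rewrite α-invol q with ℕ.<-cmp (toℕ q) (toℕ (α q))
  ... | tri< lt _ ¬gt rewrite dec-true (toℕ q ℕ.<? toℕ (α q)) lt | dec-false (toℕ (α q) ℕ.<? toℕ q) ¬gt = refl
  ... | tri≈ _ eq _ = contradiction (sym (toℕ-injective eq)) (α-fpf q)
  ... | tri> ¬lt _ gt rewrite dec-false (toℕ q ℕ.<? toℕ (α q)) ¬lt | dec-true (toℕ (α q) ℕ.<? toℕ q) gt = refl

size-indicator : ∀ {n} (i : Fin n) → size (i ==_) ≡ 1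
size-indicator {n} i = trans (size-insert none i refl) (cong suc (size-none {n} λ _ → refl))

-- An even set meeting every chosen cherry

module Cherries (G : PlaneGraph) (no-loops : PlaneGraph.NoLoops G)
  (K : Fin (PlaneGraph.nD G) → Bool) (independent : Map.Independent G K) (apart : Map.Spread G K)
  (d₀ : Fin (PlaneGraph.nD G)) where

  open Map G

  -- The face walks with the two darts p, φ p of each cherry split off: left p and right p lead from
  -- the cherry to the edges of p and φ p, stem p leads back to the face walk.  Routing the
  -- edge of d₀ through hub makes it cost 2: a third of the total 3 |K| + 2 is less than |K| + 1, so
  -- a small join, which costs at least |K| at the cherries, avoids that edge.
  data Node : Set where
    mid cherry : Fin nD → Node
    core       : Fin nO → Node
    hub        : Node

  data Edge : Set where
    left right stem bar : Fin nD → Edge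

  -- `e₀` marks the two darts of the edge of `d₀`, `free` the darts in no chosen cherry, and `h`
  -- those `p` for which `left p` is not a loop.
  e₀ free h : Fin nD → Bool
  e₀ = (d₀ ==_) ⊻ (α d₀ ==_)
  free p = not (K p) ∧ not (K (φ⁻¹ p))
  h p = K p xor free p

  -- Absent edges become loops: `left p` when `p` is the second dart of a cherry, `right p` and
  -- `stem p` when no cherry starts at `p`. `bar p` and `bar (α p)` are parallel, except on the edge
  -- of `d₀`, where they form a path through `hub`.
  src tgt : Edge → Node
  src (left p)  = if K p then cherry p else (if K (φ⁻¹ p) then mid p else core (orb p))
  src (right p) = if K p then cherry p else mid (φ p)
  src (stem p)  = if K p then cherry p else core (orb p)
  src (bar p)   = mid p
  tgt (left p)  = mid p
  tgt (right p) = mid (φ p)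
  tgt (stem p)  = core (orb p)
  tgt (bar p)   = if e₀ p then hub else mid (α p)

  infix 6 _==ₙ_
  _==ₙ_ : Node → Node → Bool
  mid p    ==ₙ mid q    = q == p
  cherry p ==ₙ cherry q = q == p
  core o   ==ₙ core o′  = o == o′
  hub      ==ₙ hub      = true
  _        ==ₙ _        = false

  ==ₙ⇒≡ : ∀ x y → x ==ₙ y ≡ true → x ≡ y
  ==ₙ⇒≡ (mid p)    (mid q)    eq = cong mid (sym (==⇒≡ eq))
  ==ₙ⇒≡ (cherry p) (cherry q) eq = cong cherry (sym (==⇒≡ eq))
  ==ₙ⇒≡ (core o)   (core o′)  eq = cong core (==⇒≡ eq)
  ==ₙ⇒≡ hub        hub        eq = refl

  ==ₙ-refl : ∀ x → x ==ₙ x ≡ true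
  ==ₙ-refl (mid p)    = ==-refl p
  ==ₙ-refl (cherry p) = ==-refl p
  ==ₙ-refl (core o)   = ==-refl o
  ==ₙ-refl hub        = refl

  N M : ℕ
  N = (nD + nD) + (nO + 1)
  M = (nD + nD) + (nD + nD)

  enc : Node → Fin N
  enc (mid p)    = (p ↑ˡ nD) ↑ˡ (nO + 1)
  enc (cherry p) = (nD ↑ʳ p) ↑ˡ (nO + 1)
  enc (core o)   = (nD + nD) ↑ʳ (o ↑ˡ 1)
  enc hub        = (nD + nD) ↑ʳ (nO ↑ʳ zero)

  unsplit : (Fin nD ⊎ Fin nD) ⊎ (Fin nO ⊎ Fin 1) → Node
  unsplit (inj₁ (inj₁ p)) = mid p
  unsplit (inj₁ (inj₂ p)) = cherry p
  unsplit (inj₂ (inj₁ o)) = core o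
  unsplit (inj₂ (inj₂ _)) = hub

  split₁ : Fin (nD + nD) ⊎ Fin (nO + 1) → (Fin nD ⊎ Fin nD) ⊎ (Fin nO ⊎ Fin 1)
  split₁ (inj₁ i) = inj₁ (splitAt nD i)
  split₁ (inj₂ i) = inj₂ (splitAt nO i)

  dec : Fin N → Node
  dec v = unsplit (split₁ (splitAt (nD + nD) v))

  dec-enc : ∀ x → dec (enc x) ≡ x
  dec-enc (mid p)    = cong unsplit (trans (cong split₁ (splitAt-↑ˡ (nD + nD) (p ↑ˡ nD) (nO + 1))) (cong inj₁ (splitAt-↑ˡ nD p nD)))
  dec-enc (cherry p) = cong unsplit (trans (cong split₁ (splitAt-↑ˡ (nD + nD) (nD ↑ʳ p) (nO + 1))) (cong inj₁ (splitAt-↑ʳ nD nD p)))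
  dec-enc (core o)   = cong unsplit (trans (cong split₁ (splitAt-↑ʳ (nD + nD) (nO + 1) (o ↑ˡ 1))) (cong inj₂ (splitAt-↑ˡ nO o 1)))
  dec-enc hub        = cong unsplit (trans (cong split₁ (splitAt-↑ʳ (nD + nD) (nO + 1) (nO ↑ʳ zero))) (cong inj₂ (splitAt-↑ʳ nO 1 zero)))

  enc-unsplit : ∀ s → enc (unsplit (split₁ s)) ≡ join (nD + nD) (nO + 1) s
  enc-unsplit (inj₁ i) = trans (helper (splitAt nD i)) (cong (_↑ˡ (nO + 1)) (join-splitAt nD nD i))
    where
    helper : ∀ t → enc (unsplit (inj₁ t)) ≡ join nD nD t ↑ˡ (nO + 1)
    helper (inj₁ _) = refl
    helper (inj₂ _) = refl
  enc-unsplit (inj₂ i) = trans (helper (splitAt nO i)) (cong ((nD + nD) ↑ʳ_) (join-splitAt nO 1 i))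
    where
    helper : ∀ t → enc (unsplit (inj₂ t)) ≡ (nD + nD) ↑ʳ join nO 1 t
    helper (inj₁ _) = refl
    helper (inj₂ zero) = refl

  enc-dec : ∀ v → enc (dec v) ≡ v
  enc-dec v = trans (enc-unsplit (splitAt (nD + nD) v)) (join-splitAt (nD + nD) (nO + 1) v)

  enc-== : ∀ x y → enc x == enc y ≡ x ==ₙ y
  enc-== x y with bool-cases (x ==ₙ y)
  ... | inj₁ eq = trans (subst (λ z → enc x == enc z ≡ true) (==ₙ⇒≡ x y eq) (==-refl (enc x))) (sym eq)
  ... | inj₂ eq = trans (==-≢ λ encx≡ency → true≢false (==ₙ-refl x)
      (subst (λ z → x ==ₙ z ≡ false) (trans (sym (dec-enc y)) (trans (cong dec (sym encx≡ency)) (dec-enc x))) eq)) (sym eq)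

  unsplitE : (Fin nD ⊎ Fin nD) ⊎ (Fin nD ⊎ Fin nD) → Edge
  unsplitE (inj₁ (inj₁ p)) = left p
  unsplitE (inj₁ (inj₂ p)) = right p
  unsplitE (inj₂ (inj₁ p)) = stem p
  unsplitE (inj₂ (inj₂ p)) = bar p

  splitE : Fin (nD + nD) ⊎ Fin (nD + nD) → (Fin nD ⊎ Fin nD) ⊎ (Fin nD ⊎ Fin nD)
  splitE (inj₁ i) = inj₁ (splitAt nD i)
  splitE (inj₂ i) = inj₂ (splitAt nD i)

  decE : Fin M → Edge
  decE e = unsplitE (splitE (splitAt (nD + nD) e))

  decE-left : ∀ p → decE ((p ↑ˡ nD) ↑ˡ (nD + nD)) ≡ left p
  decE-left p = cong unsplitE (trans (cong splitE (splitAt-↑ˡ (nD + nD) (p ↑ˡ nD) (nD + nD))) (cong inj₁ (splitAt-↑ˡ nD p nD)))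

  decE-right : ∀ p → decE ((nD ↑ʳ p) ↑ˡ (nD + nD)) ≡ right p
  decE-right p = cong unsplitE (trans (cong splitE (splitAt-↑ˡ (nD + nD) (nD ↑ʳ p) (nD + nD))) (cong inj₁ (splitAt-↑ʳ nD nD p)))

  decE-stem : ∀ p → decE ((nD + nD) ↑ʳ (p ↑ˡ nD)) ≡ stem p
  decE-stem p = cong unsplitE (trans (cong splitE (splitAt-↑ʳ (nD + nD) (nD + nD) (p ↑ˡ nD))) (cong inj₂ (splitAt-↑ˡ nD p nD)))

  decE-bar : ∀ p → decE ((nD + nD) ↑ʳ (nD ↑ʳ p)) ≡ bar p
  decE-bar p = cong unsplitE (trans (cong splitE (splitAt-↑ʳ (nD + nD) (nD + nD) (nD ↑ʳ p))) (cong inj₂ (splitAt-↑ʳ nD nD p)))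

  ⊕-edges : ∀ (g : Edge → Bool) → ⊕-sum (g ∘ decE) ≡
            (⊕-sum (g ∘ left) xor ⊕-sum (g ∘ right)) xor (⊕-sum (g ∘ stem) xor ⊕-sum (g ∘ bar))
  ⊕-edges g = trans (Split𝔽₂.sum-+ (nD + nD) (g ∘ decE)) (cong₂ _xor_
    (trans (Split𝔽₂.sum-+ nD _) (cong₂ _xor_ (⊕-cong (cong g ∘ decE-left)) (⊕-cong (cong g ∘ decE-right))))
    (trans (Split𝔽₂.sum-+ nD _) (cong₂ _xor_ (⊕-cong (cong g ∘ decE-stem)) (⊕-cong (cong g ∘ decE-bar)))))

  size-edges : ∀ (g : Edge → Bool) → size (g ∘ decE) ≡
               (size (g ∘ left) + size (g ∘ right)) + (size (g ∘ stem) + size (g ∘ bar))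
  size-edges g = trans (Splitℕ.sum-+ (nD + nD) (⟦_⟧ ∘ g ∘ decE)) (cong₂ _+_
    (trans (Splitℕ.sum-+ nD _) (cong₂ _+_ (size-cong (cong g ∘ decE-left)) (size-cong (cong g ∘ decE-right))))
    (trans (Splitℕ.sum-+ nD _) (cong₂ _+_ (size-cong (cong g ∘ decE-stem)) (size-cong (cong g ∘ decE-bar)))))

  a b : Fin M → Fin N
  a = enc ∘ src ∘ decE
  b = enc ∘ tgt ∘ decE

  open Graph a b
  open TJoin a b using (Even; Bridgeless; SmallJoin; small-join; cost)

  touch : Edge → Node → Bool
  touch (left p)  (mid q)    = h p ∧ (q == p)
  touch (left p)  (cherry q) = K p ∧ (q == p)
  touch (left p)  (core o)   = free p ∧ (orb p == o)
  touch (left p)  hub        = false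
  touch (right p) (mid q)    = K p ∧ (q == φ p)
  touch (right p) (cherry q) = K p ∧ (q == p)
  touch (right p) (core o)   = false
  touch (right p) hub        = false
  touch (stem p)  (mid q)    = false
  touch (stem p)  (cherry q) = K p ∧ (q == p)
  touch (stem p)  (core o)   = K p ∧ (orb p == o)
  touch (stem p)  hub        = false
  touch (bar p)   (mid q)    = (q == p) xor (not (e₀ p) ∧ (q == α p))
  touch (bar p)   (cherry q) = false
  touch (bar p)   (core o)   = false
  touch (bar p)   hub        = e₀ p

  touch-correct : ∀ e v → (src e ==ₙ v) xor (tgt e ==ₙ v) ≡ touch e v
  touch-correct (left p) (mid q) with K p | K (φ⁻¹ p)
  ... | true  | _     = refl
  ... | false | true  = xor-same (q == p)
  ... | false | false = refl
  touch-correct (left p) (cherry q) with K p | K (φ⁻¹ p)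
  ... | true  | _     = xor-identityʳ (q == p)
  ... | false | true  = refl
  ... | false | false = refl
  touch-correct (left p) (core o) with K p | K (φ⁻¹ p)
  ... | true  | _     = refl
  ... | false | true  = refl
  ... | false | false = xor-identityʳ (orb p == o)
  touch-correct (left p) hub with K p | K (φ⁻¹ p)
  ... | true  | _     = refl
  ... | false | true  = refl
  ... | false | false = refl
  touch-correct (right p) (mid q) with K p
  ... | true  = refl
  ... | false = xor-same (q == φ p)
  touch-correct (right p) (cherry q) with K p
  ... | true  = xor-identityʳ (q == p)
  ... | false = refl
  touch-correct (right p) (core o) with K p
  ... | true  = refl
  ... | false = refl
  touch-correct (right p) hub with K p
  ... | true  = refl
  ... | false = refl
  touch-correct (stem p) (mid q) with K p
  ... | true  = refl
  ... | false = refl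
  touch-correct (stem p) (cherry q) with K p
  ... | true  = xor-identityʳ (q == p)
  ... | false = refl
  touch-correct (stem p) (core o) with K p
  ... | true  = refl
  ... | false = xor-same (orb p == o)
  touch-correct (stem p) hub with K p
  ... | true  = refl
  ... | false = refl
  touch-correct (bar p) (mid q) with e₀ p
  ... | true  = refl
  ... | false = refl
  touch-correct (bar p) (cherry q) with e₀ p
  ... | true  = refl
  ... | false = refl
  touch-correct (bar p) (core o) with e₀ p
  ... | true  = refl
  ... | false = refl
  touch-correct (bar p) hub with e₀ p
  ... | true  = refl
  ... | false = refl

  inc-touch : ∀ e v → inc e (enc v) ≡ touch (decE e) v
  inc-touch e v = trans (cong₂ _xor_ (enc-== (src (decE e)) v) (enc-== (tgt (decE e)) v)) (touch-correct (decE e) v)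

  ∂-edges : ∀ X v → ∂ (X ∘ decE) (enc v) ≡
            (⊕-sum (λ p → X (left p) ∧ touch (left p) v) xor ⊕-sum (λ p → X (right p) ∧ touch (right p) v)) xor
            (⊕-sum (λ p → X (stem p) ∧ touch (stem p) v) xor ⊕-sum (λ p → X (bar p) ∧ touch (bar p) v))
  ∂-edges X v = trans (⊕-cong λ e → cong (X (decE e) ∧_) (inc-touch e v)) (⊕-edges (λ e → X e ∧ touch e v))

  -- Apart from the bars, exactly one of `left q` and `right (φ⁻¹ q)` is a proper edge at `mid q`;
  -- `half` reads `X` on it.
  half : (Edge → Bool) → Fin nD → Bool
  half X q = (h q ∧ X (left q)) xor (K (φ⁻¹ q) ∧ X (right (φ⁻¹ q)))

  ⊕-zero : ∀ (f : Fin nD → Bool) → ⊕-sum {nD} (λ p → f p ∧ false) ≡ false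
  ⊕-zero f = ⊕-none {nD} λ p → ∧-zeroʳ (f p)

  ∂-mid : ∀ X q → ∂ (X ∘ decE) (enc (mid q)) ≡ half X q xor (X (bar q) xor (not (e₀ (α q)) ∧ X (bar (α q))))
  ∂-mid X q = trans (∂-edges X (mid q)) (cong₂ _xor_ (cong₂ _xor_ lefts rights) (cong₂ _xor_ (⊕-zero (X ∘ stem)) bars))
    where
    rearrange : ∀ x y z → x ∧ (y ∧ z) ≡ (y ∧ x) ∧ z
    rearrange = solve 3 (λ x y z → x :* (y :* z) := (y :* x) :* z) refl
    lefts : ⊕-sum (λ p → X (left p) ∧ (h p ∧ (q == p))) ≡ h q ∧ X (left q)
    lefts = trans (⊕-cong λ p → rearrange (X (left p)) (h p) (q == p)) (⊕-single (λ p → h p ∧ X (left p)) q)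
    R : Fin nD → Bool
    R p = K (φ⁻¹ p) ∧ X (right (φ⁻¹ p))
    rights : ⊕-sum (λ p → X (right p) ∧ (K p ∧ (q == φ p))) ≡ R q
    rights = trans (⊕-cong λ p → trans (rearrange (X (right p)) (K p) (q == φ p))
        (cong (λ p′ → (K p′ ∧ X (right p′)) ∧ (q == φ p)) (sym (φ⁻¹φ p))))
      (trans (sym (⊕-φ (λ p → R p ∧ (q == p)))) (⊕-single R q))
    B : Fin nD → Bool
    B p = not (e₀ (α p)) ∧ X (bar (α p))
    bars : ⊕-sum (λ p → X (bar p) ∧ ((q == p) xor (not (e₀ p) ∧ (q == α p)))) ≡ X (bar q) xor B q
    bars = trans (⊕-cong λ p → ∧-distribˡ-xor (X (bar p)) (q == p) _)
      (trans (⊕-xor (λ p → X (bar p) ∧ (q == p)) (λ p → X (bar p) ∧ (not (e₀ p) ∧ (q == α p))))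
      (cong₂ _xor_ (⊕-single (X ∘ bar) q) (trans
        (⊕-cong λ p → trans (rearrange (X (bar p)) (not (e₀ p)) (q == α p))
          (cong (λ p′ → (not (e₀ p′) ∧ X (bar p′)) ∧ (q == α p)) (sym (α-invol p))))
        (trans (sym (⊕-α (λ p → B p ∧ (q == p)))) (⊕-single B q)))))

  ∂-cherry : ∀ X q → ∂ (X ∘ decE) (enc (cherry q)) ≡ K q ∧ ((X (left q) xor X (right q)) xor X (stem q))
  ∂-cherry X q = trans (∂-edges X (cherry q)) (trans
    (cong₂ _xor_ (cong₂ _xor_ (single left) (single right)) (cong₂ _xor_ (single stem) (⊕-zero (X ∘ bar))))
    (solve 4 (λ k l r s → ((k :* l) :+ (k :* r)) :+ ((k :* s) :+ con false) := k :* ((l :+ r) :+ s)) refl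
      (K q) (X (left q)) (X (right q)) (X (stem q))))
    where
    single : ∀ (c : Fin nD → Edge) → ⊕-sum (λ p → X (c p) ∧ (K p ∧ (q == p))) ≡ K q ∧ X (c q)
    single c = trans (⊕-cong λ p → solve 3 (λ x y z → x :* (y :* z) := (y :* x) :* z) refl (X (c p)) (K p) (q == p))
                     (⊕-single (λ p → K p ∧ X (c p)) q)

  ∂-core : ∀ X o → ∂ (X ∘ decE) (enc (core o)) ≡
           ⊕-sum (λ p → (orb p == o) ∧ ((free p ∧ X (left p)) xor (K p ∧ X (stem p))))
  ∂-core X o = trans (∂-edges X (core o)) (trans
    (cong₂ _xor_ (trans (cong (lefts xor_) (⊕-zero (X ∘ right))) (xor-identityʳ lefts))
                 (trans (cong (stems xor_) (⊕-zero (X ∘ bar))) (xor-identityʳ stems)))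
    (trans (sym (⊕-xor (λ p → X (left p) ∧ (free p ∧ (orb p == o))) (λ p → X (stem p) ∧ (K p ∧ (orb p == o)))))
    (⊕-cong λ p → solve 5 (λ l f o s k → (l :* (f :* o)) :+ (s :* (k :* o)) := o :* ((f :* l) :+ (k :* s))) refl
      (X (left p)) (free p) (orb p == o) (X (stem p)) (K p))))
    where
    lefts stems : Bool
    lefts = ⊕-sum (λ p → X (left p) ∧ (free p ∧ (orb p == o)))
    stems = ⊕-sum (λ p → X (stem p) ∧ (K p ∧ (orb p == o)))

  ∂-hub : ∀ X → ∂ (X ∘ decE) (enc hub) ≡ X (bar d₀) xor X (bar (α d₀))
  ∂-hub X = trans (∂-edges X hub) (trans
    (cong₂ _xor_ (cong₂ _xor_ (⊕-zero (X ∘ left)) (⊕-zero (X ∘ right))) (cong₂ _xor_ (⊕-zero (X ∘ stem)) bars)) refl)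
    where
    bars : ⊕-sum (λ p → X (bar p) ∧ e₀ p) ≡ X (bar d₀) xor X (bar (α d₀))
    bars = trans (⊕-cong λ p → ∧-distribˡ-xor (X (bar p)) (d₀ == p) (α d₀ == p))
      (trans (⊕-xor (λ p → X (bar p) ∧ (d₀ == p)) (λ p → X (bar p) ∧ (α d₀ == p)))
             (cong₂ _xor_ (⊕-single (X ∘ bar) d₀) (⊕-single (X ∘ bar) (α d₀))))

  -- Shifting the `right` terms along `φ` collects both edges of a cherry at its first dart.
  -- Evenness at the cherry node then lets its `stem` replace them, which turns the sum into the
  -- degree at `core o`.
  half-orbit : ∀ X o → ⊕-sum (λ p → (orb p == o) ∧ half X p) ≡
               ⊕-sum (λ p → (orb p == o) ∧ ((free p ∧ X (left p)) xor (K p ∧ (X (left p) xor X (right p)))))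
  half-orbit X o = begin
    ⊕-sum (λ p → (orb p == o) ∧ half X p)
      ≡⟨ trans (⊕-cong λ p → ∧-distribˡ-xor (orb p == o) (h p ∧ X (left p)) (R p)) (⊕-xor lefts (λ p → (orb p == o) ∧ R p)) ⟩
    ⊕-sum lefts xor ⊕-sum (λ p → (orb p == o) ∧ R p)
      ≡⟨ cong (⊕-sum lefts xor_) (trans (⊕-φ (λ p → (orb p == o) ∧ R p))
           (⊕-cong λ p → cong₂ (λ o′ p′ → (o′ == o) ∧ (K p′ ∧ X (right p′))) (orb-φ p) (φ⁻¹φ p))) ⟩
    ⊕-sum lefts xor ⊕-sum (λ p → (orb p == o) ∧ (K p ∧ X (right p)))
      ≡⟨ ⊕-xor lefts (λ p → (orb p == o) ∧ (K p ∧ X (right p))) ⟨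
    ⊕-sum (λ p → lefts p xor ((orb p == o) ∧ (K p ∧ X (right p))))
      ≡⟨ ⊕-cong (λ p → solve 5 (λ o k f l r → (o :* ((k :+ f) :* l)) :+ (o :* (k :* r)) := o :* ((f :* l) :+ (k :* (l :+ r)))) refl
           (orb p == o) (K p) (free p) (X (left p)) (X (right p))) ⟩
    ⊕-sum (λ p → (orb p == o) ∧ ((free p ∧ X (left p)) xor (K p ∧ (X (left p) xor X (right p))))) ∎
    where
    open ≡-Reasoning
    lefts R : Fin nD → Bool
    lefts p = (orb p == o) ∧ (h p ∧ X (left p))
    R p = K (φ⁻¹ p) ∧ X (right (φ⁻¹ p))

  encE : Edge → Fin M
  encE (left p)  = (p ↑ˡ nD) ↑ˡ (nD + nD)
  encE (right p) = (nD ↑ʳ p) ↑ˡ (nD + nD)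
  encE (stem p)  = (nD + nD) ↑ʳ (p ↑ˡ nD)
  encE (bar p)   = (nD + nD) ↑ʳ (nD ↑ʳ p)

  encE-unsplit : ∀ s → encE (unsplitE (splitE s)) ≡ join (nD + nD) (nD + nD) s
  encE-unsplit (inj₁ i) = trans (helper (splitAt nD i)) (cong (_↑ˡ (nD + nD)) (join-splitAt nD nD i))
    where
    helper : ∀ t → encE (unsplitE (inj₁ t)) ≡ join nD nD t ↑ˡ (nD + nD)
    helper (inj₁ _) = refl
    helper (inj₂ _) = refl
  encE-unsplit (inj₂ i) = trans (helper (splitAt nD i)) (cong ((nD + nD) ↑ʳ_) (join-splitAt nD nD i))
    where
    helper : ∀ t → encE (unsplitE (inj₂ t)) ≡ (nD + nD) ↑ʳ join nD nD t
    helper (inj₁ _) = refl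
    helper (inj₂ _) = refl

  encE-decE : ∀ e → encE (decE e) ≡ e
  encE-decE e = trans (encE-unsplit (splitAt (nD + nD) e)) (join-splitAt (nD + nD) (nD + nD) e)

  class : Node → Bool
  class (mid _)    = false
  class (cherry _) = true
  class (core _)   = false
  class hub        = true

  counted : Edge → Bool
  counted (left p)  = K p
  counted (right p) = K p
  counted (stem p)  = K p
  counted (bar p)   = e₀ p

  cut-class : ∀ e → cut (class ∘ dec) e ≡ counted (decE e)
  cut-class e = trans (cong₂ (λ x y → class x xor class y) (dec-enc (src (decE e))) (dec-enc (tgt (decE e))))
                      (by-edge (decE e))
    where
    by-edge : ∀ e → class (src e) xor class (tgt e) ≡ counted e
    by-edge (left p) with K p | K (φ⁻¹ p)
    ... | true  | _     = refl
    ... | false | true  = refl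
    ... | false | false = refl
    by-edge (right p) with K p
    ... | true  = refl
    ... | false = refl
    by-edge (stem p) with K p
    ... | true  = refl
    ... | false = refl
    by-edge (bar p) with e₀ p
    ... | true  = refl
    ... | false = refl

  α-== : ∀ d q → α d == q ≡ d == α q
  α-== d q with bool-cases (α d == q)
  ... | inj₁ eq = trans eq (sym (trans (cong (_== α q) (trans (sym (α-invol d)) (cong α (==⇒≡ eq)))) (==-refl (α q))))
  ... | inj₂ eq = trans eq (sym (==-≢ λ d≡αq → true≢false
      (trans (cong (_== q) (trans (cong α d≡αq) (α-invol q))) (==-refl q)) eq))

  e₀-α : ∀ q → e₀ (α q) ≡ e₀ q
  e₀-α q = trans (cong₂ _xor_ (sym (α-== d₀ q)) (trans (α-== d₀ (α q)) (cong (d₀ ==_) (α-invol q))))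
                 (xor-comm (α d₀ == q) (d₀ == q))

  e₀-d₀ : e₀ d₀ ≡ true
  e₀-d₀ = cong₂ _xor_ (==-refl d₀) (==-≢ (α-fpf d₀))

  size-e₀ : size e₀ ≡ 2
  size-e₀ = trans (size-insert (d₀ ==_) (α d₀) (==-≢ (α-fpf d₀ ∘ sym))) (cong suc (size-indicator d₀))

  K-predecessor : ∀ q → K q ≡ true → K (φ⁻¹ q) ≡ false
  K-predecessor q Kq = ≢true⇒≡false λ Kp → true≢false Kq (trans (cong K (sym (φφ⁻¹ q))) (independent (φ⁻¹ q) Kp))

  h-or-successor : ∀ q → h q xor K (φ⁻¹ q) ≡ true
  h-or-successor q with bool-cases (K q)
  ... | inj₁ Kq rewrite Kq = cong not (K-predecessor q Kq)
  ... | inj₂ ¬Kq rewrite ¬Kq with K (φ⁻¹ q)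
  ... | true  = refl
  ... | false = refl

  -- Converse to `half`: the stem carries the sum over the two edges of its cherry, which makes the
  -- cherry node even, and evenness on a walk becomes evenness at its `core`.
  module Lift (x : Fin nD → Bool) (x-even : FaceEven x) where
    open FaceEven x-even

    weight : Fin nD → Bool
    weight p = e₀ p ∨ first p

    -- The two parallel bars of an edge other than d₀ carry its value only once.
    lifted : Edge → Bool
    lifted (left p)  = x p
    lifted (right p) = x (φ p)
    lifted (stem p)  = x p xor x (φ p)
    lifted (bar p)   = x p ∧ weight p

    weights : ∀ q → weight q xor (not (e₀ (α q)) ∧ weight (α q)) ≡ true
    weights q rewrite e₀-α q with e₀ q
    ... | true  = refl
    ... | false = first-xor q

    half-lifted : ∀ q → half lifted q ≡ x q
    half-lifted q = trans (cong (λ d → (h q ∧ x q) xor (K (φ⁻¹ q) ∧ x d)) (φφ⁻¹ q))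
      (trans (sym (∧-distribʳ-xor (x q) (h q) (K (φ⁻¹ q)))) (cong (_∧ x q) (h-or-successor q)))

    even-at : ∀ v → ∂ (lifted ∘ decE) (enc v) ≡ false
    even-at (mid q) = trans (∂-mid lifted q) (trans
      (cong₂ (λ y z → y xor ((x q ∧ weight q) xor (not (e₀ (α q)) ∧ (z ∧ weight (α q))))) (half-lifted q) (symmetric q))
      (trans (solve 4 (λ x w n v → x :+ ((x :* w) :+ (n :* (x :* v))) := x :+ (x :* (w :+ (n :* v)))) refl
                (x q) (weight q) (not (e₀ (α q))) (weight (α q)))
      (trans (cong (λ w → x q xor (x q ∧ w)) (weights q)) (trans (cong (x q xor_) (∧-identityʳ (x q))) (xor-same (x q))))))
    even-at (cherry q) = trans (∂-cherry lifted q)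
      (trans (cong (K q ∧_) (xor-same (x q xor x (φ q)))) (∧-zeroʳ (K q)))
    even-at (core o) = trans (∂-core lifted o) (trans (sym (half-orbit lifted o))
      (trans (⊕-cong λ p → cong ((orb p == o) ∧_) (half-lifted p)) (even o)))
    even-at hub = trans (∂-hub lifted) (trans
      (cong₂ (λ y z → (x d₀ ∧ y) xor (x (α d₀) ∧ z)) (cong (_∨ first d₀) e₀-d₀) (cong (_∨ first (α d₀)) (trans (e₀-α d₀) e₀-d₀)))
      (trans (cong (λ y → (x d₀ ∧ true) xor (y ∧ true)) (symmetric d₀)) (xor-same (x d₀ ∧ true))))

    lifted-even : Even (lifted ∘ decE)
    lifted-even v = subst (λ v → ∂ (lifted ∘ decE) v ≡ false) (enc-dec v) (even-at (dec v))

  star : Fin nD → Fin nD → Bool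
  star p = δ (vert p ==_)

  star-self : ∀ p → star p p ≡ true
  star-self p = cong₂ _xor_ (==-refl (vert p)) (==-≢ (no-loops p ∘ sym))

  star-next : ∀ p → K p ≡ true → star p (φ p) ≡ false
  star-next p Kp = cong₂ _xor_ (==-≢ λ eq → no-loops p (trans (sym (vert-φ p)) (sym eq))) (==-≢ (apart p Kp))

  module LiftStar (p : Fin nD) = Lift (star p) (δ-faceEven (vert p ==_))

  -- The witnesses are lifted vertex stars. For the stem the star of `vert p` has to miss the edge
  -- of `φ p`, which holds because the two ends of a cherry are distinct.
  bridgeless : Bridgeless (class ∘ dec)
  bridgeless e ce = by-edge (decE e) refl (trans (sym (cut-class e)) ce)
    where
    by-edge : ∀ e′ → decE e ≡ e′ → counted e′ ≡ true → ∃[ Z ] (Z e ≡ true × Even Z)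
    through : ∀ p e′ → decE e ≡ e′ → LiftStar.lifted p e′ ≡ true → ∃[ Z ] (Z e ≡ true × Even Z)
    through p e′ eq Le = LiftStar.lifted p ∘ decE , trans (cong (LiftStar.lifted p) eq) Le , LiftStar.lifted-even p
    by-edge (left p)  eq _  = through p (left p) eq (star-self p)
    by-edge (right p) eq _  = through (φ p) (right p) eq (star-self (φ p))
    by-edge (stem p)  eq Kp = through p (stem p) eq (cong₂ _xor_ (star-self p) (star-next p Kp))
    by-edge (bar p)   eq ep = through p (bar p) eq
      (cong₂ _∧_ (star-self p) (cong (_∨ first p) ep))

  module Extract (small : SmallJoin (class ∘ dec)) where
    J : Edge → Bool
    J e = proj₁ small (encE e)

    X : Edge → Bool
    X e = not (J e)

    x : Fin nD → Bool
    x = half X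

    ∂X : ∀ v → ∂ (X ∘ decE) (enc v) ≡ false
    ∂X v = begin
      ∂ (X ∘ decE) (enc v) ≡⟨ ∂-cong (λ e → cong (not ∘ proj₁ small) (encE-decE e)) (enc v) ⟩
      ∂ (all ⊻ proj₁ small) (enc v) ≡⟨ ∂-xor all (proj₁ small) (enc v) ⟩
      ∂ all (enc v) xor ∂ (proj₁ small) (enc v) ≡⟨ cong (∂ all (enc v) xor_) (proj₁ (proj₂ small) (enc v)) ⟩
      ∂ all (enc v) xor ∂ all (enc v) ≡⟨ xor-same (∂ all (enc v)) ⟩
      false ∎
      where open ≡-Reasoning

    half-bars : ∀ q → x q ≡ X (bar q) xor (not (e₀ q) ∧ X (bar (α q)))
    half-bars q = trans (xor≡false (trans (sym (∂-mid X q)) (∂X (mid q))))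
      (cong (λ e → X (bar q) xor (not e ∧ X (bar (α q)))) (e₀-α q))

    bars-d₀ : X (bar d₀) ≡ X (bar (α d₀))
    bars-d₀ = xor≡false (trans (sym (∂-hub X)) (∂X hub))

    x-symmetric : ∀ q → x (α q) ≡ x q
    x-symmetric q = trans (half-bars (α q)) (trans
      (cong₂ (λ e d → X (bar (α q)) xor (not e ∧ X (bar d))) (e₀-α q) (α-invol q))
      (trans (by-case (bool-cases (e₀ q))) (sym (half-bars q))))
      where
      bars-agree : e₀ q ≡ true → X (bar (α q)) ≡ X (bar q)
      bars-agree e with xor≡true e
      ... | inj₁ (eq , _) = subst (λ d → X (bar (α d)) ≡ X (bar d)) (==⇒≡ eq) (sym bars-d₀)
      ... | inj₂ (_ , eq) = subst (λ d → X (bar (α d)) ≡ X (bar d)) (==⇒≡ eq)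
        (trans (cong (X ∘ bar) (α-invol d₀)) bars-d₀)
      by-case : e₀ q ≡ true ⊎ e₀ q ≡ false →
        X (bar (α q)) xor (not (e₀ q) ∧ X (bar q)) ≡ X (bar q) xor (not (e₀ q) ∧ X (bar (α q)))
      by-case (inj₁ e) = trans (cong (λ e → X (bar (α q)) xor (not e ∧ X (bar q))) e)
        (trans (cong (_xor false) (bars-agree e)) (cong (λ e → X (bar q) xor (not e ∧ X (bar (α q)))) (sym e)))
      by-case (inj₂ e) = trans (cong (λ e → X (bar (α q)) xor (not e ∧ X (bar q))) e)
        (trans (xor-comm (X (bar (α q))) (X (bar q))) (cong (λ e → X (bar q) xor (not e ∧ X (bar (α q)))) (sym e)))

    cherry-even : ∀ p → K p ∧ ((X (left p) xor X (right p)) xor X (stem p)) ≡ false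
    cherry-even p = trans (sym (∂-cherry X p)) (∂X (cherry p))

    x-faceEven : FaceEven x
    x-faceEven = faceEven x-symmetric λ o → begin
      ⊕-sum (λ p → (orb p == o) ∧ half X p) ≡⟨ half-orbit X o ⟩
      ⊕-sum (λ p → (orb p == o) ∧ ((free p ∧ X (left p)) xor (K p ∧ (X (left p) xor X (right p)))))
        ≡⟨ ⊕-cong (λ p → cong (λ y → (orb p == o) ∧ ((free p ∧ X (left p)) xor y)) (same p)) ⟩
      ⊕-sum (λ p → (orb p == o) ∧ ((free p ∧ X (left p)) xor (K p ∧ X (stem p)))) ≡⟨ ∂-core X o ⟨
      ∂ (X ∘ decE) (enc (core o)) ≡⟨ ∂X (core o) ⟩
      false ∎
      where
      open ≡-Reasoning
      same : ∀ p → K p ∧ (X (left p) xor X (right p)) ≡ K p ∧ X (stem p)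
      same p = xor≡false (trans (sym (∧-distribˡ-xor (K p) (X (left p) xor X (right p)) (X (stem p)))) (cherry-even p))

    three bars : Fin nD → ℕ
    three p = (⟦ J (left p) ∧ K p ⟧ + ⟦ J (right p) ∧ K p ⟧) + ⟦ J (stem p) ∧ K p ⟧
    bars p = ⟦ J (bar p) ∧ e₀ p ⟧

    cost≡ : cost (class ∘ dec) (proj₁ small) ≡ ℕΣ.sum (λ p → three p + bars p)
    cost≡ = begin
      size (λ i → proj₁ small i ∧ cut (class ∘ dec) i)
        ≡⟨ size-cong (λ i → cong₂ _∧_ (cong (proj₁ small) (sym (encE-decE i))) (cut-class i)) ⟩
      size (λ i → J (decE i) ∧ counted (decE i)) ≡⟨ size-edges (λ e → J e ∧ counted e) ⟩
      (L + R) + (S + B) ≡⟨ ℕ.+-assoc (L + R) S B ⟨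
      ((L + R) + S) + B ≡⟨ cong (λ y → (y + S) + B) (ℕΣ.∑-distrib-+ l r) ⟨
      (ℕΣ.sum (λ p → l p + r p) + S) + B ≡⟨ cong (_+ B) (ℕΣ.∑-distrib-+ (λ p → l p + r p) s) ⟨
      ℕΣ.sum three + B ≡⟨ ℕΣ.∑-distrib-+ three bars ⟨
      ℕΣ.sum (λ p → three p + bars p) ∎
      where
      open ≡-Reasoning
      l r s : Fin nD → ℕ
      l p = ⟦ J (left p) ∧ K p ⟧
      r p = ⟦ J (right p) ∧ K p ⟧
      s p = ⟦ J (stem p) ∧ K p ⟧
      L R S B : ℕ
      L = ℕΣ.sum l
      R = ℕΣ.sum r
      S = ℕΣ.sum s
      B = ℕΣ.sum bars

    size-cut : size (cut (class ∘ dec)) ≡ 2 + 3 * size K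
    size-cut = trans (trans (size-cong cut-class) (size-edges counted))
      (trans (cong (λ e → (size K + size K) + (size K + e)) size-e₀)
      (+-*-Solver.solve 1 (λ k → (k ⊹ k) ⊹ (k ⊹ num 2) ≔ num 2 ⊹ num 3 ⋆ k) refl (size K)))
      where open +-*-Solver using () renaming (_:+_ to _⊹_; _:*_ to _⋆_; _:=_ to _≔_; con to num)

    cost≤ : ℕΣ.sum (λ p → three p + bars p) ≤ size K
    cost≤ = ℕ.≮⇒≥ λ K< → ℕ.<⇒≱ (ℕ.n<1+n (2 + 3 * size K)) (begin
      3 + 3 * size K ≡⟨ ℕ.*-suc 3 (size K) ⟨
      3 * suc (size K) ≤⟨ ℕ.*-monoʳ-≤ 3 K< ⟩
      3 * ℕΣ.sum (λ p → three p + bars p) ≡⟨ cong (3 *_) cost≡ ⟨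
      3 * cost (class ∘ dec) (proj₁ small) ≤⟨ proj₂ (proj₂ small) ⟩
      size (cut (class ∘ dec)) ≡⟨ size-cut ⟩
      2 + 3 * size K ∎)
      where open ℕ.≤-Reasoning

    -- The complement is even at a cherry node of degree three, so it omits at least one of the
    -- three edges.
    three≥ : ∀ p → ⟦ K p ⟧ ≤ three p
    three≥ p = at-least (K p) (J (left p)) (J (right p)) (J (stem p)) (cherry-even p)
      where
      at-least : ∀ k l r s → k ∧ ((not l xor not r) xor not s) ≡ false →
                 ⟦ k ⟧ ≤ (⟦ l ∧ k ⟧ + ⟦ r ∧ k ⟧) + ⟦ s ∧ k ⟧
      at-least false _ _ _ _ = z≤n
      at-least true true  _     _    _ = s≤s z≤n
      at-least true false true  _    _ = s≤s z≤n
      at-least true false false true _ = s≤s z≤n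

    -- The minima at the cherries already add up to `size K`, so the join spends exactly one edge at
    -- each cherry and none at `hub`. Hence the complement keeps both bars at `hub` and one of
    -- `left p`, `right p`.
    tight : ∀ p → three p + bars p ≤ ⟦ K p ⟧
    tight = sum-mono-tight (λ p → ℕ.≤-trans (three≥ p) (ℕ.m≤m+n (three p) (bars p))) cost≤

    bars≡0 : ∀ p → bars p ≡ 0
    bars≡0 p = ℕ.n≤0⇒n≡0 (ℕ.+-cancelˡ-≤ (three p) (bars p) 0
      (ℕ.≤-trans (tight p) (ℕ.≤-trans (three≥ p) (ℕ.≤-reflexive (sym (ℕ.+-identityʳ (three p)))))))

    x-d₀ : x d₀ ≡ true
    x-d₀ = trans (half-bars d₀) (trans (cong (λ e → X (bar d₀) xor (not e ∧ X (bar (α d₀)))) e₀-d₀)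
      (trans (xor-identityʳ (X (bar d₀))) (absent (J (bar d₀)) (e₀ d₀) e₀-d₀ (bars≡0 d₀))))
      where
      absent : ∀ j e → e ≡ true → ⟦ j ∧ e ⟧ ≡ 0 → not j ≡ true
      absent false _ _ _ = refl
      absent true .true refl ()

    x-left : ∀ p → K p ≡ true → x p ≡ X (left p)
    x-left p Kp = trans (cong₂ (λ y z → (y ∧ X (left p)) xor (z ∧ X (right (φ⁻¹ p)))) h≡ (K-predecessor p Kp)) (xor-identityʳ (X (left p)))
      where
      h≡ : h p ≡ true
      h≡ = cong (λ k → k xor (not k ∧ not (K (φ⁻¹ p)))) Kp

    x-right : ∀ p → K p ≡ true → x (φ p) ≡ X (right p)
    x-right p Kp = trans (cong (λ d → (h (φ p) ∧ X (left (φ p))) xor (K d ∧ X (right d))) (φ⁻¹φ p))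
      (cong₂ (λ y z → (y ∧ X (left (φ p))) xor (z ∧ X (right p))) h≡ Kp)
      where
      h≡ : h (φ p) ≡ false
      h≡ = cong₂ (λ k k′ → k xor (not k ∧ not k′)) (independent p Kp) (trans (cong K (φ⁻¹φ p)) Kp)

    x-hits : ∀ p → K p ≡ true → x p ≡ true ⊎ x (φ p) ≡ true
    x-hits p Kp = one-of (J (left p)) (J (right p)) (K p) Kp
        (ℕ.≤-trans (ℕ.≤-trans (ℕ.m≤m+n _ _) (ℕ.m≤m+n _ (bars p))) (tight p))
        (x-left p Kp) (x-right p Kp)
      where
      one-of : ∀ l r k → k ≡ true → ⟦ l ∧ k ⟧ + ⟦ r ∧ k ⟧ ≤ ⟦ k ⟧ → x p ≡ not l → x (φ p) ≡ not r →
               x p ≡ true ⊎ x (φ p) ≡ true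
      one-of false _ _ _ _ xl _ = inj₁ xl
      one-of true false _ _ _ _ xr = inj₂ xr
      one-of true true .true refl (s≤s ()) _ _

  abstract
    cherry-set : ∃[ x ] (FaceEven x × (∀ p → K p ≡ true → x p ≡ true ⊎ x (φ p) ≡ true) × x d₀ ≡ true)
    cherry-set = x , x-faceEven , x-hits , x-d₀
      where
      small : SmallJoin (class ∘ dec)
      small = small-join (suc (size (cut (class ∘ dec)))) (class ∘ dec) (ℕ.n<1+n _) bridgeless
      open Extract small

-- A dimension bound over 𝔽₂

funToFin-cong : ∀ {m n} {f g : Fin m → Fin n} → f ≗ g → funToFin f ≡ funToFin g
funToFin-cong {zero}  f≗g = refl
funToFin-cong {suc m} f≗g = cong₂ combine (f≗g zero) (funToFin-cong (f≗g ∘ suc))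

bit : Bool → Fin 2
bit false = zero
bit true  = suc zero

unbit : Fin 2 → Bool
unbit zero       = false
unbit (suc zero) = true

unbit-bit : ∀ x → unbit (bit x) ≡ x
unbit-bit false = refl
unbit-bit true  = refl

bit-unbit : ∀ i → bit (unbit i) ≡ i
bit-unbit zero       = refl
bit-unbit (suc zero) = refl

-- By counting rather than elimination: f is injective on 2ᵃ points with at most 2ᵇ values.
trivial-kernel⇒≤ : ∀ {a b} (f : (Fin a → Bool) → Fin b → Bool) →
  (∀ u v i → f (u ⊻ v) i ≡ f u i xor f v i) →
  (∀ u → (∀ i → f u i ≡ false) → ∀ j → u j ≡ false) → a ≤ b
trivial-kernel⇒≤ {a} {b} f additive kernel = ℕ.≮⇒≥ λ b<a →
  ℕ.<⇒≱ (ℕ.^-monoʳ-< 2 (ℕ.n<1+n 1) b<a) (injective⇒≤ injective)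
  where
  vec : Fin (2 ℕ.^ a) → Fin a → Bool
  vec i = unbit ∘ finToFun i
  g : Fin (2 ℕ.^ a) → Fin (2 ℕ.^ b)
  g i = funToFin (bit ∘ f (vec i))
  injective : ∀ {i j} → g i ≡ g j → i ≡ j
  injective {i} {j} gi≡gj = trans (sym (funToFin-finToFin {a} i))
      (trans (funToFin-cong digits) (funToFin-finToFin {a} j))
    where
    f≗ : ∀ k → f (vec i) k ≡ f (vec j) k
    f≗ k = trans (sym (unbit-bit (f (vec i) k))) (trans (cong unbit (trans
        (sym (finToFun-funToFin (bit ∘ f (vec i)) k))
        (trans (cong (λ z → finToFun z k) gi≡gj) (finToFun-funToFin (bit ∘ f (vec j)) k))))
      (unbit-bit (f (vec j) k)))
    vec≗ : ∀ k → vec i k ≡ vec j k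
    vec≗ k = xor≡false (kernel (vec i ⊻ vec j)
      (λ l → trans (additive (vec i) (vec j) l) (trans (cong (_xor f (vec j) l) (f≗ l)) (xor-same (f (vec j) l)))) k)
    digits : finToFun i ≗ finToFun j
    digits k = trans (sym (bit-unbit (finToFun i k))) (trans (cong bit (vec≗ k)) (bit-unbit (finToFun j k)))

-- Face-even sets are coboundaries

module Planarity (G : PlaneGraph) (v₀ : Fin (PlaneGraph.nV G)) (no-isolated : PlaneGraph.NoIsolated G) where

  open Map G

  root : Fin nC → Fin nV
  root k = proj₁ (comp-surj k)

  dart-at : Fin nV → Fin nD
  dart-at v = proj₁ (no-isolated v)

  base : Fin nC → Fin nO
  base k = orb (dart-at (root k))

  compOf-base : ∀ k → compOf (base k) ≡ k
  compOf-base k = trans (compOf-orb (dart-at (root k)))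
    (trans (cong comp (proj₂ (no-isolated (root k)))) (proj₂ (comp-surj k)))

  module Dual = Graph orb (orb ∘ α)

  -- `σ d` is `φ (α d)`, so turning at a vertex amounts to crossing an edge and staying on a walk.
  -- `U` is therefore constant around each vertex, hence along every path of the component.
  constant-on-components : (U : Fin nO → Bool) → (∀ d → U (orb d) xor U (orb (α d)) ≡ false) →
                           ∀ o o′ → compOf o ≡ compOf o′ → U o ≡ U o′
  constant-on-components U closed o o′ eq = begin
      U o ≡⟨ cong U (proj₂ (orb-surj o)) ⟨
      U (orb d) ≡⟨ along (comp-conn (vert d) (vert d′) same) refl refl ⟩
      U (orb d′) ≡⟨ cong U (proj₂ (orb-surj o′)) ⟩
      U o′ ∎
    where
    open ≡-Reasoning
    d d′ : Fin nD
    d = proj₁ (orb-surj o)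
    d′ = proj₁ (orb-surj o′)
    same : comp (vert d) ≡ comp (vert d′)
    same = trans (sym (compOf-orb d)) (trans (cong compOf (proj₂ (orb-surj o)))
      (trans eq (trans (cong compOf (sym (proj₂ (orb-surj o′)))) (compOf-orb d′))))
    across : ∀ d → U (orb d) ≡ U (orb (α d))
    across d = xor≡false (closed d)
    turn : ∀ d → U (orb (σ d)) ≡ U (orb d)
    turn d = trans (cong (λ e → U (orb (σ e))) (sym (α-invol d)))
      (trans (cong U (orb-φ (α d))) (sym (across d)))
    turns : ∀ k d → U (orb (iter σ k d)) ≡ U (orb d)
    turns zero d = refl
    turns (suc k) d = trans (turn (iter σ k d)) (turns k d)
    around : ∀ {d d′} → vert d ≡ vert d′ → U (orb d) ≡ U (orb d′)
    around {d} {d′} eq = trans (sym (turns (proj₁ (σ-cycle d d′ eq)) d)) (cong (U ∘ orb) (proj₂ (σ-cycle d d′ eq)))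
    along : ∀ {v w} → Star Adj v w → ∀ {d d′} → vert d ≡ v → vert d′ ≡ w → U (orb d) ≡ U (orb d′)
    along ε p q = around (trans p (sym q))
    along ((e , p′ , p″) ◅ s) p q = trans (around (trans p (sym p′))) (trans (across e) (along s p″ q))

  dual-link : ∀ o → Dual.Link all o (base (compOf o))
  dual-link o = links o (trans (constant-on-components U (λ d → closed d refl) o (base (compOf o)) (sym (compOf-base (compOf o)))) t∈)
    where open Dual.Cluster (Dual.cluster all (base (compOf o)))

  -- `Dual` has one edge for each dart, so a dual path is a set of darts that need not be symmetric;
  -- adding its image under `α` makes it so and keeps the boundary.
  z : Fin nO → Fin nD → Bool
  z o d = path d xor path (α d)
    where open Dual.Link (dual-link o)

  z-symmetric : ∀ o d → z o (α d) ≡ z o d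
  z-symmetric o d = trans (cong (λ e → path (α d) xor path e) (α-invol d)) (xor-comm (path (α d)) (path d))
    where open Dual.Link (dual-link o)

  z-orbit : ∀ o o′ → ⊕-sum (λ d → (orb d == o′) ∧ z o d) ≡ (o == o′) xor (base (compOf o) == o′)
  z-orbit o o′ = begin
    ⊕-sum (λ d → (orb d == o′) ∧ (path d xor path (α d)))
      ≡⟨ trans (⊕-cong λ d → ∧-distribˡ-xor (orb d == o′) (path d) (path (α d)))
           (⊕-xor (λ d → (orb d == o′) ∧ path d) (λ d → (orb d == o′) ∧ path (α d))) ⟩
    ⊕-sum (λ d → (orb d == o′) ∧ path d) xor ⊕-sum (λ d → (orb d == o′) ∧ path (α d))
      ≡⟨ cong (⊕-sum (λ d → (orb d == o′) ∧ path d) xor_) (trans (⊕-α (λ d → (orb d == o′) ∧ path (α d)))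
           (⊕-cong λ d → cong (λ e → (orb (α d) == o′) ∧ path e) (α-invol d))) ⟩
    ⊕-sum (λ d → (orb d == o′) ∧ path d) xor ⊕-sum (λ d → (orb (α d) == o′) ∧ path d)
      ≡⟨ trans (⊕-cong λ d → trans (∧-comm (path d) _) (∧-distribʳ-xor (path d) (orb d == o′) (orb (α d) == o′)))
           (⊕-xor (λ d → (orb d == o′) ∧ path d) (λ d → (orb (α d) == o′) ∧ path d)) ⟨
    Dual.∂ path o′ ≡⟨ ∂-path o′ ⟩
    (o == o′) xor (base (compOf o) == o′) ∎
    where
    open ≡-Reasoning
    open Dual.Link (dual-link o)

  -- One extra vertex per face, with value t, ties the components together: the edges of the
  -- enlarged connected graph outnumber those of a spanning tree by nO ∸ nC, which is also the
  -- number of independent evenness conditions.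
  module Potential (x : Fin nD → Bool) (x-even : FaceEven x)
    (β : Fin nO → Fin nV) (comp-β : ∀ o → comp (β o) ≡ compOf o) (y : Fin nO → Bool) where

    Solves : (Fin nV → Bool) → (Fin nF → Bool) → Set
    Solves c t = (∀ d → δ c d ≡ x d) × (∀ o → c (β o) xor t (faceOf o) ≡ y o)

    A B : ℕ
    A = nV + (nF + (nO + 1))
    B = nO + (1 + nC)

    col : (Fin A → Bool) → Fin nV → Bool
    col u v = u (v ↑ˡ (nF + (nO + 1)))

    faceVal : (Fin A → Bool) → Fin nF → Bool
    faceVal u f = u (nV ↑ʳ (f ↑ˡ (nO + 1)))

    coef : (Fin A → Bool) → Fin nO → Bool
    coef u o = u (nV ↑ʳ (nF ↑ʳ (o ↑ˡ 1)))

    scale : (Fin A → Bool) → Bool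
    scale u = u (nV ↑ʳ (nF ↑ʳ (nO ↑ʳ zero)))

    -- The dual paths weighted by `coef` account for labels that are not even on the walks. `scale`
    -- is the surplus coordinate: a vector of the kernel with `scale` equal to `true` is a solution.
    label : (Fin A → Bool) → Fin nD → Bool
    label u d = (δ (col u) d xor (scale u ∧ x d)) xor ⊕-sum (λ o → coef u o ∧ z o d)

    side₁ : (Fin A → Bool) → Fin nO → Bool
    side₁ u o = (col u (β o) xor faceVal u (faceOf o)) xor (scale u ∧ y o)

    -- The dual path from a base walk to itself has empty boundary, so the sums over walks do not
    -- detect its coefficient; it is set to zero by hand.
    side₃ : (Fin A → Bool) → Fin nC → Bool
    side₃ u k = coef u (base k)

    label-additive : ∀ u v d → label (u ⊻ v) d ≡ label u d xor label v d
    label-additive u v d = trans (cong (lhs xor_) (trans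
        (⊕-cong λ o → ∧-distribʳ-xor (z o d) (coef u o) (coef v o))
        (⊕-xor (λ o → coef u o ∧ z o d) (λ o → coef v o ∧ z o d))))
      (solve 9 (λ a a′ b b′ s s′ w p q →
          ((((a :+ a′) :+ (b :+ b′)) :+ ((s :+ s′) :* w)) :+ (p :+ q)) :=
          (((a :+ b) :+ (s :* w)) :+ p) :+ (((a′ :+ b′) :+ (s′ :* w)) :+ q)) refl
        (col u (vert d)) (col v (vert d)) (col u (vert (α d))) (col v (vert (α d))) (scale u) (scale v) (x d)
        (⊕-sum (λ o → coef u o ∧ z o d)) (⊕-sum (λ o → coef v o ∧ z o d)))
      where
      lhs : Bool
      lhs = δ (col (u ⊻ v)) d xor (scale (u ⊻ v) ∧ x d)

    side₁-additive : ∀ u v o → side₁ (u ⊻ v) o ≡ side₁ u o xor side₁ v o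
    side₁-additive u v o = solve 7 (λ a a′ b b′ s s′ w →
        ((a :+ a′) :+ (b :+ b′)) :+ ((s :+ s′) :* w) := ((a :+ b) :+ (s :* w)) :+ ((a′ :+ b′) :+ (s′ :* w))) refl
      (col u (β o)) (col v (β o)) (faceVal u (faceOf o)) (faceVal v (faceOf o)) (scale u) (scale v) (y o)

    label-symmetric : ∀ u d → label u (α d) ≡ label u d
    label-symmetric u d = cong₂ _xor_
      (cong₂ (λ p q → p xor (scale u ∧ q)) (FaceEven.symmetric (δ-faceEven (col u)) d) (FaceEven.symmetric x-even d))
      (⊕-cong λ o → cong (coef u o ∧_) (z-symmetric o d))

    label-orbit : ∀ u o′ → ⊕-sum (λ d → (orb d == o′) ∧ label u d) ≡
                  ⊕-sum (λ o → coef u o ∧ ((o == o′) xor (base (compOf o) == o′)))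
    label-orbit u o′ = begin
      ⊕-sum (λ d → (orb d == o′) ∧ label u d)
        ≡⟨ ⊕-cong (λ d → solve 5 (λ i p s w q → i :* ((p :+ (s :* w)) :+ q) := ((i :* p) :+ (s :* (i :* w))) :+ (i :* q)) refl
             (orb d == o′) (δ (col u) d) (scale u) (x d) (⊕-sum (λ o → coef u o ∧ z o d))) ⟩
      ⊕-sum (λ d → (D d xor (scale u ∧ E d)) xor F d)
        ≡⟨ trans (⊕-xor (λ d → D d xor (scale u ∧ E d)) F) (cong (_xor ⊕-sum F) (⊕-xor D (λ d → scale u ∧ E d))) ⟩
      (⊕-sum D xor ⊕-sum (λ d → scale u ∧ E d)) xor ⊕-sum F
        ≡⟨ cong (_xor ⊕-sum F) (cong₂ _xor_ (FaceEven.even (δ-faceEven (col u)) o′)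
             (trans (sym (𝔽₂.*-distribˡ-sum (scale u) E)) (trans (cong (scale u ∧_) (FaceEven.even x-even o′)) (∧-zeroʳ (scale u))))) ⟩
      ⊕-sum F ≡⟨ ⊕-cong (λ d → 𝔽₂.*-distribˡ-sum (orb d == o′) (λ o → coef u o ∧ z o d)) ⟩
      ⊕-sum (λ d → ⊕-sum (λ o → (orb d == o′) ∧ (coef u o ∧ z o d)))
        ≡⟨ 𝔽₂.∑-comm (λ d o → (orb d == o′) ∧ (coef u o ∧ z o d)) ⟩
      ⊕-sum (λ o → ⊕-sum (λ d → (orb d == o′) ∧ (coef u o ∧ z o d)))
        ≡⟨ ⊕-cong (λ o → trans (⊕-cong λ d → solve 3 (λ p q r → p :* (q :* r) := q :* (p :* r)) refl (orb d == o′) (coef u o) (z o d))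
             (trans (sym (𝔽₂.*-distribˡ-sum (coef u o) (λ d → (orb d == o′) ∧ z o d))) (cong (coef u o ∧_) (z-orbit o o′)))) ⟩
      ⊕-sum (λ o → coef u o ∧ ((o == o′) xor (base (compOf o) == o′))) ∎
      where
      open ≡-Reasoning
      D E F : Fin nD → Bool
      D d = (orb d == o′) ∧ δ (col u) d
      E d = (orb d == o′) ∧ x d
      F d = (orb d == o′) ∧ ⊕-sum (λ o → coef u o ∧ z o d)

    module Kernel (unsolvable : ∀ c t → ¬ Solves c t) (u : Fin A → Bool)
      (label≡0 : ∀ d → label u d ≡ false) (side₁≡0 : ∀ o → side₁ u o ≡ false)
      (col-v₀ : col u v₀ ≡ false) (side₃≡0 : ∀ k → side₃ u k ≡ false) where

      -- Coboundaries and `x` are even on every walk. What the label leaves on a walk other than the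
      -- base of its component is the coefficient of that walk alone.
      coef≡0 : ∀ o → coef u o ≡ false
      coef≡0 o′ = by-case (bool-cases (base (compOf o′) == o′))
        where
        by-case : base (compOf o′) == o′ ≡ true ⊎ base (compOf o′) == o′ ≡ false → coef u o′ ≡ false
        by-case (inj₁ eq) = trans (cong (coef u) (sym (==⇒≡ eq))) (side₃≡0 (compOf o′))
        by-case (inj₂ ne) = begin
          coef u o′ ≡⟨ ⊕-single (coef u) o′ ⟨
          ⊕-sum (λ o → coef u o ∧ (o′ == o))
            ≡⟨ ⊕-cong (λ o → cong (coef u o ∧_) (trans (==-sym o′ o) (sym (trans (cong ((o == o′) xor_) (not-base o)) (xor-identityʳ (o == o′)))))) ⟩
          ⊕-sum (λ o → coef u o ∧ ((o == o′) xor (base (compOf o) == o′))) ≡⟨ label-orbit u o′ ⟨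
          ⊕-sum (λ d → (orb d == o′) ∧ label u d)
            ≡⟨ ⊕-none (λ d → trans (cong ((orb d == o′) ∧_) (label≡0 d)) (∧-zeroʳ (orb d == o′))) ⟩
          false ∎
          where
          open ≡-Reasoning
          not-base : ∀ o → base (compOf o) == o′ ≡ false
          not-base o = ==-≢ λ eq → true≢false (trans (cong (_== o′) (trans
            (cong base (trans (sym (cong compOf eq)) (compOf-base (compOf o)))) eq)) (==-refl o′)) ne

      label-simple : ∀ d → δ (col u) d ≡ scale u ∧ x d
      label-simple d = xor≡false (trans (sym (xor-identityʳ _)) (trans
        (cong ((δ (col u) d xor (scale u ∧ x d)) xor_) (sym (⊕-none λ o → cong (_∧ z o d) (coef≡0 o)))) (label≡0 d)))

      scale≡0 : scale u ≡ false
      scale≡0 = ≢true⇒≡false λ eq → unsolvable (col u) (faceVal u)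
        ( (λ d → trans (label-simple d) (cong (_∧ x d) eq))
        , λ o → trans (xor≡false (side₁≡0 o)) (cong (_∧ y o) eq) )

      value : Fin nC ⊎ Fin nF → Bool
      value (inj₁ k) = col u (root k)
      value (inj₂ f) = faceVal u f

      edge-constant : ∀ d → col u (vert d) ≡ col u (vert (α d))
      edge-constant d = xor≡false (trans (label-simple d) (cong (_∧ x d) scale≡0))

      comp-constant : ∀ {v w} → Star Adj v w → col u v ≡ col u w
      comp-constant ε = refl
      comp-constant ((d , p , q) ◅ s) =
        trans (cong (col u) (sym p)) (trans (edge-constant d) (trans (cong (col u) q) (comp-constant s)))

      to-root : ∀ v → col u v ≡ value (inj₁ (comp v))
      to-root v = comp-constant (comp-conn v (root (comp v)) (sym (proj₂ (comp-surj (comp v)))))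

      walk-value : ∀ o → value (inj₁ (compOf o)) ≡ value (inj₂ (faceOf o))
      walk-value o = trans (cong (value ∘ inj₁) (sym (comp-β o))) (trans (sym (to-root (β o)))
        (xor≡false (trans (sym (trans (cong (λ s → (col u (β o) xor faceVal u (faceOf o)) xor (s ∧ y o)) scale≡0)
          (xor-identityʳ _))) (side₁≡0 o))))

      tree-constant : ∀ {p q} → Star BAdj p q → value p ≡ value q
      tree-constant ε = refl
      tree-constant ((o , inj₁ (refl , refl)) ◅ s) = trans (walk-value o) (tree-constant s)
      tree-constant ((o , inj₂ (refl , refl)) ◅ s) = trans (sym (walk-value o)) (tree-constant s)

      -- The incidence graph of components and faces is connected, so a single constant is left, and
      -- the condition at `v₀` removes it.
      value≡0 : ∀ p → value p ≡ false
      value≡0 p = trans (tree-constant (tree-conn p (inj₁ (comp v₀)))) (trans (sym (to-root v₀)) col-v₀)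

      kernel : ∀ j → u j ≡ false
      kernel j = subst (λ j → u j ≡ false) (join-splitAt nV (nF + (nO + 1)) j) (at (splitAt nV j))
        where
        at‴ : ∀ s → u (nV ↑ʳ (nF ↑ʳ join nO 1 s)) ≡ false
        at‴ (inj₁ o) = coef≡0 o
        at‴ (inj₂ zero) = scale≡0
        at″ : ∀ s → u (nV ↑ʳ join nF (nO + 1) s) ≡ false
        at″ (inj₁ f) = value≡0 (inj₂ f)
        at″ (inj₂ i) = subst (λ i → u (nV ↑ʳ (nF ↑ʳ i)) ≡ false) (join-splitAt nO 1 i) (at‴ (splitAt nO i))
        at : ∀ s → u (join nV (nF + (nO + 1)) s) ≡ false
        at (inj₁ v) = trans (to-root v) (value≡0 (inj₁ (comp v)))
        at (inj₂ i) = subst (λ i → u (nV ↑ʳ i) ≡ false) (join-splitAt nF (nO + 1) i) (at″ (splitAt nF i))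

    side : (Fin A → Bool) → Fin nO ⊎ (Fin 1 ⊎ Fin nC) → Bool
    side u (inj₁ o)        = side₁ u o
    side u (inj₂ (inj₁ _)) = col u v₀
    side u (inj₂ (inj₂ k)) = side₃ u k

    side-additive : ∀ u v s → side (u ⊻ v) s ≡ side u s xor side v s
    side-additive u v (inj₁ o)        = side₁-additive u v o
    side-additive u v (inj₂ (inj₁ _)) = refl
    side-additive u v (inj₂ (inj₂ k)) = refl

    splitB : Fin B → Fin nO ⊎ (Fin 1 ⊎ Fin nC)
    splitB i = Sum.map₂ (splitAt 1) (splitAt nO i)

    joinB : Fin nO ⊎ (Fin 1 ⊎ Fin nC) → Fin B
    joinB s = join nO (1 + nC) (Sum.map₂ (join 1 nC) s)

    splitB-joinB : ∀ s → splitB (joinB s) ≡ s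
    splitB-joinB (inj₁ o) = cong (Sum.map₂ (splitAt 1)) (splitAt-↑ˡ nO o (1 + nC))
    splitB-joinB (inj₂ s) = trans (cong (Sum.map₂ (splitAt 1)) (splitAt-↑ʳ nO (1 + nC) (join 1 nC s)))
                                  (cong inj₂ (splitAt-join 1 nC s))

    -- A label is symmetric, hence known from one dart of each edge: two labels fit
    -- into one function on darts.
    output : (u v : Fin A → Bool) → Fin nD ⊎ (Fin B ⊎ Fin B) → Bool
    output u v (inj₁ d)        = if first d then label u d else label v d
    output u v (inj₂ (inj₁ i)) = side u (splitB i)
    output u v (inj₂ (inj₂ i)) = side v (splitB i)

    output-additive : ∀ u u′ v v′ s → output (u ⊻ u′) (v ⊻ v′) s ≡ output u v s xor output u′ v′ s
    output-additive u u′ v v′ (inj₁ d) with first d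
    ... | true  = label-additive u u′ d
    ... | false = label-additive v v′ d
    output-additive u u′ v v′ (inj₂ (inj₁ i)) = side-additive u u′ (splitB i)
    output-additive u u′ v v′ (inj₂ (inj₂ i)) = side-additive v v′ (splitB i)

    output-label : ∀ u v → (∀ s → output u v s ≡ false) →
                   (∀ d → label u d ≡ false) × (∀ d → label v d ≡ false)
    output-label u v out≡0 = u-label , v-label
      where
      choose : ∀ {f} → f ≡ true → ∀ (p q : Bool) → (if f then p else q) ≡ p
      choose refl p q = refl
      choose′ : ∀ {f} → f ≡ false → ∀ (p q : Bool) → (if f then p else q) ≡ q
      choose′ refl p q = refl
      u-at : ∀ {d} → first d ≡ true → label u d ≡ false
      u-at {d} eq = trans (sym (choose eq (label u d) (label v d))) (out≡0 (inj₁ d))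
      v-at : ∀ {d} → first d ≡ false → label v d ≡ false
      v-at {d} eq = trans (sym (choose′ eq (label u d) (label v d))) (out≡0 (inj₁ d))
      first-α : ∀ d → first (α d) ≡ not (first d)
      first-α d = other (first d) (first (α d)) (first-xor d)
        where
        other : ∀ p q → p xor q ≡ true → q ≡ not p
        other true  false _ = refl
        other false true  _ = refl
      u-label : ∀ d → label u d ≡ false
      u-label d with bool-cases (first d)
      ... | inj₁ eq = u-at eq
      ... | inj₂ eq = trans (sym (label-symmetric u d)) (u-at (trans (first-α d) (cong not eq)))
      v-label : ∀ d → label v d ≡ false
      v-label d with bool-cases (first d)
      ... | inj₂ eq = v-at eq
      ... | inj₁ eq = trans (sym (label-symmetric v d)) (v-at (trans (first-α d) (cong not eq)))

    splitOut : Fin (nD + (B + B)) → Fin nD ⊎ (Fin B ⊎ Fin B)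
    splitOut i = Sum.map₂ (splitAt B) (splitAt nD i)

    joinOut : Fin nD ⊎ (Fin B ⊎ Fin B) → Fin (nD + (B + B))
    joinOut s = join nD (B + B) (Sum.map₂ (join B B) s)

    splitOut-joinOut : ∀ s → splitOut (joinOut s) ≡ s
    splitOut-joinOut (inj₁ d) = cong (Sum.map₂ (splitAt B)) (splitAt-↑ˡ nD d (B + B))
    splitOut-joinOut (inj₂ s) = trans (cong (Sum.map₂ (splitAt B)) (splitAt-↑ʳ nD (B + B) (join B B s)))
                                      (cong inj₂ (splitAt-join B B s))

    dimension : (∀ c t → ¬ Solves c t) → A + A ≤ nD + (B + B)
    dimension unsolvable = trivial-kernel⇒≤
        (λ w i → output (λ j → w (j ↑ˡ A)) (λ j → w (A ↑ʳ j)) (splitOut i))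
        (λ w w′ i → output-additive (λ j → w (j ↑ˡ A)) (λ j → w′ (j ↑ˡ A)) (λ j → w (A ↑ʳ j)) (λ j → w′ (A ↑ʳ j)) (splitOut i))
        kernel
      where
      kernel : ∀ w → (∀ i → output (λ j → w (j ↑ˡ A)) (λ j → w (A ↑ʳ j)) (splitOut i) ≡ false) → ∀ j → w j ≡ false
      kernel w out≡0 j = subst (λ j → w j ≡ false) (join-splitAt A A j) (at (splitAt A j))
        where
        u v : Fin A → Bool
        u j = w (j ↑ˡ A)
        v j = w (A ↑ʳ j)
        out≡0′ : ∀ s → output u v s ≡ false
        out≡0′ s = subst (λ s → output u v s ≡ false) (splitOut-joinOut s) (out≡0 (joinOut s))
        side-u : ∀ s → side u s ≡ false
        side-u s = subst (λ s → side u s ≡ false) (splitB-joinB s) (out≡0′ (inj₂ (inj₁ (joinB s))))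
        side-v : ∀ s → side v s ≡ false
        side-v s = subst (λ s → side v s ≡ false) (splitB-joinB s) (out≡0′ (inj₂ (inj₂ (joinB s))))
        at : ∀ s → w (join A A s) ≡ false
        at (inj₁ i) = Kernel.kernel unsolvable u (proj₁ (output-label u v out≡0′))
          (side-u ∘ inj₁) (side-u (inj₂ (inj₁ zero))) (side-u ∘ inj₂ ∘ inj₂) i
        at (inj₂ i) = Kernel.kernel unsolvable v (proj₂ (output-label u v out≡0′))
          (side-v ∘ inj₁) (side-v (inj₂ (inj₁ zero))) (side-v ∘ inj₂ ∘ inj₂) i

    -- By `tree-count` the left side exceeds the right by exactly 2: the `scale` coordinate, once
    -- for each of the two copies.
    too-big : ¬ (A + A ≤ nD + (B + B))
    too-big A≤ = ℕ.<⇒≱ (ℕ.m<m+n (nD + (B + B)) {2} z<s) (ℕ.≤-trans (ℕ.≤-reflexive (begin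
      (nD + (B + B)) + 2 ≡⟨ +-*-Solver.solve 3 (λ d c o → (d ⊹ ((o ⊹ (num 1 ⊹ c)) ⊹ (o ⊹ (num 1 ⊹ c)))) ⊹ num 2
                              ≔ (d ⊹ num 2 ⋆ c ⊹ num 2) ⊹ (num 2 ⋆ o ⊹ num 2)) refl nD nC nO ⟩
      (nD + 2 * nC + 2) + (2 * nO + 2) ≡⟨ cong (_+ (2 * nO + 2)) tree-count ⟨
      (2 * nF + 2 * nV) + (2 * nO + 2) ≡⟨ +-*-Solver.solve 3 (λ f v o → (num 2 ⋆ f ⊹ num 2 ⋆ v) ⊹ (num 2 ⋆ o ⊹ num 2)
                              ≔ (v ⊹ (f ⊹ (o ⊹ num 1))) ⊹ (v ⊹ (f ⊹ (o ⊹ num 1)))) refl nF nV nO ⟩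
      A + A ∎)) A≤)
      where
      open ≡-Reasoning
      open +-*-Solver using () renaming (_:+_ to _⊹_; _:*_ to _⋆_; _:=_ to _≔_; con to num)

    Solves-Subset : Subset nV → Subset nF → Set
    Solves-Subset c t = Solves (lookup c) (lookup t)

    solves? : ∀ c t → Dec (Solves-Subset c t)
    solves? c t = all? (λ d → _ Bool.≟ _) ×-dec all? (λ o → _ Bool.≟ _)

    abstract
      -- Counting only refutes that there is no solution. A witness comes from deciding `Solves`
      -- over the finitely many pairs of subsets.
      potential : ∃[ c ] ∃[ t ] Solves c t
      potential with anySubset? (λ c → anySubset? (solves? c))
      ... | yes (c , t , solved) = lookup c , lookup t , solved
      ... | no unsolved = contradiction (dimension unsolvable) too-big
        where
        unsolvable : ∀ c t → ¬ Solves c t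
        unsolvable c t (δc≡x , ct≡y) = unsolved (tabulate c , tabulate t
          , (λ d → trans (cong₂ _xor_ (lookup∘tabulate c (vert d)) (lookup∘tabulate c (vert (α d)))) (δc≡x d))
          , λ o → trans (cong₂ _xor_ (lookup∘tabulate c (β o)) (lookup∘tabulate t (faceOf o))) (ct≡y o))

-- Choice of the cherries

module Corners (G : PlaneGraph) (no-loops : PlaneGraph.NoLoops G) (S₀ : Fin (PlaneGraph.nV G) → Bool)
  (branching : Map.Branching G S₀) (reach : Map.Reaching G S₀) where

  open Map G

  centre head : Fin nD → Fin nV
  centre c = vert (φ c)
  head c = vert (α (φ c))

  -- A discrete intermediate value argument along the rotation; it finds the corner at which the
  -- neighbour stops, or starts, being a given vertex.
  σ-change : (P : Fin nD → Bool) (b : Bool) → ∀ k d → P d ≡ b → P (iter σ k d) ≡ not b →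
             ∃[ e ] (vert e ≡ vert d × P e ≡ b × P (σ e) ≡ not b)
  σ-change P b zero d Pd ¬Pd = contradiction (trans (sym Pd) ¬Pd) (≢not b)
    where
    ≢not : ∀ b → b ≢ not b
    ≢not true ()
    ≢not false ()
  σ-change P b (suc k) d Pd ¬Pd = go (P (iter σ k d) Bool.≟ b)
    where
    go : Dec (P (iter σ k d) ≡ b) → ∃[ e ] (vert e ≡ vert d × P e ≡ b × P (σ e) ≡ not b)
    go (yes eq) = iter σ k d , vert-iter k d , eq , ¬Pd
    go (no ne) = σ-change P b k d Pd (Bool.¬-not ne)

  -- Since `w` has a neighbour other than `u`, some dart from `w` to `u` is followed in the rotation
  -- by one to another vertex; the corner between the two is the one wanted.
  tail-corner : ∀ w u → S₀ w ≡ false → Adj w u → ∃[ c ] (centre c ≡ w × vert c ≡ u × head c ≢ u)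
  tail-corner w u w∉ (d , dw , du) = α e
    , trans (vert-φ (α e)) (trans (cong vert (α-invol e)) (trans e-d dw))
    , ==⇒≡ (proj₁ (proj₂ (proj₂ change)))
    , λ eq → true≢false (trans (cong (_== u) (trans (cong (vert ∘ α ∘ σ) (sym (α-invol e))) eq)) (==-refl u))
                        (proj₂ (proj₂ (proj₂ change)))
    where
    other : ∃[ d′ ] (vert d′ ≡ w × vert (α d′) ≢ u)
    other = branching w w∉ u
    turn : ∃[ k ] iter σ k d ≡ proj₁ other
    turn = σ-cycle d (proj₁ other) (trans dw (sym (proj₁ (proj₂ other))))
    P : Fin nD → Bool
    P d = vert (α d) == u
    change : ∃[ e ] (vert e ≡ vert d × P e ≡ true × P (σ e) ≡ false)
    change = σ-change P true (proj₁ turn) d (trans (cong (_== u) du) (==-refl u))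
      (trans (cong P (proj₂ turn)) (==-≢ (proj₂ (proj₂ other))))
    e : Fin nD
    e = proj₁ change
    e-d : vert e ≡ vert d
    e-d = proj₁ (proj₂ change)

  head-corner : ∀ w u → S₀ w ≡ false → Adj w u → ∃[ c ] (centre c ≡ w × head c ≡ u × vert c ≢ u)
  head-corner w u w∉ (d , dw , du) = α e
    , trans (vert-φ (α e)) (trans (cong vert (α-invol e)) (trans e-d (proj₁ (proj₂ other))))
    , trans (cong (vert ∘ α ∘ σ) (α-invol e)) (==⇒≡ (proj₂ (proj₂ (proj₂ change))))
    , λ eq → true≢false (trans (cong (_== u) eq) (==-refl u)) (proj₁ (proj₂ (proj₂ change)))
    where
    other : ∃[ d′ ] (vert d′ ≡ w × vert (α d′) ≢ u)
    other = branching w w∉ u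
    turn : ∃[ k ] iter σ k (proj₁ other) ≡ d
    turn = σ-cycle (proj₁ other) d (trans (proj₁ (proj₂ other)) (sym dw))
    P : Fin nD → Bool
    P d = vert (α d) == u
    change : ∃[ e ] (vert e ≡ vert (proj₁ other) × P e ≡ false × P (σ e) ≡ true)
    change = σ-change P false (proj₁ turn) (proj₁ other) (==-≢ (proj₂ (proj₂ other)))
      (trans (cong P (proj₂ turn)) (trans (cong (_== u) du) (==-refl u)))
    e : Fin nD
    e = proj₁ change
    e-d : vert e ≡ vert (proj₁ other)
    e-d = proj₁ (proj₂ change)

  -- Two corners compete only if each is centred at an end of the other.  The visited vertices have
  -- their corners' ends visited, except for the last one; its missing end is visited next, with a
  -- corner turned so as not to compete with it.
  record State (S : Fin nV → Bool) : Set where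
    field
      S₀⊑S   : S₀ ⊑ S
      corner : Fin nV → Fin nD
      at     : ∀ v → S v ≡ true → S₀ v ≡ false → centre (corner v) ≡ v
      apart  : ∀ v → S v ≡ true → S₀ v ≡ false → vert (corner v) ≢ head (corner v)
      compatible : ∀ u v → S u ≡ true → S₀ u ≡ false → S v ≡ true → S₀ v ≡ false → corner u ≢ φ (corner v)

  φ-moves : ∀ c → c ≢ φ c
  φ-moves c eq = no-loops c (sym (trans (cong vert eq) (vert-φ c)))

  -- A conflict `corner u ≡ φ (corner v)` makes `v` the tail of the corner of `u` and `u` the head
  -- of the corner of `v`. `before` rules this out when the new corner precedes an old one, `after`
  -- when it follows one.
  module Add {S : Fin nV → Bool} (st : State S) (w : Fin nV) (w∉S : S w ≡ false)
    (c : Fin nD) (c-at : centre c ≡ w) (c-apart : vert c ≢ head c)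
    (before : ∀ v → S v ≡ true → S₀ v ≡ false → vert (State.corner st v) ≡ w → head c ≢ v)
    (after  : ∀ v → S v ≡ true → S₀ v ≡ false → head (State.corner st v) ≡ w → vert c ≢ v) where
    open State st

    S′ : Fin nV → Bool
    S′ = S ⊻ (w ==_)

    corner′ : Fin nV → Fin nD
    corner′ v = if w == v then c else corner v

    data View (v : Fin nV) : Set where
      new : v ≡ w → corner′ v ≡ c → View v
      old : S v ≡ true → corner′ v ≡ corner v → View v

    view : ∀ v → S′ v ≡ true → View v
    view v h = by-case (bool-cases (w == v))
      where
      by-case : w == v ≡ true ⊎ w == v ≡ false → View v
      by-case (inj₁ eq) = new (sym (==⇒≡ eq)) (cong (λ b → if b then c else corner v) eq)
      by-case (inj₂ ne) = old (trans (sym (trans (cong (S v xor_) ne) (xor-identityʳ (S v)))) h)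
                              (cong (λ b → if b then c else corner v) ne)

    tail-of-successor : ∀ {c c′} → c′ ≡ φ c → vert c′ ≡ centre c
    tail-of-successor eq = cong vert eq

    head-of-predecessor : ∀ {c c′} → c′ ≡ φ c → head c ≡ centre c′
    head-of-predecessor {c} {c′} eq = trans (cong (vert ∘ α) (sym eq)) (sym (vert-φ c′))

    state : State S′
    state = record
      { S₀⊑S = λ v v∈ → cong₂ _xor_ (S₀⊑S v v∈) (==-≢ λ w≡v → true≢false (S₀⊑S v v∈) (trans (cong S (sym w≡v)) w∉S))
      ; corner = corner′ ; at = at′ ; apart = apart′ ; compatible = compatible′ }
      where
      at′ : ∀ v → S′ v ≡ true → S₀ v ≡ false → centre (corner′ v) ≡ v
      at′ v h v∉ with view v h
      ... | new v≡w eq = trans (cong centre eq) (trans c-at (sym v≡w))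
      ... | old Sv eq = trans (cong centre eq) (at v Sv v∉)
      apart′ : ∀ v → S′ v ≡ true → S₀ v ≡ false → vert (corner′ v) ≢ head (corner′ v)
      apart′ v h v∉ with view v h
      ... | new _ eq = subst (λ d → vert d ≢ head d) (sym eq) c-apart
      ... | old Sv eq = subst (λ d → vert d ≢ head d) (sym eq) (apart v Sv v∉)
      compatible′ : ∀ u v → S′ u ≡ true → S₀ u ≡ false → S′ v ≡ true → S₀ v ≡ false → corner′ u ≢ φ (corner′ v)
      compatible′ u v hu u∉ hv v∉ conflict with view u hu | view v hv
      ... | new _ equ | new _ eqv = φ-moves c (trans (sym equ) (trans conflict (cong φ eqv)))
      ... | old Su equ | old Sv eqv = compatible u v Su u∉ Sv v∉ (trans (sym equ) (trans conflict (cong φ eqv)))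
      ... | old Su equ | new _ eqv = before u Su u∉ (trans (tail-of-successor follows) c-at)
          (trans (head-of-predecessor follows) (at u Su u∉))
        where
        follows : corner u ≡ φ c
        follows = trans (sym equ) (trans conflict (cong φ eqv))
      ... | new _ equ | old Sv eqv = after v Sv v∉ (trans (head-of-predecessor follows) c-at)
          (trans (tail-of-successor follows) (at v Sv v∉))
        where
        follows : c ≡ φ (corner v)
        follows = trans (sym equ) (trans conflict (cong φ eqv))

    grow : ∀ {u} → S u ≡ true → S′ u ≡ true
    grow {u} Su = cong₂ _xor_ Su (==-≢ λ w≡u → true≢false Su (trans (cong S (sym w≡u)) w∉S))

    w∈S′ : S′ w ≡ true
    w∈S′ = cong₂ _xor_ w∉S (==-refl w)

    corner-w : corner′ w ≡ c
    corner-w = cong (λ b → if b then c else corner w) (==-refl w)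

    fewer : ∀ k → size (not ∘ S) < suc k → size (not ∘ S′) < k
    fewer k (s≤s bound) = subst (_≤ k) (trans (size-delete (not ∘ S) w (cong not w∉S))
      (cong suc (size-cong λ x → sym (Bool.not-distribˡ-xor (S x) (w == x))))) bound

  Ends : {S : Fin nV → Bool} → State S → Fin nV → Set
  Ends {S} st v = S (vert (State.corner st v)) ≡ true × S (head (State.corner st v)) ≡ true

  ClosedBut : {S : Fin nV → Bool} → State S → Fin nV → Set
  ClosedBut {S} st t = ∀ v → S v ≡ true → S₀ v ≡ false → v ≢ t → Ends st v

  Closed : {S : Fin nV → Bool} → State S → Set
  Closed {S} st = ∀ v → S v ≡ true → S₀ v ≡ false → Ends st v

  Complete : Set
  Complete = State all

  centre-adj-tail : ∀ {c v} → centre c ≡ v → Adj (vert c) v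
  centre-adj-tail {c} at = c , refl , trans (sym (vert-φ c)) at

  centre-adj-head : ∀ {c v} → centre c ≡ v → Adj (head c) v
  centre-adj-head {c} at = α (φ c) , refl , trans (cong vert (α-invol (φ c))) at

  closed-but-new : ∀ {S} (st : State S) w w∉ c at ap bf af →
    (∀ v → S v ≡ true → S₀ v ≡ false → S (vert (State.corner st v)) ≡ true ⊎ vert (State.corner st v) ≡ w) →
    (∀ v → S v ≡ true → S₀ v ≡ false → S (head (State.corner st v)) ≡ true ⊎ head (State.corner st v) ≡ w) →
    ClosedBut (Add.state st w w∉ c at ap bf af) w
  closed-but-new {S} st w w∉ c at ap bf af tails heads v hv v∉ v≢w with Add.view st w w∉ c at ap bf af v hv
  ... | Add.new v≡w _ = contradiction v≡w v≢w
  ... | Add.old Sv eq = subst (λ d → Add.S′ st w w∉ c at ap bf af (vert d) ≡ true × Add.S′ st w w∉ c at ap bf af (head d) ≡ true) (sym eq)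
      (included (tails v Sv v∉) , included (heads v Sv v∉))
    where
    included : ∀ {u} → S u ≡ true ⊎ u ≡ w → Add.S′ st w w∉ c at ap bf af u ≡ true
    included (inj₁ Su) = Add.grow st w w∉ c at ap bf af Su
    included (inj₂ refl) = Add.w∈S′ st w w∉ c at ap bf af

  Frontier : (Fin nV → Bool) → Fin nD → Bool
  Frontier S d = S (vert d) ∧ not (S (vert (α d)))

  all-visited : ∀ {S} → State S → (∀ d → Frontier S d ≡ false) → ∀ v → S v ≡ true
  all-visited {S} st none′ v = along (proj₂ (proj₂ (reach v))) (State.S₀⊑S st _ (proj₁ (proj₂ (reach v))))
    where
    step : ∀ d → S (vert d) ≡ true → S (vert (α d)) ≡ true
    step d Sd = ≢false⇒≡true λ eq → true≢false (∧-intro Sd (cong not eq)) (none′ d)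
    along : ∀ {u w} → Star Adj u w → S u ≡ true → S w ≡ true
    along ε Su = Su
    along ((d , p , q) ◅ s) Su = along s (trans (cong S (sym q)) (step d (trans (cong S p) Su)))

  -- While all ends of corners are visited, no corner ends at an unvisited vertex. A vertex entered
  -- along a frontier edge may thus take any corner with a visited tail, without conflict.
  run : ∀ k {S} (st : State S) → size (not ∘ S) < k → Closed st → Complete
  -- Only the corner of `t` may point outside. If its tail `w` is missing, `w` gets a corner with
  -- tail `t` and head other than `t`; if its head is missing, the roles are exchanged. With `t` on
  -- the same side of both corners they cannot be consecutive, and again at most one end is missing.
  follow : ∀ k {S} (st : State S) → size (not ∘ S) < k → ∀ t → S t ≡ true → S₀ t ≡ false →
           ClosedBut st t →
           S (vert (State.corner st t)) ≡ true ⊎ S (head (State.corner st t)) ≡ true → Complete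

  not-S₀ : ∀ {S} → State S → ∀ {w} → S w ≡ false → S₀ w ≡ false
  not-S₀ st w∉ = ≢true⇒≡false λ w∈ → true≢false (State.S₀⊑S st _ w∈) w∉

  run (suc k) {S} st bound closed = go (find (Frontier S))
    where
    go : (∃[ d ] Frontier S d ≡ true) ⊎ (∀ d → Frontier S d ≡ false) → Complete
    go (inj₂ none′) = record
      { S₀⊑S = λ _ _ → refl ; corner = corner
      ; at = λ v _ → at v (visited v)
      ; apart = λ v _ → apart v (visited v)
      ; compatible = λ u v _ u∉ _ → compatible u v (visited u) u∉ (visited v) }
      where
      open State st
      visited : ∀ v → S v ≡ true
      visited = all-visited st none′
    go (inj₁ (d , h)) = follow k state (fewer k bound) w w∈S′ w∉S₀
        (closed-but-new st w w∉ c (proj₁ (proj₂ new-corner)) c-apart no-before no-after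
          (λ v Sv v∉ → inj₁ (proj₁ (closed v Sv v∉))) (λ v Sv v∉ → inj₁ (proj₂ (closed v Sv v∉))))
        (inj₁ (trans (cong (S′ ∘ vert) corner-w) (trans (cong S′ c-tail) (grow Sd))))
      where
      w : Fin nV
      w = vert (α d)
      Sd : S (vert d) ≡ true
      Sd = proj₁ (∧-true h)
      w∉ : S w ≡ false
      w∉ = ≢true⇒≡false λ Sw → true≢false (proj₂ (∧-true {S (vert d)} h)) (cong not Sw)
      w∉S₀ : S₀ w ≡ false
      w∉S₀ = not-S₀ st w∉
      new-corner : ∃[ c ] (centre c ≡ w × vert c ≡ vert d × head c ≢ vert d)
      new-corner = tail-corner w (vert d) w∉S₀ (α d , refl , cong vert (α-invol d))
      c : Fin nD
      c = proj₁ new-corner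
      c-tail : vert c ≡ vert d
      c-tail = proj₁ (proj₂ (proj₂ new-corner))
      c-apart : vert c ≢ head c
      c-apart eq = proj₂ (proj₂ (proj₂ new-corner)) (trans (sym eq) c-tail)
      no-before : ∀ v → S v ≡ true → S₀ v ≡ false → vert (State.corner st v) ≡ w → head c ≢ v
      no-before v Sv v∉ eq _ = true≢false (proj₁ (closed v Sv v∉)) (trans (cong S eq) w∉)
      no-after : ∀ v → S v ≡ true → S₀ v ≡ false → head (State.corner st v) ≡ w → vert c ≢ v
      no-after v Sv v∉ eq _ = true≢false (proj₂ (closed v Sv v∉)) (trans (cong S eq) w∉)
      open Add st w w∉ c (proj₁ (proj₂ new-corner)) c-apart no-before no-after

  follow k {S} st bound t St t∉ closed-but one-end =
      go (bool-cases (S (vert (corner t)))) (bool-cases (S (head (corner t)))) one-end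
    where
    open State st

    settled : S (vert (corner t)) ≡ true → S (head (corner t)) ≡ true → Closed st
    settled tail∈ head∈ v Sv v∉ with v ≟ t
    ... | yes refl = tail∈ , head∈
    ... | no v≢t = closed-but v Sv v∉ v≢t

    t-unique : ∀ {v w} → S v ≡ true → S₀ v ≡ false → S w ≡ false →
               vert (corner v) ≡ w ⊎ head (corner v) ≡ w → v ≡ t
    t-unique {v} Sv v∉ w∉ touches with v ≟ t
    ... | yes v≡t = v≡t
    ... | no v≢t = contradiction touches λ
      { (inj₁ eq) → true≢false (proj₁ (closed-but v Sv v∉ v≢t)) (trans (cong S eq) w∉)
      ; (inj₂ eq) → true≢false (proj₂ (closed-but v Sv v∉ v≢t)) (trans (cong S eq) w∉) }

    to-tail : ∀ k → size (not ∘ S) < k → S (vert (corner t)) ≡ false → S (head (corner t)) ≡ true → Complete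
    to-tail (suc k) bound w∉ head∈ = follow k state (fewer k bound) w w∈S′ w∉S₀
        (closed-but-new st w w∉ c (proj₁ (proj₂ new-corner)) c-apart no-before no-after tails heads)
        (inj₁ (trans (cong (S′ ∘ vert) corner-w) (trans (cong S′ c-tail) (grow St))))
      where
      w : Fin nV
      w = vert (corner t)
      w∉S₀ : S₀ w ≡ false
      w∉S₀ = not-S₀ st w∉
      new-corner : ∃[ c ] (centre c ≡ w × vert c ≡ t × head c ≢ t)
      new-corner = tail-corner w t w∉S₀ (centre-adj-tail (at t St t∉))
      c : Fin nD
      c = proj₁ new-corner
      c-tail : vert c ≡ t
      c-tail = proj₁ (proj₂ (proj₂ new-corner))
      c-apart : vert c ≢ head c
      c-apart eq = proj₂ (proj₂ (proj₂ new-corner)) (trans (sym eq) c-tail)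
      no-before : ∀ v → S v ≡ true → S₀ v ≡ false → vert (corner v) ≡ w → head c ≢ v
      no-before v Sv v∉ eq head≡v = proj₂ (proj₂ (proj₂ new-corner)) (trans head≡v (t-unique Sv v∉ w∉ (inj₁ eq)))
      no-after : ∀ v → S v ≡ true → S₀ v ≡ false → head (corner v) ≡ w → vert c ≢ v
      no-after v Sv v∉ eq _ = true≢false head∈
        (subst (λ v → S (head (corner v)) ≡ false) (t-unique Sv v∉ w∉ (inj₂ eq)) (trans (cong S eq) w∉))
      tails : ∀ v → S v ≡ true → S₀ v ≡ false → S (vert (corner v)) ≡ true ⊎ vert (corner v) ≡ w
      tails v Sv v∉ with v ≟ t
      ... | yes refl = inj₂ refl
      ... | no v≢t = inj₁ (proj₁ (closed-but v Sv v∉ v≢t))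
      heads : ∀ v → S v ≡ true → S₀ v ≡ false → S (head (corner v)) ≡ true ⊎ head (corner v) ≡ w
      heads v Sv v∉ with v ≟ t
      ... | yes refl = inj₁ head∈
      ... | no v≢t = inj₁ (proj₂ (closed-but v Sv v∉ v≢t))
      open Add st w w∉ c (proj₁ (proj₂ new-corner)) c-apart no-before no-after

    to-head : ∀ k → size (not ∘ S) < k → S (head (corner t)) ≡ false → S (vert (corner t)) ≡ true → Complete
    to-head (suc k) bound w∉ tail∈ = follow k state (fewer k bound) w w∈S′ w∉S₀
        (closed-but-new st w w∉ c (proj₁ (proj₂ new-corner)) c-apart no-before no-after tails heads)
        (inj₂ (trans (cong (S′ ∘ head) corner-w) (trans (cong S′ c-head) (grow St))))
      where
      w : Fin nV
      w = head (corner t)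
      w∉S₀ : S₀ w ≡ false
      w∉S₀ = not-S₀ st w∉
      new-corner : ∃[ c ] (centre c ≡ w × head c ≡ t × vert c ≢ t)
      new-corner = head-corner w t w∉S₀ (centre-adj-head (at t St t∉))
      c : Fin nD
      c = proj₁ new-corner
      c-head : head c ≡ t
      c-head = proj₁ (proj₂ (proj₂ new-corner))
      c-apart : vert c ≢ head c
      c-apart eq = proj₂ (proj₂ (proj₂ new-corner)) (trans eq c-head)
      no-before : ∀ v → S v ≡ true → S₀ v ≡ false → vert (corner v) ≡ w → head c ≢ v
      no-before v Sv v∉ eq _ = true≢false tail∈
        (subst (λ v → S (vert (corner v)) ≡ false) (t-unique Sv v∉ w∉ (inj₁ eq)) (trans (cong S eq) w∉))
      no-after : ∀ v → S v ≡ true → S₀ v ≡ false → head (corner v) ≡ w → vert c ≢ v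
      no-after v Sv v∉ eq tail≡v = proj₂ (proj₂ (proj₂ new-corner)) (trans tail≡v (t-unique Sv v∉ w∉ (inj₂ eq)))
      tails : ∀ v → S v ≡ true → S₀ v ≡ false → S (vert (corner v)) ≡ true ⊎ vert (corner v) ≡ w
      tails v Sv v∉ with v ≟ t
      ... | yes refl = inj₁ tail∈
      ... | no v≢t = inj₁ (proj₁ (closed-but v Sv v∉ v≢t))
      heads : ∀ v → S v ≡ true → S₀ v ≡ false → S (head (corner v)) ≡ true ⊎ head (corner v) ≡ w
      heads v Sv v∉ with v ≟ t
      ... | yes refl = inj₂ refl
      ... | no v≢t = inj₁ (proj₂ (closed-but v Sv v∉ v≢t))
      open Add st w w∉ c (proj₁ (proj₂ new-corner)) c-apart no-before no-after

    go : S (vert (corner t)) ≡ true ⊎ S (vert (corner t)) ≡ false →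
         S (head (corner t)) ≡ true ⊎ S (head (corner t)) ≡ false →
         S (vert (corner t)) ≡ true ⊎ S (head (corner t)) ≡ true → Complete
    go (inj₁ tail∈) (inj₁ head∈) _ = run k st bound (settled tail∈ head∈)
    go (inj₂ tail∉) (inj₁ head∈) _ = to-tail k bound tail∉ head∈
    go (inj₁ tail∈) (inj₂ head∉) _ = to-head k bound head∉ tail∈
    go (inj₂ tail∉) (inj₂ head∉) (inj₁ tail∈) = contradiction tail∉ (true≢false tail∈)
    go (inj₂ tail∉) (inj₂ head∉) (inj₂ head∈) = contradiction head∉ (true≢false head∈)

  module Selection (no-isolated : NoIsolated) where

    start : State S₀
    start = record
      { S₀⊑S = λ _ h → h ; corner = λ v → proj₁ (no-isolated v)
      ; at = λ _ h h′ → contradiction h′ (true≢false h)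
      ; apart = λ _ h h′ → contradiction h′ (true≢false h)
      ; compatible = λ _ _ h h′ → contradiction h′ (true≢false h) }

    abstract
      complete : Complete
      complete = run (suc (size (not ∘ S₀))) start (ℕ.n<1+n _) λ _ h h′ → contradiction h′ (true≢false h)

    open State complete public using (corner)

    corner-centre : ∀ v → S₀ v ≡ false → centre (corner v) ≡ v
    corner-centre v = State.at complete v refl

    at-vertex : Fin nD → Bool
    at-vertex p = not (S₀ (centre p)) ∧ (corner (centre p) == p)

    spread : Fin nD → Bool
    spread p = not (vert p == head p)

    used : Fin nO → Bool
    used o with find (λ p → (orb p == o) ∧ at-vertex p)
    ... | inj₁ _ = true
    ... | inj₂ _ = false

    unused : ∀ {o} → used o ≡ false → ∀ p → orb p ≡ o → at-vertex p ≡ false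
    unused {o} eq p refl with find (λ p → (orb p == o) ∧ at-vertex p)
    ... | inj₂ none′ = ≢true⇒≡false λ h → true≢false (∧-intro (==-refl o) h) (none′ p)

    used-witness : ∀ {o} → used o ≡ true → ∃[ p ] (orb p ≡ o × at-vertex p ≡ true)
    used-witness {o} eq with find (λ p → (orb p == o) ∧ at-vertex p)
    ... | inj₁ (p , h) = p , ==⇒≡ (proj₁ (∧-true h)) , proj₂ (∧-true {orb p == o} h)

    pick : (o : Fin nO) → (∃[ p ] (orb p == o) ∧ spread p ≡ true) ⊎ (∀ p → (orb p == o) ∧ spread p ≡ false)
    pick o = find (λ p → (orb p == o) ∧ spread p)

    picked-from : ∀ {o} → (∃[ p ] (orb p == o) ∧ spread p ≡ true) ⊎ (∀ p → (orb p == o) ∧ spread p ≡ false) → Fin nD → Bool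
    picked-from (inj₁ (p , _)) q = p == q
    picked-from (inj₂ _)       q = false

    -- A walk receives an extra cherry only if it contains no corner chosen for a vertex, and then
    -- just one. The two kinds thus never share a walk, which keeps `K` independent.
    picked : Fin nD → Bool
    picked q = not (used (orb q)) ∧ picked-from (pick (orb q)) q

    picked-unique : ∀ {p q} → orb p ≡ orb q → picked p ≡ true → picked q ≡ true → p ≡ q
    picked-unique {p} {q} eq hp hq = by-case (pick (orb q))
        (trans (cong (λ o → picked-from (pick o) p) (sym eq)) (proj₂ (∧-true {not (used (orb p))} hp)))
        (proj₂ (∧-true {not (used (orb q))} hq))
      where
      by-case : ∀ r → picked-from r p ≡ true → picked-from r q ≡ true → p ≡ q
      by-case (inj₁ (r , _)) rp rq = trans (sym (==⇒≡ {i = r} {p} rp)) (==⇒≡ {i = r} {q} rq)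

    picked-spread : ∀ {p} → picked p ≡ true → spread p ≡ true
    picked-spread {p} h = by-case (pick (orb p)) (proj₂ (∧-true {not (used (orb p))} h))
      where
      by-case : ∀ r → picked-from r p ≡ true → spread p ≡ true
      by-case (inj₁ (r , h′)) rp = subst (λ p → spread p ≡ true) (==⇒≡ rp) (proj₂ (∧-true {orb r == orb p} h′))

    K : Fin nD → Bool
    K p = at-vertex p ∨ picked p

    ∨-cases : ∀ {x y} → x ∨ y ≡ true → x ≡ true ⊎ y ≡ true
    ∨-cases {true}  _ = inj₁ refl
    ∨-cases {false} h = inj₂ h

    spread⇒≢ : ∀ {p} → spread p ≡ true → vert p ≢ head p
    spread⇒≢ {p} h eq = true≢false h (cong not (trans (cong (_== head p) eq) (==-refl (head p))))

    not⇒≡false : ∀ {x} → not x ≡ true → x ≡ false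
    not⇒≡false {false} _ = refl

    at-vertex-elim : ∀ {p} → at-vertex p ≡ true → S₀ (centre p) ≡ false × corner (centre p) ≡ p
    at-vertex-elim {p} h = not⇒≡false (proj₁ (∧-true h)) , ==⇒≡ (proj₂ (∧-true {not (S₀ (centre p))} h))

    K-apart : ∀ p → K p ≡ true → vert p ≢ head p
    K-apart p h with ∨-cases {at-vertex p} h
    ... | inj₁ hv = let (v∉ , eq) = at-vertex-elim hv in
      subst (λ d → vert d ≢ head d) eq (State.apart complete (centre p) refl v∉)
    ... | inj₂ hf = spread⇒≢ (picked-spread hf)

    K-independent : ∀ p → K p ≡ true → K (φ p) ≡ false
    K-independent p h = ≢true⇒≡false λ h′ → clash (∨-cases {at-vertex p} h) (∨-cases {at-vertex (φ p)} h′)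
      where
      unused-orb : ∀ {q} → picked q ≡ true → used (orb q) ≡ false
      unused-orb hq = not⇒≡false (proj₁ (∧-true hq))
      clash : at-vertex p ≡ true ⊎ picked p ≡ true → at-vertex (φ p) ≡ true ⊎ picked (φ p) ≡ true → ⊥
      clash (inj₁ hv) (inj₁ hv′) =
        let (u∉ , equ) = at-vertex-elim hv′ ; (v∉ , eqv) = at-vertex-elim hv in
        State.compatible complete (centre (φ p)) (centre p) refl u∉ refl v∉ (trans equ (cong φ (sym eqv)))
      clash (inj₁ hv) (inj₂ hf) = true≢false hv (unused (unused-orb hf) p (sym (orb-φ p)))
      clash (inj₂ hf) (inj₁ hv) = true≢false hv (unused (unused-orb hf) (φ p) (orb-φ p))
      clash (inj₂ hf) (inj₂ hf′) = φ-moves p (picked-unique (sym (orb-φ p)) hf hf′)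

    K-corner : ∀ v → S₀ v ≡ false → K (corner v) ≡ true
    K-corner v v∉ = cong (_∨ picked (corner v)) (cong₂ (λ s b → not s ∧ b)
      (trans (cong S₀ (corner-centre v v∉)) v∉)
      (trans (cong (λ w → corner w == corner v) (corner-centre v v∉)) (==-refl (corner v))))

    K-covers : ∀ p → spread p ≡ true → ∃[ q ] (orb q ≡ orb p × K q ≡ true)
    K-covers p hp = by-used (bool-cases (used (orb p)))
      where
      picked-K : used (orb p) ≡ false → ∀ q → orb q ≡ orb p → picked-from (pick (orb p)) q ≡ true → K q ≡ true
      picked-K eq q qp h = trans (cong (at-vertex q ∨_) (∧-intro (cong not (trans (cong used qp) eq))
        (trans (cong (λ o → picked-from (pick o) q) qp) h))) (Bool.∨-zeroʳ (at-vertex q))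
      by-pick : ∀ (r : (∃[ q ] (orb q == orb p) ∧ spread q ≡ true) ⊎ (∀ q → (orb q == orb p) ∧ spread q ≡ false)) →
                pick (orb p) ≡ r → used (orb p) ≡ false → ∃[ q ] (orb q ≡ orb p × K q ≡ true)
      by-pick (inj₁ (q , h)) eq un = q , qp , picked-K un q qp (trans (cong (λ r → picked-from r q) eq) (==-refl q))
        where
        qp : orb q ≡ orb p
        qp = ==⇒≡ (proj₁ (∧-true h))
      by-pick (inj₂ none′) _ _ = contradiction (none′ p) (true≢false (∧-intro (==-refl (orb p)) hp))
      by-used : used (orb p) ≡ true ⊎ used (orb p) ≡ false → ∃[ q ] (orb q ≡ orb p × K q ≡ true)
      by-used (inj₁ us) = let (q , qp , h) = used-witness us in q , qp , cong (_∨ picked q) h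
      by-used (inj₂ un) = by-pick (pick (orb p)) refl un

count≡size : ∀ {n} (p : Fin n → Bool) → count p ≡ size p
count≡size {zero} p = refl
count≡size {suc n} p with p zero
... | true  = cong suc (count≡size (p ∘ suc))
... | false = count≡size (p ∘ suc)

-- Face walks alternating between two vertices

module Zigzag (G : PlaneGraph) (v₀ : Fin (PlaneGraph.nV G)) (no-isolated : PlaneGraph.NoIsolated G)
  (no-loops : PlaneGraph.NoLoops G) where

  open Map G
  open Planarity G v₀ no-isolated

  first-visit : ∀ d e → ∀ k → iter σ k d ≡ e → ∃[ j ] (iter σ j d ≡ e × (∀ i → i < j → iter σ i d ≢ e))
  first-visit d e k eq = search k 0 (trans (cong (λ j → iter σ j d) (ℕ.+-identityʳ k)) eq) (λ _ ())
    where
    search : ∀ m j → iter σ (m + j) d ≡ e → (∀ i → i < j → iter σ i d ≢ e) →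
             ∃[ j ] (iter σ j d ≡ e × (∀ i → i < j → iter σ i d ≢ e))
    search zero j eq before = j , eq , before
    search (suc m) j eq before with iter σ j d ≟ e
    ... | yes found = j , found , before
    ... | no missed = search m (suc j) (trans (cong (λ i → iter σ i d) (ℕ.+-suc m j)) eq) before′
      where
      before′ : ∀ i → i < suc j → iter σ i d ≢ e
      before′ i (s≤s i≤j) with ℕ.m≤n⇒m<n∨m≡n i≤j
      ... | inj₁ i<j = before i i<j
      ... | inj₂ refl = missed

  -- The darts d, σ d, …, σᵏ d, crossed by a closed curve around vert d when d and
  -- σᵏ⁺¹ d leave the same face.
  arc : Fin nD → ℕ → Fin nD → Bool
  arc d zero    e = (d == e) xor (d == α e)
  arc d (suc k) e = ((iter σ (suc k) d == e) xor (iter σ (suc k) d == α e)) xor arc d k e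

  -- Crossing the edge of `f` leads from the walk of `f` to that of `σ f`; the intermediate walks
  -- cancel.
  arc-orbit : ∀ d k o → ⊕-sum (λ e → (orb e == o) ∧ arc d k e) ≡ (orb d == o) xor (orb (σ (iter σ k d)) == o)
  arc-orbit d k o = go k
    where
    orb-α : ∀ e → orb (α e) ≡ orb (σ e)
    orb-α e = trans (sym (orb-φ (α e))) (cong (orb ∘ σ) (α-invol e))
    single : ∀ f → ⊕-sum (λ e → (orb e == o) ∧ ((f == e) xor (f == α e))) ≡ (orb f == o) xor (orb (σ f) == o)
    single f = trans (⊕-cong λ e → ∧-distribˡ-xor (orb e == o) (f == e) (f == α e))
      (trans (⊕-xor (λ e → (orb e == o) ∧ (f == e)) (λ e → (orb e == o) ∧ (f == α e)))
      (cong₂ _xor_ (⊕-single (λ e → orb e == o) f)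
        (trans (⊕-α (λ e → (orb e == o) ∧ (f == α e)))
        (trans (⊕-cong λ e → cong ((orb (α e) == o) ∧_) (cong (f ==_) (α-invol e)))
        (trans (⊕-single (λ e → orb (α e) == o) f) (cong (_== o) (orb-α f)))))))
    go : ∀ k → ⊕-sum (λ e → (orb e == o) ∧ arc d k e) ≡ (orb d == o) xor (orb (σ (iter σ k d)) == o)
    go zero = single d
    go (suc k) = trans (⊕-cong λ e → ∧-distribˡ-xor (orb e == o) ((f == e) xor (f == α e)) (arc d k e))
      (trans (⊕-xor (λ e → (orb e == o) ∧ ((f == e) xor (f == α e))) (λ e → (orb e == o) ∧ arc d k e))
      (trans (cong₂ _xor_ (single f) (go k))
      (solve 3 (λ f g d → (f :+ g) :+ (d :+ f) := d :+ g) refl (orb f == o) (orb (σ f) == o) (orb d == o))))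
      where
      f : Fin nD
      f = iter σ (suc k) d

  arc-symmetric : ∀ d k e → arc d k (α e) ≡ arc d k e
  arc-symmetric d zero e = trans (cong (λ e′ → (d == α e) xor (d == e′)) (α-invol e)) (xor-comm (d == α e) (d == e))
  arc-symmetric d (suc k) e = cong₂ _xor_
    (trans (cong (λ e′ → (f == α e) xor (f == e′)) (α-invol e)) (xor-comm (f == α e) (f == e))) (arc-symmetric d k e)
    where
    f : Fin nD
    f = iter σ (suc k) d

  iter-+ : ∀ i j d → iter σ (i + j) d ≡ iter σ i (iter σ j d)
  iter-+ zero j d = refl
  iter-+ (suc i) j d = cong σ (iter-+ i j d)

  module _ (p : Fin nD) (p₃≢p : φ (φ p) ≢ p) (zig : vert (φ (φ p)) ≡ vert p) (zag : vert (φ (φ (φ p))) ≡ vert (φ p)) where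
    private
      p₂ p₃ p₄ : Fin nD
      p₂ = φ p
      p₃ = φ p₂
      p₄ = φ p₃

      same-vertex : vert p₂ ≡ vert (α p₃)
      same-vertex = trans (sym zag) (vert-φ p₃)

      visit : ∃[ j ] (iter σ j p₂ ≡ α p₃ × (∀ i → i < j → iter σ i p₂ ≢ α p₃))
      visit = first-visit p₂ (α p₃) (proj₁ (σ-cycle p₂ (α p₃) same-vertex)) (proj₂ (σ-cycle p₂ (α p₃) same-vertex))

      k : ℕ
      k = proj₁ visit

      arrives : iter σ k p₂ ≡ α p₃
      arrives = proj₁ (proj₂ visit)

      -- Otherwise `α p₃` would be reached `i` steps earlier, against the minimality of `k`.
      no-return : ∀ i → 1 ≤ i → i ≤ k → iter σ i p₂ ≢ p₂
      no-return i 1≤i i≤k back = proj₂ (proj₂ visit) (k ℕ.∸ i) (ℕ.∸-monoʳ-< 1≤i i≤k) (begin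
        iter σ (k ℕ.∸ i) p₂ ≡⟨ cong (iter σ (k ℕ.∸ i)) back ⟨
        iter σ (k ℕ.∸ i) (iter σ i p₂) ≡⟨ iter-+ (k ℕ.∸ i) i p₂ ⟨
        iter σ ((k ℕ.∸ i) + i) p₂ ≡⟨ cong (λ j → iter σ j p₂) (ℕ.m∸n+n≡m i≤k) ⟩
        iter σ k p₂ ≡⟨ arrives ⟩
        α p₃ ∎)
        where open ≡-Reasoning

      -- `σ (α p)` is `p₂`: after `α p` the arc would either return to `p₂`, or end there, making
      -- `p₃` equal to `p`.
      not-αp : ∀ i → i ≤ k → iter σ i p₂ ≢ α p
      not-αp i i≤k eq with ℕ.m≤n⇒m<n∨m≡n i≤k
      ... | inj₁ i<k = no-return (suc i) (s≤s z≤n) i<k (cong σ eq)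
      ... | inj₂ refl = p₃≢p (trans (sym (α-invol p₃)) (trans (cong α (trans (sym arrives) eq)) (α-invol p)))

      away : ∀ i e → vert e ≢ vert p₂ → iter σ i p₂ ≢ e
      away i e ne eq = ne (trans (cong vert (sym eq)) (vert-iter i p₂))

      vert-p≢ : vert p ≢ vert p₂
      vert-p≢ eq = no-loops p (sym (trans eq (vert-φ p)))

      vert-αp₂≢ : vert (α p₂) ≢ vert p₂
      vert-αp₂≢ = no-loops p₂

      arc-p : ∀ j → j ≤ k → arc p₂ j p ≡ false
      arc-p zero j≤k = cong₂ _xor_ (==-≢ (away 0 p vert-p≢)) (==-≢ (not-αp 0 j≤k))
      arc-p (suc j) j<k = cong₂ _xor_ (cong₂ _xor_ (==-≢ (away (suc j) p vert-p≢)) (==-≢ (not-αp (suc j) j<k)))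
        (arc-p j (ℕ.<⇒≤ j<k))

      arc-p₂ : ∀ j → j ≤ k → arc p₂ j p₂ ≡ true
      arc-p₂ zero _ = cong₂ _xor_ (==-refl p₂) (==-≢ (away 0 (α p₂) vert-αp₂≢))
      arc-p₂ (suc j) j<k = cong₂ _xor_ (cong₂ _xor_ (==-≢ (no-return (suc j) (s≤s z≤n) j<k)) (==-≢ (away (suc j) (α p₂) vert-αp₂≢)))
        (arc-p₂ j (ℕ.<⇒≤ j<k))

      arc-even : FaceEven (arc p₂ k)
      arc-even = faceEven (arc-symmetric p₂ k) λ o → trans (arc-orbit p₂ k o)
        (trans (cong (λ o′ → (orb p₂ == o) xor (o′ == o)) (trans (cong (orb ∘ σ) arrives) (trans (orb-φ p₃) (orb-φ p₂))))
               (xor-same (orb p₂ == o)))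

      β : Fin nO → Fin nV
      β o = vert (proj₁ (orb-surj o))

      comp-β : ∀ o → comp (β o) ≡ compOf o
      comp-β o = trans (sym (compOf-orb (proj₁ (orb-surj o)))) (cong compOf (proj₂ (orb-surj o)))

    -- The darts `p₂` and `σ (α p₃)` lie on the same walk, so the arc between them around `vert p₂`
    -- is face-even and hence a coboundary. It contains the edge of `p₂` but not that of `p`,
    -- although both edges join the same two vertices.
    no-zigzag : ⊥
    no-zigzag = true≢false {arc p₂ k p₂} (arc-p₂ k ℕ.≤-refl) (begin
      arc p₂ k p₂ ≡⟨ δc p₂ ⟨
      c (vert p₂) xor c (vert (α p₂)) ≡⟨ cong₂ (λ v w → c v xor c w) (vert-φ p) (trans (sym (vert-φ p₂)) zig) ⟩
      c (vert (α p)) xor c (vert p) ≡⟨ xor-comm (c (vert (α p))) (c (vert p)) ⟩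
      c (vert p) xor c (vert (α p)) ≡⟨ δc p ⟩
      arc p₂ k p ≡⟨ arc-p k ℕ.≤-refl ⟩
      false ∎)
      where
      open ≡-Reasoning
      solution : ∃[ c ] ∃[ t ] Potential.Solves (arc p₂ k) arc-even β comp-β none c t
      solution = Potential.potential (arc p₂ k) arc-even β comp-β none
      c : Fin nV → Bool
      c = proj₁ solution
      δc : ∀ d → δ c d ≡ arc p₂ k d
      δc = proj₁ (proj₂ (proj₂ solution))

-- The colouring and its corrections

module Colouring (G : PlaneGraph) (v₀ : Fin (PlaneGraph.nV G)) (no-isolated : PlaneGraph.NoIsolated G)
  (no-loops : PlaneGraph.NoLoops G) (no-2-faces : PlaneGraph.No2Faces G) where

  open Map G

  open Planarity G v₀ no-isolated using (root; dart-at; module Potential)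

  head₀ : Fin nV → Fin nV
  head₀ v = vert (α (dart-at v))

  vert-dart-at : ∀ v → vert (dart-at v) ≡ v
  vert-dart-at v = proj₂ (no-isolated v)

  comp-root : ∀ k → comp (root k) ≡ k
  comp-root k = proj₂ (comp-surj k)

  -- v has a single neighbour, possibly along several parallel edges.
  leaf : Fin nV → Bool
  leaf v with find (λ d → (vert d == v) ∧ not (vert (α d) == head₀ v))
  ... | inj₁ _ = false
  ... | inj₂ _ = true

  leaf-head : ∀ {v} → leaf v ≡ true → ∀ d → vert d ≡ v → vert (α d) ≡ head₀ v
  leaf-head {v} h d dv with find (λ d → (vert d == v) ∧ not (vert (α d) == head₀ v))
  ... | inj₂ none′ = ==⇒≡ (≢false⇒≡true λ ne → true≢false
    (∧-intro (trans (cong (_== v) dv) (==-refl v)) (cong not ne)) (none′ d))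

  not-leaf : ∀ {v} → leaf v ≡ false → ∃[ d ] (vert d ≡ v × vert (α d) ≢ head₀ v)
  not-leaf {v} h with find (λ d → (vert d == v) ∧ not (vert (α d) == head₀ v))
  ... | inj₁ (d , h′) = d , ==⇒≡ (proj₁ (∧-true h′)) , λ eq → true≢false (proj₂ (∧-true {vert d == v} h′))
    (cong not (trans (cong (_== head₀ v) eq) (==-refl (head₀ v))))

  -- The vertices excused from having a cherry: leaves admit none, and the root is served by the
  -- prescribed edge.
  S₀ : Fin nV → Bool
  S₀ v = leaf v ∨ (root (comp v) == v)

  S₀-false : ∀ {v} → S₀ v ≡ false → leaf v ≡ false
  S₀-false {v} h = ≢true⇒≡false λ l → true≢false (cong (_∨ (root (comp v) == v)) l) h

  branching : ∀ v → S₀ v ≡ false → ∀ u → ∃[ d ] (vert d ≡ v × vert (α d) ≢ u)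
  branching v h u with head₀ v ≟ u
  ... | yes refl = not-leaf (S₀-false h)
  ... | no ne = dart-at v , vert-dart-at v , ne

  reach : ∀ v → ∃[ u ] (S₀ u ≡ true × Star Adj u v)
  reach v = root (comp v) , is-S₀ , comp-conn (root (comp v)) v (comp-root (comp v))
    where
    is-S₀ : S₀ (root (comp v)) ≡ true
    is-S₀ = trans (cong (leaf (root (comp v)) ∨_) (trans (cong (λ k → root k == root (comp v)) (comp-root (comp v)))
      (==-refl (root (comp v))))) (Bool.∨-zeroʳ (leaf (root (comp v))))

  open Corners G no-loops S₀ branching reach using (module Selection; head)
  open Selection no-isolated

  -- A second prescribed edge would raise the total to 3 |K| + 4 and spoil the rounding, so
  -- `cherry-set` is applied once for each component; `x` takes from each solution the part on its
  -- own component.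
  edges : ∀ k → ∃[ x ] (FaceEven x × (∀ p → K p ≡ true → x p ≡ true ⊎ x (φ p) ≡ true) × x (dart-at (root k)) ≡ true)
  edges k = Cherries.cherry-set G no-loops K K-independent K-apart (dart-at (root k))

  x : Fin nD → Bool
  x d = proj₁ (edges (comp (vert d))) d

  x-even : FaceEven x
  x-even = faceEven
    (λ d → trans (cong (λ k → proj₁ (edges k) (α d)) (comp-edge d)) (FaceEven.symmetric (proj₁ (proj₂ (edges (comp (vert d))))) d))
    (λ o → trans (⊕-cong (local o)) (FaceEven.even (proj₁ (proj₂ (edges (compOf o)))) o))
    where
    local : ∀ o d → (orb d == o) ∧ x d ≡ (orb d == o) ∧ proj₁ (edges (compOf o)) d
    local o d = by-case (bool-cases (orb d == o))
      where
      by-case : orb d == o ≡ true ⊎ orb d == o ≡ false → (orb d == o) ∧ x d ≡ (orb d == o) ∧ proj₁ (edges (compOf o)) d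
      by-case (inj₁ eq) = cong (λ k → (orb d == o) ∧ proj₁ (edges k) d)
        (trans (sym (compOf-orb d)) (cong compOf (==⇒≡ eq)))
      by-case (inj₂ ne) = trans (cong (_∧ x d) ne) (sym (cong (_∧ proj₁ (edges (compOf o)) d) ne))

  x-hits : ∀ p → K p ≡ true → x p ≡ true ⊎ x (φ p) ≡ true
  x-hits p Kp = Sum.map₂ (trans (cong (λ k → proj₁ (edges k) (φ p)) (trans (cong comp (vert-φ p)) (comp-edge p))))
    (proj₁ (proj₂ (proj₂ (edges (comp (vert p))))) p Kp)

  x-root : ∀ k → x (dart-at (root k)) ≡ true
  x-root k = trans (cong (λ k → proj₁ (edges k) (dart-at (root _))) (trans (cong comp (vert-dart-at (root k))) (comp-root k)))
    (proj₂ (proj₂ (proj₂ (edges k))))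

  -- The path from `f` to a component in the incidence graph has a first step, which is a walk of
  -- `f`.
  walk-of : ∀ f → ∃[ o ] faceOf o ≡ f
  walk-of f = first-step (tree-conn (inj₂ f) (inj₁ (comp v₀)))
    where
    first-step : Star BAdj (inj₂ f) (inj₁ (comp v₀)) → ∃[ o ] faceOf o ≡ f
    first-step ((o , inj₂ (refl , _)) ◅ _) = o , refl

  dart-of : Fin nO → Fin nD
  dart-of o = proj₁ (orb-surj o)

  orb-dart-of : ∀ o → orb (dart-of o) ≡ o
  orb-dart-of o = proj₂ (orb-surj o)

  β : Fin nO → Fin nV
  β o = vert (dart-of o)

  comp-β : ∀ o → comp (β o) ≡ compOf o
  comp-β o = trans (sym (compOf-orb (dart-of o))) (cong compOf (orb-dart-of o))

  -- Makes the first walk of a face differ from all its other walks at their base vertices.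
  y : Fin nO → Bool
  y o = not (proj₁ (walk-of (faceOf o)) == o)

  solution : ∃[ c ] ∃[ t ] Potential.Solves x x-even β comp-β y c t
  solution = Potential.potential x x-even β comp-β y

  c : Fin nV → Bool
  c = proj₁ solution

  t : Fin nF → Bool
  t = proj₁ (proj₂ solution)

  δc : ∀ d → δ c d ≡ x d
  δc = proj₁ (proj₂ (proj₂ solution))

  ct : ∀ o → c (β o) xor t (faceOf o) ≡ y o
  ct = proj₂ (proj₂ (proj₂ solution))

  xor-opposite : ∀ {p q} → p xor q ≡ true → q ≡ not p
  xor-opposite {true}  {false} _ = refl
  xor-opposite {false} {true}  _ = refl

  opposite-sym : ∀ {p q} → q ≡ not p → p ≡ not q
  opposite-sym {p} refl = sym (Bool.not-involutive p)

  c-edge : ∀ d → x d ≡ true → c (vert (α d)) ≡ not (c (vert d))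
  c-edge d xd = xor-opposite (trans (δc d) xd)

  -- A vertex with a single neighbour has no usable corner; it is recoloured at the end.
  c′ : Fin nV → Bool
  c′ v = if leaf v ∧ not (leaf (head₀ v)) then not (c (head₀ v)) else c v

  c′-inner : ∀ {v} → leaf v ≡ false → c′ v ≡ c v
  c′-inner {v} eq = cong (λ l → if l ∧ not (leaf (head₀ v)) then not (c (head₀ v)) else c v) eq

  c′-pendant : ∀ {v} → leaf v ≡ true → leaf (head₀ v) ≡ false → c′ v ≡ not (c (head₀ v))
  c′-pendant {v} eq eq′ = cong₂ (λ l l′ → if l ∧ not l′ then not (c (head₀ v)) else c v) eq eq′

  c′-pair : ∀ {v} → leaf v ≡ true → leaf (head₀ v) ≡ true → c′ v ≡ c v
  c′-pair {v} eq eq′ = cong₂ (λ l l′ → if l ∧ not l′ then not (c (head₀ v)) else c v) eq eq′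

  head₀-back : ∀ {u} → leaf u ≡ true → ∀ d → vert (α d) ≡ u → head₀ u ≡ vert d
  head₀-back l d eq = trans (sym (leaf-head l (α d) eq)) (cong vert (α-invol d))

  -- Two adjacent leaves make up a whole component. One of them is its root, so the prescribed edge
  -- joins the two and separates their colours.
  module Pair (v : Fin nV) (lv : leaf v ≡ true) (lu : leaf (head₀ v) ≡ true) where
    u : Fin nV
    u = head₀ v

    head-u : head₀ u ≡ v
    head-u = trans (head₀-back lu (dart-at v) refl) (vert-dart-at v)

    stays : ∀ {a b} → Star Adj a b → a ≡ v ⊎ a ≡ u → b ≡ v ⊎ b ≡ u
    stays ε h = h
    stays ((d , p , q) ◅ s) (inj₁ eq) = stays s (inj₂ (trans (sym q) (leaf-head lv d (trans p eq))))
    stays ((d , p , q) ◅ s) (inj₂ eq) = stays s (inj₁ (trans (sym q) (trans (leaf-head lu d (trans p eq)) head-u)))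

    r : Fin nV
    r = root (comp v)

    c-r : c (head₀ r) ≡ not (c r)
    c-r = trans (c-edge (dart-at r) (x-root (comp v))) (cong (not ∘ c) (vert-dart-at r))

    opposite : c u ≡ not (c v)
    opposite = by-root (stays (comp-conn v r (sym (comp-root (comp v)))) (inj₁ refl))
      where
      by-root : r ≡ v ⊎ r ≡ u → c u ≡ not (c v)
      by-root (inj₁ r≡v) = subst (λ r → c (head₀ r) ≡ not (c r)) r≡v c-r
      by-root (inj₂ r≡u) = opposite-sym (trans (cong c (sym head-u)) (subst (λ r → c (head₀ r) ≡ not (c r)) r≡u c-r))

  leaf-opposite : ∀ {v} → leaf v ≡ true → c′ (head₀ v) ≡ not (c′ v)
  leaf-opposite {v} lv = by-head (bool-cases (leaf (head₀ v)))
    where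
    by-head : leaf (head₀ v) ≡ true ⊎ leaf (head₀ v) ≡ false → c′ (head₀ v) ≡ not (c′ v)
    by-head (inj₂ inner) = trans (c′-inner inner) (opposite-sym (c′-pendant lv inner))
    by-head (inj₁ lu) = trans (c′-pair lu (trans (cong leaf head-u) lv)) (trans opposite (cong not (sym (c′-pair lv lu))))
      where open Pair v lv lu

  -- If the far end is a leaf, its only neighbour is the inner vertex `vert d`, and the recolouring
  -- makes it opposite to that vertex.
  inner-opposite : ∀ d → leaf (vert d) ≡ false → x d ≡ true → c′ (vert (α d)) ≡ not (c′ (vert d))
  inner-opposite d inner xd = by-leaf (bool-cases (leaf (vert (α d))))
    where
    by-leaf : leaf (vert (α d)) ≡ true ⊎ leaf (vert (α d)) ≡ false → c′ (vert (α d)) ≡ not (c′ (vert d))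
    by-leaf (inj₂ inner′) = trans (c′-inner inner′) (trans (c-edge d xd) (cong not (sym (c′-inner inner))))
    by-leaf (inj₁ l) = trans (c′-pendant l (trans (cong leaf back) inner)) (cong not (trans (cong c back) (sym (c′-inner inner))))
      where
      back : head₀ (vert (α d)) ≡ vert d
      back = head₀-back l d refl

  Dominated : Fin nV → Set
  Dominated v = ∃[ d ] (vert d ≡ v × c′ (vert (α d)) ≡ not (c′ v))

  inner-dominated : ∀ {v} d → vert d ≡ v → leaf v ≡ false → x d ≡ true → Dominated v
  inner-dominated d refl inner xd = d , refl , inner-opposite d inner xd

  dominated : ∀ v → Dominated v
  dominated v = by-case (bool-cases (leaf v)) (bool-cases (S₀ v))
    where
    at-corner : leaf v ≡ false → S₀ v ≡ false → x (corner v) ≡ true ⊎ x (φ (corner v)) ≡ true → Dominated v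
    at-corner inner v∉ (inj₁ xp) = inner-dominated (α (corner v)) (trans (sym (vert-φ (corner v))) (corner-centre v v∉)) inner
      (trans (FaceEven.symmetric x-even (corner v)) xp)
    at-corner inner v∉ (inj₂ xp) = inner-dominated (φ (corner v)) (corner-centre v v∉) inner xp
    by-case : leaf v ≡ true ⊎ leaf v ≡ false → S₀ v ≡ true ⊎ S₀ v ≡ false → Dominated v
    by-case (inj₁ l) _ = dart-at v , vert-dart-at v , leaf-opposite l
    by-case (inj₂ inner) (inj₁ v∈) = inner-dominated (dart-at v) (vert-dart-at v) inner
      (subst (λ v → x (dart-at v) ≡ true) (==⇒≡ (trans (sym (cong (_∨ (root (comp v) == v)) inner)) v∈)) (x-root (comp v)))
    by-case (inj₂ inner) (inj₂ v∉) = at-corner inner v∉ (x-hits (corner v) (K-corner v v∉))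

  Bichromatic : Fin nF → Set
  Bichromatic f = ∃[ v ] ∃[ w ] (OnFace f v × OnFace f w × c′ w ≡ not (c′ v))

  -- A walk through a leaf continues to its only neighbour.
  leaf-on-face : ∀ {f} d → faceOf (orb d) ≡ f → leaf (vert d) ≡ true → Bichromatic f
  leaf-on-face d df l = vert d , vert (φ d) , (d , df , refl) , (φ d , trans (cong faceOf (orb-φ d)) df , refl)
    , trans (cong c′ (trans (vert-φ d) (leaf-head l d refl))) (leaf-opposite l)

  -- Transfers a colour difference from `c` to `c′`: the recolouring changes leaves only, and a face
  -- with a leaf has both colours anyway.
  differ : ∀ {f} d e → faceOf (orb d) ≡ f → faceOf (orb e) ≡ f → c (vert e) ≡ not (c (vert d)) → Bichromatic f
  differ {f} d e df ef opp = by-leaf (bool-cases (leaf (vert d))) (bool-cases (leaf (vert e)))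
    where
    by-leaf : leaf (vert d) ≡ true ⊎ leaf (vert d) ≡ false → leaf (vert e) ≡ true ⊎ leaf (vert e) ≡ false → Bichromatic f
    by-leaf (inj₁ l) _ = leaf-on-face d df l
    by-leaf (inj₂ _) (inj₁ l) = leaf-on-face e ef l
    by-leaf (inj₂ id) (inj₂ ie) = vert d , vert e , (d , df , refl) , (e , ef , refl)
      , trans (c′-inner ie) (trans opp (cong not (sym (c′-inner id))))

  module OneWalk (f : Fin nF) (o : Fin nO) (o-f : faceOf o ≡ f) (alone : ∀ o′ → faceOf o′ ≡ f → o′ ≡ o) where
    p : Fin nD
    p = dart-of o

    on-face : ∀ {d} → orb d ≡ o → faceOf (orb d) ≡ f
    on-face eq = trans (cong faceOf eq) o-f

    spread-bichromatic : ∀ q → orb q ≡ o → spread q ≡ true → Bichromatic f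
    spread-bichromatic q qo hq = hit (x-hits q′ (proj₂ (proj₂ covered)))
      where
      covered : ∃[ q′ ] (orb q′ ≡ orb q × K q′ ≡ true)
      covered = K-covers q hq
      q′ : Fin nD
      q′ = proj₁ covered
      q′o : orb q′ ≡ o
      q′o = trans (proj₁ (proj₂ covered)) qo
      edge : ∀ e → orb e ≡ o → x e ≡ true → Bichromatic f
      edge e eo xe = differ e (φ e) (on-face eo) (on-face (trans (orb-φ e) eo)) (trans (cong c (vert-φ e)) (c-edge e xe))
      hit : x q′ ≡ true ⊎ x (φ q′) ≡ true → Bichromatic f
      hit (inj₁ h) = edge q′ q′o h
      hit (inj₂ h) = edge (φ q′) (trans (orb-φ q′) q′o) h

    module NoSpread (no-spread : ∀ q → (orb q == o) ∧ spread q ≡ false) where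
      zig : ∀ q → orb q ≡ o → vert (φ (φ q)) ≡ vert q
      zig q qo = trans (vert-φ (φ q)) (sym (==⇒≡ (≢false⇒≡true λ ne → true≢false
        (∧-intro (trans (cong (_== o) qo) (==-refl o)) (cong not ne)) (no-spread q))))

      long : φ (φ p) ≢ p → ⊥
      long ne = Zigzag.no-zigzag G v₀ no-isolated no-loops p ne (zig p (orb-dart-of o))
        (zig (φ p) (trans (orb-φ p) (orb-dart-of o)))

      module Short (φφp : φ (φ p) ≡ p) where
        two-darts : ∀ k → iter φ k p ≡ p ⊎ iter φ k p ≡ φ p
        two-darts zero = inj₁ refl
        two-darts (suc k) = Sum.swap (Sum.map (cong φ) (λ eq → trans (cong φ eq) φφp) (two-darts k))

        φp≢p : φ p ≢ p
        φp≢p eq = no-loops p (trans (sym (vert-φ p)) (cong vert eq))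

        in-face : ∀ d → does (faceOf (orb d) ≟ f) ≡ (p == d) xor (φ p == d)
        in-face d = by-face (faceOf (orb d) ≟ f)
          where
          turn : faceOf (orb d) ≡ f → ∃[ k ] iter φ k p ≡ d
          turn df = orb-cyc p d (trans (orb-dart-of o) (sym (alone (orb d) df)))
          member : ∀ {e} → e ≡ d → e ≡ p ⊎ e ≡ φ p → (p == d) xor (φ p == d) ≡ true
          member refl (inj₁ eq) = subst (λ d → (p == d) xor (φ p == d) ≡ true) (sym eq) (cong₂ _xor_ (==-refl p) (==-≢ φp≢p))
          member refl (inj₂ eq) = subst (λ d → (p == d) xor (φ p == d) ≡ true) (sym eq) (cong₂ _xor_ (==-≢ (φp≢p ∘ sym)) (==-refl (φ p)))
          by-face : (r : Dec (faceOf (orb d) ≡ f)) → does r ≡ (p == d) xor (φ p == d)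
          by-face (yes df) = sym (member (proj₂ (turn df)) (two-darts (proj₁ (turn df))))
          by-face (no ¬df) = sym (cong₂ _xor_
            (==-≢ λ eq → ¬df (on-face (trans (cong orb (sym eq)) (orb-dart-of o))))
            (==-≢ λ eq → ¬df (on-face (trans (cong orb (sym eq)) (trans (orb-φ p) (orb-dart-of o))))))

        length-2 : faceLength f ≡ 2
        length-2 = trans (count≡size (λ d → ⌊ faceOf (orb d) ≟ f ⌋))
          (trans (size-cong λ d → trans (isYes≗does (faceOf (orb d) ≟ f)) (in-face d))
          (trans (size-insert (p ==_) (φ p) (==-≢ (φp≢p ∘ sym))) (cong suc (size-indicator p))))

      -- A walk without cherries alternates between two vertices. It has either two darts, and then
      -- `f` is a 2-face because no other walk bounds it, or more, and then it is a zigzag.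
      impossible : ⊥
      impossible = by-length (φ (φ p) ≟ p)
        where
        by-length : Dec (φ (φ p) ≡ p) → ⊥
        by-length (yes φφp) = no-2-faces f (Short.length-2 φφp)
        by-length (no ne) = long ne

    bichromatic : Bichromatic f
    bichromatic = go (find (λ q → (orb q == o) ∧ spread q))
      where
      go : (∃[ q ] (orb q == o) ∧ spread q ≡ true) ⊎ (∀ q → (orb q == o) ∧ spread q ≡ false) → Bichromatic f
      go (inj₁ (q , h)) = spread-bichromatic q (==⇒≡ (proj₁ (∧-true h))) (proj₂ (∧-true {orb q == o} h))
      go (inj₂ no-spread) = ⊥-elim (NoSpread.impossible no-spread)

  bichromatic : ∀ f → Bichromatic f
  bichromatic f = go (find (λ o′ → (faceOf o′ == f) ∧ not (o == o′)))
    where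
    o : Fin nO
    o = proj₁ (walk-of f)
    o-f : faceOf o ≡ f
    o-f = proj₂ (walk-of f)
    y-at : ∀ o′ → faceOf o′ ≡ f → y o′ ≡ not (o == o′)
    y-at o′ eq = cong (λ f → not (proj₁ (walk-of f) == o′)) eq
    two : ∀ o′ → faceOf o′ ≡ f → not (o == o′) ≡ true → Bichromatic f
    two o′ o′f ne = differ (dart-of o) (dart-of o′) (trans (cong faceOf (orb-dart-of o)) o-f)
      (trans (cong faceOf (orb-dart-of o′)) o′f)
      -- Both equations contain the same `t f`; it cancels and leaves a comparison of the two
      -- colours.
      (opposed (c (β o)) (c (β o′)) (t f)
        (trans (cong (λ f → c (β o) xor t f) (sym o-f)) (trans (ct o) (trans (y-at o o-f) (cong not (==-refl o)))))
        (trans (cong (λ f → c (β o′) xor t f) (sym o′f)) (trans (ct o′) (trans (y-at o′ o′f) ne))))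
      where
      opposed : ∀ p q s → p xor s ≡ false → q xor s ≡ true → q ≡ not p
      opposed true  false true  _ _ = refl
      opposed false true  false _ _ = refl
    go : (∃[ o′ ] (faceOf o′ == f) ∧ not (o == o′) ≡ true) ⊎ (∀ o′ → (faceOf o′ == f) ∧ not (o == o′) ≡ false) → Bichromatic f
    go (inj₁ (o′ , h)) = two o′ (==⇒≡ (proj₁ (∧-true h))) (proj₂ (∧-true {faceOf o′ == f} h))
    go (inj₂ none′) = OneWalk.bichromatic f o o-f λ o′ o′f → sym (==⇒≡ (≢false⇒≡true λ ne → true≢false
      (∧-intro (trans (cong (_== f) o′f) (==-refl f)) (cong not ne)) (none′ o′)))

-- The two colour classes

∈-tabulate : ∀ {n} (g : Fin n → Bool) {v} → g v ≡ true → v ∈ tabulate g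
∈-tabulate g {v} gv = lookup⇒[]= v (tabulate g) (trans (lookup∘tabulate g v) gv)

tabulate-∈ : ∀ {n} (g : Fin n → Bool) {v} → v ∈ tabulate g → g v ≡ true
tabulate-∈ g {v} v∈ = trans (sym (lookup∘tabulate g v)) ([]=⇒lookup v∈)

theorem1 : (G : PlaneGraph) → let open PlaneGraph G in
    1 ≤ nV → NoIsolated → NoLoops → No2Faces →
    ∃[ V₁ ] ∃[ V₂ ] (Disjoint V₁ V₂ × Dominating V₁ × FaceHitting V₁
    × Dominating V₂ × FaceHitting V₂)
theorem1 G 1≤nV no-isolated no-loops no-2-faces =
    tabulate c′ , tabulate (not ∘ c′)
  , (λ v v∈₁ v∈₂ → true≢false (tabulate-∈ (not ∘ c′) v∈₂) (cong not (tabulate-∈ c′ v∈₁)))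
  , (λ v v∉ → let (d , dv , opp) = dominated v in
      vert (α d) , (d , dv , refl) , ∈-tabulate c′ (trans opp (cong not (≢true⇒≡false (v∉ ∘ ∈-tabulate c′)))))
  , (λ f → let (v , w , vf , wf , opp) = bichromatic f in either c′ opp vf wf)
  , (λ v v∉ → let (d , dv , opp) = dominated v in
      vert (α d) , (d , dv , refl) , ∈-tabulate (not ∘ c′)
        (cong not (trans opp (≢true⇒≡false (v∉ ∘ ∈-tabulate (not ∘ c′))))))
  , (λ f → let (v , w , vf , wf , opp) = bichromatic f in either (not ∘ c′) (cong not opp) vf wf)
  where
  open PlaneGraph G
  open Colouring G (fromℕ< 1≤nV) no-isolated no-loops no-2-faces
  either : ∀ (g : Fin nV → Bool) {f v w} → g w ≡ not (g v) → OnFace f v → OnFace f w →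
           ∃[ u ] (OnFace f u × u ∈ tabulate g)
  either g {v = v} {w} opp vf wf with bool-cases (g v)
  ... | inj₁ gv = v , vf , ∈-tabulate g gv
  ... | inj₂ gv = w , wf , ∈-tabulate g (trans opp (cong not gv))
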